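{- (1) There exists a loopless matroid $\mathsf{M}$ such that the sequence of coefficients of $\mathrm{H}_\mathsf{M}^{\mathcal{G}_{\min}}(x)$ is not log-concave. (2) There exists $N$ such that for every $n\ge N$ there is a building set $\mathcal{G}$ on the Boolean matroid $\mathsf{U}_{n,n}$ for which the sequence of coefficients of $\mathrm{H}_{\mathsf{U}_{n,n}}^{\mathcal{G}}(x)$ is not log-concave.
   Context: A matroid $\mathsf{M}=(E,\operatorname{rk})$ is a polymatroid (finite $E$, $\operatorname{rk}:2^E\to\mathbb{Z}_{\ge0}$ with $\operatorname{rk}(\varnothing)=0$, monotone, submodular) with $\operatorname{rk}(A)\le|A|$ for all $A$. Flats: $F$ with $\operatorname{rk}(F\cup\{e\})>\operatorname{rk}(F)$ for $e\notin F$; lattice $\mathcal L(\mathsf{M})$ with join $\vee$; loopless means $\varnothing$ is a flat. The Boolean matroid $\mathsf{U}_{n,n}$ has ground set $[n]$ and $\operatorname{rk}(A)=|A|$. $f(\mathcal{G})$ = inclusion-maximal elements of a set $\mathcal{G}$ of flats, $\mathcal{G}_{\le F}=\{G\in\mathcal{G}:G\subseteq F\}$. A building set is $\mathcal{G}\subseteq\mathcal L(\mathsf{M})\setminus\{\varnothing\}$ such that for every flat $F$ the map $\prod_{G\in f(\mathcal{G}_{\le F})}[\varnothing,G]\to[\varnothing,F]$, $(F_G)\mapsto\bigvee F_G$, is a lattice isomorphism and $\operatorname{rk}(F)=\sum_{G\in f(\mathcal{G}_{\le F})}\operatorname{rk}(G)$. $\mathcal{G}_{\min}$ is the building set of nonempty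 flats $F$ for which $\mathcal L(\mathsf{M}|_F)\cong[\varnothing,F]$ is not isomorphic to a product of two nontrivial lattices (connected flats). The Chow ring $D(\mathsf{M},\mathcal{G})$ is $\mathbb{Q}[x_G:G\in\mathcal{G}]$ (degree-1 generators) modulo the ideal generated by $\big(\prod_{i=1}^m x_{G_i}\big)\big(\sum_{H\in\mathcal{G},H\supseteq G}x_H\big)^{\operatorname{rk}(G)-\operatorname{rk}(\sup(S,G))}$ for each subset $S=\{G_1,\dots,G_m\}\subseteq\mathcal{G}$ and $G\in\mathcal{G}$, where $\sup(S,G)=\bigvee_{G'\in S,\,G'\subsetneq G}G'$; $\mathrm{H}_\mathsf{M}^{\mathcal{G}}(x)=\sum_i\dim D^i(\mathsf{M},\mathcal{G})x^i$. A sequence $(a_0,\dots,a_d)$ is log-concave if $a_i^2\ge a_{i-1}a_{i+1}$ for all $0<i<d$. -}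

module Defs where

open import Level using (0ℓ)
open import Data.Nat using (ℕ; zero; suc; _+_; _*_; _∸_; _≤_; _<_; _≡ᵇ_; z≤n; s≤s)
open import Data.Nat.Properties using (≤-refl; +-suc; n≤1+n; m≤n⇒m≤1+n; +-mono-≤; +-comm)
import Data.Nat.Properties as ℕP
open import Data.Bool using (Bool; true; false; not; _∧_; _∨_; if_then_else_)
open import Data.Fin using (Fin)
open import Data.Fin.Subset using (Subset; ⊥; ⁅_⁆; _∪_; _∩_; _⊆_; _⊂_; ∣_∣; _∉_; inside; outside)
open import Data.Fin.Subset.Properties using (_⊆?_; _∈?_; p⊆q⇒∣p∣≤∣q∣)
open import Data.Vec as V using (Vec; []; _∷_; tabulate; lookup; replicate; zipWith)
import Data.Vec.Properties as VP
import Data.Vec.Relation.Unary.All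
import Data.Fin
open import Data.List as L using (List; []; _∷_; map; filter; concatMap; foldr; allFin; length; _++_; any)
open import Data.List.Relation.Unary.All using (All)
open import Data.List.Relation.Unary.Unique.Propositional using (Unique)
import Data.List.Membership.Propositional as LM
open import Data.Rational using (ℚ; 0ℚ; 1ℚ; -_) renaming (_+_ to _+ℚ_; _*_ to _*ℚ_)
open import Data.Product using (Σ; Σ-syntax; ∃; _×_; _,_; proj₁; proj₂)
open import Relation.Nullary using (¬_; does; Dec; _×-dec_; ¬?)
open import Data.List.Relation.Unary.Any using (any?)
open import Data.Nat.ListAction using (sum)
open import Relation.Binary.PropositionalEquality using (_≡_; _≢_; refl; cong)
open import Relation.Binary.Lattice.Bundles using (Lattice)
open import Function using (_⇔_)


-- Polynomials over ℚ in k commuting variables x_0 … x_{k-1}, represented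
-- as finite lists of terms (coefficient , exponent vector); two
-- polynomials are equal when all their coefficients agree.

Monomial : ℕ → Set
Monomial k = Vec ℕ k

Poly : ℕ → Set
Poly k = List (ℚ × Monomial k)

module _ {k : ℕ} where

  coeff : Poly k → Monomial k → ℚ
  coeff []             e = 0ℚ
  coeff ((c , m) ∷ p) e = (if does (VP.≡-dec ℕP._≟_ m e) then c else 0ℚ) +ℚ coeff p e

  _≈P_ : Poly k → Poly k → Set
  p ≈P q = ∀ (e : Monomial k) → coeff p e ≡ coeff q e

  0P : Poly k
  0P = []

  1P : Poly k
  1P = (1ℚ , replicate k 0) ∷ []

  var : Fin k → Poly k
  var j = (1ℚ , tabulate (λ i → if does (i Data.Fin.≟ j) then 1 else 0)) ∷ []

  _+P_ : Poly k → Poly k → Poly k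
  p +P q = p ++ q

  _·P_ : ℚ → Poly k → Poly k
  c ·P p = map (λ t → (c *ℚ proj₁ t , proj₂ t)) p

  -P_ : Poly k → Poly k
  -P p = map (λ t → (- proj₁ t , proj₂ t)) p

  _*P_ : Poly k → Poly k → Poly k
  p *P q = concatMap (λ t → map (λ u → (proj₁ t *ℚ proj₁ u , zipWith _+_ (proj₂ t) (proj₂ u))) q) p

  _^P_ : Poly k → ℕ → Poly k
  p ^P zero  = 1P
  p ^P suc r = p *P (p ^P r)

  ΣP : List (Poly k) → Poly k
  ΣP = foldr _+P_ 0P

  ΠP : List (Poly k) → Poly k
  ΠP = foldr _*P_ 1P

  Homogeneous : ℕ → Poly k → Set
  Homogeneous i p = All (λ t → V.sum (proj₂ t) ≡ i) p

  InIdeal : {Gen : Set} → (Gen → Poly k) → Poly k → Set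
  InIdeal {Gen} gen p = Σ (List (Poly k × Gen)) λ l →
                          p ≈P ΣP (map (λ t → proj₁ t *P gen (proj₂ t)) l)

  lincomb : ∀ {d} → Vec ℚ d → Vec (Poly k) d → Poly k
  lincomb c B = ΣP (V.toList (zipWith _·P_ c B))

  -- the degree-i part of Q[x]/I has dimension d: there are d homogeneous
  -- polynomials of degree i whose classes form a basis of it.
  DegreeDim : {Gen : Set} → (Gen → Poly k) → ℕ → ℕ → Set
  DegreeDim gen i d = Σ (Vec (Poly k) d) λ B →
      Data.Vec.Relation.Unary.All.All (Homogeneous i) B
    × (∀ p → Homogeneous i p → Σ (Vec ℚ d) λ c → InIdeal gen (p +P (-P lincomb c B)))
    × (∀ c → InIdeal gen (lincomb c B) → ∀ j → lookup c j ≡ 0ℚ)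

  -- the coefficient sequence (a_0, a_1, …) of the Hilbert series of Q[x]/I
  -- is not log-concave: a_i² < a_{i-1} a_{i+1} for some i ≥ 1
  -- (written with i-1 shifted to i).
  NotLogConcave : {Gen : Set} → (Gen → Poly k) → Set
  NotLogConcave gen = Σ ℕ λ i → Σ ℕ λ a → Σ ℕ λ b → Σ ℕ λ c →
      DegreeDim gen i a × DegreeDim gen (suc i) b × DegreeDim gen (suc (suc i)) c
    × (b * b < a * c)

record Matroid (n : ℕ) : Set where
  field
    rk        : Subset n → ℕ
    rk-⊥      : rk ⊥ ≡ 0
    rk-mono   : ∀ {A B : Subset n} → A ⊆ B → rk A ≤ rk B
    rk-submod : ∀ (A B : Subset n) → rk (A ∪ B) + rk (A ∩ B) ≤ rk A + rk B
    rk-≤card  : ∀ (A : Subset n) → rk A ≤ ∣ A ∣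

_⊆ᵇ_ : ∀ {n} → Subset n → Subset n → Bool
A ⊆ᵇ B = does (A ⊆? B)

_⊂?_ : ∀ {n} (A B : Subset n) → Dec (A ⊆ B × ¬ (B ⊆ A))
A ⊂? B = (A ⊆? B) ×-dec ¬? (B ⊆? A)

⋃ : ∀ {n} → List (Subset n) → Subset n
⋃ = foldr _∪_ ⊥

module _ {n : ℕ} (M : Matroid n) where
  open Matroid M

  IsFlat : Subset n → Set
  IsFlat F = ∀ (e : Fin n) → e ∉ F → rk F < rk (F ∪ ⁅ e ⁆)

  Loopless : Set
  Loopless = IsFlat ⊥

  -- closure; the join of flats F, G in the lattice of flats is cl (F ∪ G),
  -- the meet is F ∩ G, and the bottom is cl ⊥.
  cl : Subset n → Subset n
  cl A = tabulate (λ e → rk (A ∪ ⁅ e ⁆) ≡ᵇ rk A)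

  ⋁ : List (Subset n) → Subset n
  ⋁ Fs = cl (⋃ Fs)

  record IntervalIso (F : Subset n) (L₁ L₂ : Lattice 0ℓ 0ℓ 0ℓ) : Set where
    module L₁ = Lattice L₁
    module L₂ = Lattice L₂
    _≈×_ : (L₁.Carrier × L₂.Carrier) → (L₁.Carrier × L₂.Carrier) → Set
    (a , b) ≈× (c , d) = (a L₁.≈ c) × (b L₂.≈ d)
    _∨×_ : (L₁.Carrier × L₂.Carrier) → (L₁.Carrier × L₂.Carrier) → (L₁.Carrier × L₂.Carrier)
    (a , b) ∨× (c , d) = (a L₁.∨ c) , (b L₂.∨ d)
    _∧×_ : (L₁.Carrier × L₂.Carrier) → (L₁.Carrier × L₂.Carrier) → (L₁.Carrier × L₂.Carrier)
    (a , b) ∧× (c , d) = (a L₁.∧ c) , (b L₂.∧ d)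
    field
      to      : Subset n → L₁.Carrier × L₂.Carrier
      from    : L₁.Carrier × L₂.Carrier → Subset n
      from-flat : ∀ p → IsFlat (from p) × from p ⊆ F
      from-cong : ∀ p q → p ≈× q → from p ≡ from q
      from-to : ∀ G → IsFlat G → G ⊆ F → from (to G) ≡ G
      to-from : ∀ p → to (from p) ≈× p
      to-∨    : ∀ G H → IsFlat G → G ⊆ F → IsFlat H → H ⊆ F →
                to (cl (G ∪ H)) ≈× (to G ∨× to H)
      to-∧    : ∀ G H → IsFlat G → G ⊆ F → IsFlat H → H ⊆ F →
                to (G ∩ H) ≈× (to G ∧× to H)

  Nontrivial : Lattice 0ℓ 0ℓ 0ℓ → Set
  Nontrivial L = Σ (Lattice.Carrier L) λ x → Σ (Lattice.Carrier L) λ y → ¬ (Lattice._≈_ L x y)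

  Decomposable : Subset n → Set₁
  Decomposable F = Σ (Lattice 0ℓ 0ℓ 0ℓ) λ L₁ → Σ (Lattice 0ℓ 0ℓ 0ℓ) λ L₂ →
                   Nontrivial L₁ × Nontrivial L₂ × IntervalIso F L₁ L₂

  IsConnectedFlat : Subset n → Set₁
  IsConnectedFlat F = IsFlat F × (F ≢ ⊥) × ¬ Decomposable F

  IsGminList : List (Subset n) → Set₁
  IsGminList Gs = Unique Gs × (∀ F → (F LM.∈ Gs → IsConnectedFlat F) × (IsConnectedFlat F → F LM.∈ Gs))

  module _ (𝒢 : List (Subset n)) where

    maxBelow : Subset n → List (Subset n)
    maxBelow F = filter (λ G → (G ⊆? F) ×-dec ¬? (any? (λ G′ → (G′ ⊆? F) ×-dec (G ⊂? G′)) 𝒢)) 𝒢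

    BuildingCondition : Subset n → Set
    BuildingCondition F =
      let ms = maxBelow F
          m  = length ms
          Gi : Fin m → Subset n
          Gi i = L.lookup ms i
          InProd : (Fin m → Subset n) → Set
          InProd t = ∀ i → IsFlat (t i) × t i ⊆ Gi i
          Φ : (Fin m → Subset n) → Subset n
          Φ t = ⋁ (map t (allFin m))
      in  -- the join map ∏ [∅,G] → [∅,F] is a lattice isomorphism
          (∀ t t′ → InProd t → InProd t′ → Φ t ≡ Φ t′ → ∀ i → t i ≡ t′ i)
        × (∀ H → IsFlat H → H ⊆ F → Σ (Fin m → Subset n) λ t → InProd t × Φ t ≡ H)
        × (∀ t t′ → InProd t → InProd t′ → Φ (λ i → cl (t i ∪ t′ i)) ≡ cl (Φ t ∪ Φ t′))
        × (∀ t t′ → InProd t → InProd t′ → Φ (λ i → t i ∩ t′ i) ≡ Φ t ∩ Φ t′)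
        × (rk F ≡ sum (map rk ms))

    IsBuildingSet : Set
    IsBuildingSet = Unique 𝒢
                  × (∀ G → G LM.∈ 𝒢 → IsFlat G × G ≢ ⊥)
                  × (∀ F → IsFlat F → BuildingCondition F)

    -- Chow ring D(M,𝒢): variables x_G (G ∈ 𝒢) indexed by positions in 𝒢;
    -- one generator of the ideal for each S ⊆ 𝒢 (a Subset of positions)
    -- and each G ∈ 𝒢.
    ChowGen : Subset (length 𝒢) × Fin (length 𝒢) → Poly (length 𝒢)
    ChowGen (S , j) =
      let k   = length 𝒢
          Gat = L.lookup 𝒢
          G   = Gat j
          idxS  = filter (λ i → i ∈? S) (allFin k)
          supSG = ⋁ (map Gat (filter (λ i → Gat i ⊂? G) idxS))
          above = filter (λ i → G ⊆? Gat i) (allFin k)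
      in ΠP (map var idxS) *P (ΣP (map var above) ^P (rk G ∸ rk supSG))

    ChowNotLogConcave : Set
    ChowNotLogConcave = NotLogConcave ChowGen

private
  ∣∪∣+∣∩∣ : ∀ {n} (A B : Subset n) → ∣ A ∪ B ∣ + ∣ A ∩ B ∣ ≡ ∣ A ∣ + ∣ B ∣
  ∣∪∣+∣∩∣ [] [] = refl
  ∣∪∣+∣∩∣ (outside ∷ A) (outside ∷ B) = ∣∪∣+∣∩∣ A B
  ∣∪∣+∣∩∣ (outside ∷ A) (inside ∷ B) rewrite +-suc ∣ A ∣ ∣ B ∣ = cong suc (∣∪∣+∣∩∣ A B)
  ∣∪∣+∣∩∣ (inside ∷ A) (outside ∷ B) = cong suc (∣∪∣+∣∩∣ A B)
  ∣∪∣+∣∩∣ (inside ∷ A) (inside ∷ B) rewrite +-suc ∣ A ∪ B ∣ ∣ A ∩ B ∣ | +-suc ∣ A ∣ ∣ B ∣ =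
    cong (λ x → suc (suc x)) (∣∪∣+∣∩∣ A B)

U : (n : ℕ) → Matroid n
U n = record
  { rk        = ∣_∣
  ; rk-⊥      = ∣⊥∣ n
  ; rk-mono   = p⊆q⇒∣p∣≤∣q∣
  ; rk-submod = λ A B → ℕP.≤-reflexive (∣∪∣+∣∩∣ A B)
  ; rk-≤card  = λ A → ≤-refl
  }
  where
    ∣⊥∣ : ∀ m → ∣ ⊥ {m} ∣ ≡ 0
    ∣⊥∣ zero = refl
    ∣⊥∣ (suc m) = ∣⊥∣ m

{-# OPTIONS --safe #-}
-- The Chow ring of a building set is made to have a small low degree part.  Take a chain of
-- members G ⊂ H ⊂ T whose ranks start at 4 or more and jump by at least 3, seven hyperplanes
-- P a of T that are incomparable with H and G and join pairwise, and with G, to T, and all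
-- singletons.  The singleton variables are eliminated by linear relations, x_P x_F = 0 for every
-- other non-singleton F, and all remaining relations have degree at least 4.  Hence in degrees
-- ≤ 3 the ring is ℚ[t,h,g] with seven extra coordinate axes attached, with dimensions
-- 3 + 7, 6 + 7, 10 + 7 in degrees 1, 2, 3, and 13² = 169 < 170 = 10 · 17.
-- Spanning is a rewriting argument.  For independence, points of the union of the 3-space and the
-- axes, extended to the singleton coordinates by the linear relations, kill all generators of
-- degree ≤ 3, so evaluating the degree d component there gives functionals that vanish on the
-- ideal, and suitable combinations of them are dual to the monomial basis.
-- On the Boolean matroid of rank n ≥ 13 the family consists of initial segments of sizes
-- 7, 10, 13 and complements of points in the last one.  For G_min, the same family arises as the
-- cyclic flats of a rank 10 matroid on 13 points, with chain of ranks 4, 7, 10 and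
-- seven circuit-hyperplanes P a.
module Submission where

open import Defs
open import Level using (0ℓ)
open import Data.Bool using (Bool; true; false; if_then_else_)
import Data.Bool.Properties as BoolP
open import Data.Empty using (⊥; ⊥-elim)
open import Data.Fin as F using (Fin; zero; suc; toℕ)
open import Data.Fin.Patterns
import Data.Fin.Properties as FP
open import Data.Fin.Subset as Sub using (Subset; ⁅_⁆; _∪_; _∩_; _∈_; _∉_; _⊆_; ∣_∣; inside; outside; _─_)
import Data.Fin.Subset.Properties as SP
open import Data.List as L using (List; []; _∷_; map; length; _++_; allFin; filter)
open import Data.List.Membership.Propositional using (find) renaming (_∈_ to _∈ˡ_)
import Data.List.Membership.Propositional.Properties as MP
import Data.List.Membership.Propositional.Properties.WithK as MPK
import Data.List.Properties as LP
open import Data.List.Relation.Binary.BagAndSetEquality using (∼bag⇒↭)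
open import Data.List.Relation.Binary.Permutation.Propositional as Perm using (_↭_)
import Data.List.Relation.Binary.Permutation.Propositional.Properties as PermP
open import Data.List.Relation.Unary.All as All using (All; []; _∷_)
import Data.List.Relation.Unary.All.Properties as AllP
open import Data.List.Relation.Unary.AllPairs using ([]; _∷_)
open import Data.List.Relation.Unary.Any as Any using (here; there; any?)
import Data.List.Relation.Unary.Any.Properties as AnyP
open import Data.List.Relation.Unary.Unique.Propositional using (Unique)
import Data.List.Relation.Unary.Unique.Propositional.Properties as UP
open import Data.Nat using (ℕ; zero; suc; _≤_; _<_; z≤n; s≤s; _+_; _∸_; _⊓_)
open import Data.Nat.ListAction using (sum)
import Data.Nat.Properties as ℕP
open import Data.Product using (Σ; ∃; _×_; _,_; proj₁; proj₂)
open import Data.Rational using (ℚ; 0ℚ; 1ℚ; ½; -_) renaming (_+_ to _+ℚ_; _*_ to _*ℚ_)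
import Data.Rational.Properties as ℚP
open import Data.Rational.Solver using (module +-*-Solver)
open import Data.Sum as Sum using (_⊎_; inj₁; inj₂; [_,_]′)
open import Data.Vec as V using (Vec; []; _∷_; lookup; zipWith; tabulate; replicate)
import Data.Vec.Properties as VP
import Data.Vec.Relation.Unary.All as VA
import Data.Vec.Relation.Unary.All.Properties as VAP
open import Function using (_∘_; _$_; Equivalence; mk⇔)
open import Relation.Binary.Lattice.Bundles using (Lattice)
open import Relation.Binary.PropositionalEquality
open import Relation.Nullary using (¬_; Dec; does; yes; no; _×-dec_; _⊎-dec_; _→-dec_; ¬?)
open import Relation.Nullary.Decidable using (from-yes; dec-true; dec-false)
open import Relation.Unary using (Pred; Decidable)
open import Algebra.Properties.CommutativeSemigroup ℕP.+-commutativeSemigroup using (interchange)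
open +-*-Solver using (solve; _:=_; _:+_; _:*_; :-_; con)

-- With c axes the dimensions in degrees 1, 2, 3 are 3 + c, 6 + c, 10 + c, and (3 + c)(10 + c) - (6
-- + c)^2 = c - 6. So the polynomial ring in three variables alone is log-concave here, six axes
-- give equality, and seven is the first number that breaks log-concavity. The constants 4 and 3
-- come from the two shortest kinds of relations on the chain. A member A strictly below B gives x_A
-- h_B^(rk B - rk A), where h_B is the sum of the variables of all members containing B; its degree
-- is 1 + rk B - rk A, so a gap of 3 keeps it out of degree 3. The bottom member gives h_G^(rk G),
-- whence rank at least 4. The obstacle is that the sets S of the relations are arbitrary and may
-- contain many singletons, which lower the exponent. Each of them lowers it by at most one and
-- contributes a factor of degree one, so the total degree never drops.

private
  variable
    k n : ℕ
    A : Set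

-- Polynomials as functionals on monomial weights

_⊕_ : Monomial k → Monomial k → Monomial k
_⊕_ = zipWith _+_

-- The linear extension of φ from monomials to polynomials.  Two polynomials are ≈P iff
-- they agree under all such functionals, which turns products into iterated sums.
⟪_,_⟫ : Poly k → (Monomial k → ℚ) → ℚ
⟪ [] , φ ⟫          = 0ℚ
⟪ (c , m) ∷ p , φ ⟫ = c *ℚ φ m +ℚ ⟪ p , φ ⟫

⟪⟫-cong : ∀ (p : Poly k) {φ ψ} → (∀ m → φ m ≡ ψ m) → ⟪ p , φ ⟫ ≡ ⟪ p , ψ ⟫
⟪⟫-cong []            e = refl
⟪⟫-cong ((c , m) ∷ p) e = cong₂ (λ x y → c *ℚ x +ℚ y) (e m) (⟪⟫-cong p e)

⟪⟫-++ : ∀ (p q : Poly k) φ → ⟪ p ++ q , φ ⟫ ≡ ⟪ p , φ ⟫ +ℚ ⟪ q , φ ⟫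
⟪⟫-++ []            q φ = sym (ℚP.+-identityˡ _)
⟪⟫-++ ((c , m) ∷ p) q φ =
  trans (cong (c *ℚ φ m +ℚ_) (⟪⟫-++ p q φ)) (sym (ℚP.+-assoc (c *ℚ φ m) ⟪ p , φ ⟫ ⟪ q , φ ⟫))

⟪⟫-0 : ∀ (p : Poly k) → ⟪ p , (λ _ → 0ℚ) ⟫ ≡ 0ℚ
⟪⟫-0 []            = refl
⟪⟫-0 ((c , m) ∷ p) = cong₂ _+ℚ_ (ℚP.*-zeroʳ c) (⟪⟫-0 p)

⟪⟫-+ : ∀ (p : Poly k) φ ψ → ⟪ p , (λ m → φ m +ℚ ψ m) ⟫ ≡ ⟪ p , φ ⟫ +ℚ ⟪ p , ψ ⟫
⟪⟫-+ []            φ ψ = refl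
⟪⟫-+ ((c , m) ∷ p) φ ψ = trans (cong (c *ℚ (φ m +ℚ ψ m) +ℚ_) (⟪⟫-+ p φ ψ))
  (solve 5 (λ c a b x y → c :* (a :+ b) :+ (x :+ y) := (c :* a :+ x) :+ (c :* b :+ y)) refl
    c (φ m) (ψ m) ⟪ p , φ ⟫ ⟪ p , ψ ⟫)

⟪⟫-* : ∀ (p : Poly k) a φ → ⟪ p , (λ m → a *ℚ φ m) ⟫ ≡ a *ℚ ⟪ p , φ ⟫
⟪⟫-* []            a φ = sym (ℚP.*-zeroʳ a)
⟪⟫-* ((c , m) ∷ p) a φ = trans (cong (c *ℚ (a *ℚ φ m) +ℚ_) (⟪⟫-* p a φ))
  (solve 4 (λ c a x y → c :* (a :* x) :+ a :* y := a :* (c :* x :+ y)) refl c a (φ m) ⟪ p , φ ⟫)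

⟪·P⟫ : ∀ a (p : Poly k) φ → ⟪ a ·P p , φ ⟫ ≡ a *ℚ ⟪ p , φ ⟫
⟪·P⟫ a []            φ = sym (ℚP.*-zeroʳ a)
⟪·P⟫ a ((c , m) ∷ p) φ = trans (cong (a *ℚ c *ℚ φ m +ℚ_) (⟪·P⟫ a p φ))
  (solve 4 (λ c a x y → a :* c :* x :+ a :* y := a :* (c :* x :+ y)) refl c a (φ m) ⟪ p , φ ⟫)

⟪-P⟫ : ∀ (p : Poly k) φ → ⟪ -P p , φ ⟫ ≡ - ⟪ p , φ ⟫
⟪-P⟫ []            φ = refl
⟪-P⟫ ((c , m) ∷ p) φ = trans (cong (- c *ℚ φ m +ℚ_) (⟪-P⟫ p φ))
  (solve 3 (λ c x y → :- c :* x :+ :- y := :- (c :* x :+ y)) refl c (φ m) ⟪ p , φ ⟫)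

⟪*P⟫ : ∀ (p q : Poly k) φ → ⟪ p *P q , φ ⟫ ≡ ⟪ p , (λ m → ⟪ q , (λ m′ → φ (m ⊕ m′)) ⟫) ⟫
⟪*P⟫ []            q φ = refl
⟪*P⟫ ((c , m) ∷ p) q φ = trans (⟪⟫-++ (map _ q) (p *P q) φ) (cong₂ _+ℚ_ (term q) (⟪*P⟫ p q φ))
  where
  term : ∀ q → ⟪ map (λ u → (c *ℚ proj₁ u , m ⊕ proj₂ u)) q , φ ⟫ ≡ c *ℚ ⟪ q , (λ m′ → φ (m ⊕ m′)) ⟫
  term []             = sym (ℚP.*-zeroʳ c)
  term ((d , m′) ∷ q) = trans (cong (c *ℚ d *ℚ φ (m ⊕ m′) +ℚ_) (term q))
    (solve 4 (λ c d x y → c :* d :* x :+ c :* y := c :* (d :* x :+ y)) refl c d (φ (m ⊕ m′)) _)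

-- Fubini for finite sums; commutativity of `_*P_` reduces to it.
⟪⟫-swap : ∀ {l} (p : Poly k) (q : Poly l) (f : Monomial k → Monomial l → ℚ) →
          ⟪ p , (λ m → ⟪ q , f m ⟫) ⟫ ≡ ⟪ q , (λ m′ → ⟪ p , (λ m → f m m′) ⟫) ⟫
⟪⟫-swap []            q f = sym (⟪⟫-0 q)
⟪⟫-swap ((c , m) ∷ p) q f = trans
  (cong₂ _+ℚ_ (sym (⟪⟫-* q c (f m))) (⟪⟫-swap p q f))
  (sym (⟪⟫-+ q (λ m′ → c *ℚ f m m′) (λ m′ → ⟪ p , (λ m → f m m′) ⟫)))

δ : Monomial k → Monomial k → ℚ
δ e m = if does (VP.≡-dec ℕP._≟_ m e) then 1ℚ else 0ℚ

coeff≡⟪⟫ : ∀ (p : Poly k) e → coeff p e ≡ ⟪ p , δ e ⟫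
coeff≡⟪⟫ []            e = refl
coeff≡⟪⟫ ((c , m) ∷ p) e with does (VP.≡-dec ℕP._≟_ m e)
... | true  = cong₂ _+ℚ_ (sym (ℚP.*-identityʳ c)) (coeff≡⟪⟫ p e)
... | false = cong₂ _+ℚ_ (sym (ℚP.*-zeroʳ c)) (coeff≡⟪⟫ p e)

⟪⟫⇒≈P : ∀ {p q : Poly k} → (∀ φ → ⟪ p , φ ⟫ ≡ ⟪ q , φ ⟫) → p ≈P q
⟪⟫⇒≈P {p = p} {q} h e = trans (coeff≡⟪⟫ p e) (trans (h (δ e)) (sym (coeff≡⟪⟫ q e)))

delete : Monomial k → Poly k → Poly k
delete e [] = []
delete e ((c , m) ∷ p) with VP.≡-dec ℕP._≟_ m e
... | yes _ = delete e p
... | no  _ = (c , m) ∷ delete e p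

length-delete : ∀ (e : Monomial k) p → length (delete e p) ≤ length p
length-delete e [] = z≤n
length-delete e ((c , m) ∷ p) with VP.≡-dec ℕP._≟_ m e
... | yes _ = ℕP.m≤n⇒m≤1+n (length-delete e p)
... | no  _ = s≤s (length-delete e p)

⟪⟫-delete : ∀ (e : Monomial k) p φ → ⟪ p , φ ⟫ ≡ coeff p e *ℚ φ e +ℚ ⟪ delete e p , φ ⟫
⟪⟫-delete e [] φ = sym (trans (ℚP.+-identityʳ _) (ℚP.*-zeroˡ (φ e)))
⟪⟫-delete e ((c , m) ∷ p) φ with VP.≡-dec ℕP._≟_ m e
... | yes refl = trans (cong (c *ℚ φ m +ℚ_) (⟪⟫-delete m p φ))
  (solve 4 (λ c x a y → c :* x :+ (a :* x :+ y) := (c :+ a) :* x :+ y) refl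
    c (φ m) (coeff p m) ⟪ delete m p , φ ⟫)
... | no _ = trans (cong (c *ℚ φ m +ℚ_) (⟪⟫-delete e p φ))
  (solve 4 (λ u a x y → u :+ (a :* x :+ y) := (con 0ℚ :+ a) :* x :+ (u :+ y)) refl
    (c *ℚ φ m) (coeff p e) (φ e) ⟪ delete e p , φ ⟫)

coeff-delete : ∀ (e e′ : Monomial k) p → coeff p e′ ≡ 0ℚ → coeff (delete e p) e′ ≡ 0ℚ
coeff-delete e e′ p z with VP.≡-dec ℕP._≟_ e e′
... | yes refl = same e p
  where
  same : ∀ (e : Monomial _) p → coeff (delete e p) e ≡ 0ℚ
  same e [] = refl
  same e ((c , m) ∷ p) with VP.≡-dec ℕP._≟_ m e
  ... | yes _ = same e p
  ... | no m≢e with VP.≡-dec ℕP._≟_ m e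
  ...   | yes m≡e = ⊥-elim (m≢e m≡e)
  ...   | no _    = trans (ℚP.+-identityˡ _) (same e p)
... | no e≢e′ = trans (other p) z
  where
  other : ∀ p → coeff (delete e p) e′ ≡ coeff p e′
  other [] = refl
  other ((c , m) ∷ p) with VP.≡-dec ℕP._≟_ m e
  ... | no _ = cong ((if does (VP.≡-dec ℕP._≟_ m e′) then c else 0ℚ) +ℚ_) (other p)
  ... | yes refl with VP.≡-dec ℕP._≟_ m e′
  ...   | yes m≡e′ = ⊥-elim (e≢e′ m≡e′)
  ...   | no _     = trans (other p) (sym (ℚP.+-identityˡ _))

-- Vanishing coefficients say nothing about a single term, because the same exponent may occur
-- several times in the list. So all terms sharing the exponent of the head are deleted at once;
-- they contribute a multiple of their common coefficient. The induction runs on a bound for the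
-- length, since what remains is not a tail of the list.
≈0⇒⟪⟫≡0 : ∀ (p : Poly k) → (∀ e → coeff p e ≡ 0ℚ) → ∀ φ → ⟪ p , φ ⟫ ≡ 0ℚ
≈0⇒⟪⟫≡0 {k} p z φ = go (length p) p ℕP.≤-refl z
  where
  go : ∀ n (p : Poly k) → length p ≤ n → (∀ e → coeff p e ≡ 0ℚ) → ⟪ p , φ ⟫ ≡ 0ℚ
  go n [] _ _ = refl
  go (suc n) q@((c , m) ∷ p) (s≤s l≤n) z = begin
    ⟪ q , φ ⟫                               ≡⟨ ⟪⟫-delete m q φ ⟩
    coeff q m *ℚ φ m +ℚ ⟪ delete m q , φ ⟫    ≡⟨ cong₂ (λ x y → x *ℚ φ m +ℚ y) (z m) rest ⟩
    0ℚ *ℚ φ m +ℚ 0ℚ                           ≡⟨ trans (ℚP.+-identityʳ _) (ℚP.*-zeroˡ (φ m)) ⟩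
    0ℚ                                      ∎
    where
    open ≡-Reasoning
    head-deleted : delete m q ≡ delete m p
    head-deleted with VP.≡-dec ℕP._≟_ m m
    ... | yes _  = refl
    ... | no m≢m = ⊥-elim (m≢m refl)
    rest : ⟪ delete m q , φ ⟫ ≡ 0ℚ
    rest = go n (delete m q)
      (subst (λ r → length r ≤ n) (sym head-deleted) (ℕP.≤-trans (length-delete m p) l≤n))
      (λ e → coeff-delete m e q (z e))

≈P⇒⟪⟫ : ∀ {p q : Poly k} → p ≈P q → ∀ φ → ⟪ p , φ ⟫ ≡ ⟪ q , φ ⟫
≈P⇒⟪⟫ {p = p} {q} p≈q φ = begin
  ⟪ p , φ ⟫                              ≡⟨ solve 2 (λ x y → x := (x :+ :- y) :+ y) refl ⟪ p , φ ⟫ ⟪ q , φ ⟫ ⟩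
  (⟪ p , φ ⟫ +ℚ - ⟪ q , φ ⟫) +ℚ ⟪ q , φ ⟫  ≡⟨ cong (_+ℚ ⟪ q , φ ⟫) (trans (sym (difference φ)) vanish) ⟩
  0ℚ +ℚ ⟪ q , φ ⟫                         ≡⟨ ℚP.+-identityˡ _ ⟩
  ⟪ q , φ ⟫                              ∎
  where
  open ≡-Reasoning
  difference : ∀ φ → ⟪ p ++ (-P q) , φ ⟫ ≡ ⟪ p , φ ⟫ +ℚ - ⟪ q , φ ⟫
  difference φ = trans (⟪⟫-++ p (-P q) φ) (cong (⟪ p , φ ⟫ +ℚ_) (⟪-P⟫ q φ))
  vanish : ⟪ p ++ (-P q) , φ ⟫ ≡ 0ℚ
  vanish = ≈0⇒⟪⟫≡0 (p ++ (-P q)) (λ e → begin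
    coeff (p ++ (-P q)) e            ≡⟨ coeff≡⟪⟫ (p ++ (-P q)) e ⟩
    ⟪ p ++ (-P q) , δ e ⟫            ≡⟨ difference (δ e) ⟩
    ⟪ p , δ e ⟫ +ℚ - ⟪ q , δ e ⟫      ≡⟨ cong₂ (λ x y → x +ℚ - y) (sym (coeff≡⟪⟫ p e)) (sym (coeff≡⟪⟫ q e)) ⟩
    coeff p e +ℚ - coeff q e          ≡⟨ cong (λ x → x +ℚ - coeff q e) (p≈q e) ⟩
    coeff q e +ℚ - coeff q e          ≡⟨ ℚP.+-inverseʳ (coeff q e) ⟩
    0ℚ                               ∎) φ

-- The dual form of `_≈P_`, equivalent to it by `≈P⇒⟪⟫` and `⟪⟫⇒≈P`. As a record it keeps `p` and
-- `q` recoverable from the type, which the bare family of equations would not.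
record _≃_ (p q : Poly k) : Set where
  constructor mk≃
  field at : ∀ φ → ⟪ p , φ ⟫ ≡ ⟪ q , φ ⟫
open _≃_

unit : Fin k → Monomial k
unit j = tabulate (λ i → if does (i F.≟ j) then 1 else 0)

⟪var⟫ : ∀ (j : Fin k) φ → ⟪ var j , φ ⟫ ≡ φ (unit j)
⟪var⟫ j φ = trans (ℚP.+-identityʳ _) (ℚP.*-identityˡ _)

⟪var*⟫ : ∀ (j : Fin k) p φ → ⟪ var j *P p , φ ⟫ ≡ ⟪ p , (λ m → φ (unit j ⊕ m)) ⟫
⟪var*⟫ j p φ = trans (⟪*P⟫ (var j) p φ) (⟪var⟫ j (λ m → ⟪ p , (λ m′ → φ (m ⊕ m′)) ⟫))

0-vec : ∀ {n} → tabulate {n = n} (λ _ → 0) ≡ replicate n 0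
0-vec {zero}  = refl
0-vec {suc n} = cong (0 ∷_) 0-vec

0⊕ : ∀ (m : Monomial k) → replicate k 0 ⊕ m ≡ m
0⊕ = VP.zipWith-identityˡ (λ _ → refl)

⊕0 : ∀ (m : Monomial k) → m ⊕ replicate k 0 ≡ m
⊕0 = VP.zipWith-identityʳ ℕP.+-identityʳ

⊕-comm : ∀ (m m′ : Monomial k) → m ⊕ m′ ≡ m′ ⊕ m
⊕-comm = VP.zipWith-comm ℕP.+-comm

⊕-assoc : ∀ (a b c : Monomial k) → (a ⊕ b) ⊕ c ≡ a ⊕ (b ⊕ c)
⊕-assoc = VP.zipWith-assoc ℕP.+-assoc

⟪1P⟫ : ∀ φ → ⟪ 1P {k} , φ ⟫ ≡ φ (replicate k 0)
⟪1P⟫ φ = trans (ℚP.+-identityʳ _) (ℚP.*-identityˡ _)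

*P-comm : ∀ (p q : Poly k) → (p *P q) ≃ (q *P p)
*P-comm p q .at φ = begin
  ⟪ p *P q , φ ⟫                             ≡⟨ ⟪*P⟫ p q φ ⟩
  ⟪ p , (λ m → ⟪ q , (λ m′ → φ (m ⊕ m′)) ⟫) ⟫  ≡⟨ ⟪⟫-swap p q (λ m m′ → φ (m ⊕ m′)) ⟩
  ⟪ q , (λ m′ → ⟪ p , (λ m → φ (m ⊕ m′)) ⟫) ⟫
    ≡⟨ ⟪⟫-cong q (λ m′ → ⟪⟫-cong p (λ m → cong φ (⊕-comm m m′))) ⟩
  ⟪ q , (λ m′ → ⟪ p , (λ m → φ (m′ ⊕ m)) ⟫) ⟫  ≡⟨ sym (⟪*P⟫ q p φ) ⟩
  ⟪ q *P p , φ ⟫                             ∎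
  where open ≡-Reasoning

*P-assoc : ∀ (p q r : Poly k) → ((p *P q) *P r) ≃ (p *P (q *P r))
*P-assoc p q r .at φ = begin
  ⟪ (p *P q) *P r , φ ⟫                                     ≡⟨ ⟪*P⟫ (p *P q) r φ ⟩
  ⟪ p *P q , (λ m → ⟪ r , (λ m″ → φ (m ⊕ m″)) ⟫) ⟫            ≡⟨ ⟪*P⟫ p q _ ⟩
  ⟪ p , (λ m → ⟪ q , (λ m′ → ⟪ r , (λ m″ → φ ((m ⊕ m′) ⊕ m″)) ⟫) ⟫) ⟫
    ≡⟨ ⟪⟫-cong p (λ m → trans
         (⟪⟫-cong q (λ m′ → ⟪⟫-cong r (λ m″ → cong φ (⊕-assoc m m′ m″))))
         (sym (⟪*P⟫ q r (λ m′ → φ (m ⊕ m′))))) ⟩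
  ⟪ p , (λ m → ⟪ q *P r , (λ m′ → φ (m ⊕ m′)) ⟫) ⟫            ≡⟨ sym (⟪*P⟫ p (q *P r) φ) ⟩
  ⟪ p *P (q *P r) , φ ⟫                                     ∎
  where open ≡-Reasoning

*P-cong : ∀ (p p′ q q′ : Poly k) → p ≃ p′ → q ≃ q′ → (p *P q) ≃ (p′ *P q′)
*P-cong p p′ q q′ e e′ .at φ = trans (⟪*P⟫ p q φ) (trans
  (trans (⟪⟫-cong p (λ m → e′ .at (λ m′ → φ (m ⊕ m′)))) (e .at _)) (sym (⟪*P⟫ p′ q′ φ)))

*P-congʳ : ∀ (p q q′ : Poly k) → q ≃ q′ → (p *P q) ≃ (p *P q′)
*P-congʳ p q q′ = *P-cong p p q q′ (mk≃ λ _ → refl)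

*P-zeroʳ : ∀ (p : Poly k) → (p *P 0P) ≃ 0P
*P-zeroʳ p .at φ = trans (⟪*P⟫ p [] φ) (⟪⟫-0 p)

*P-distribˡ : ∀ (p q r : Poly k) → (p *P (q ++ r)) ≃ ((p *P q) ++ (p *P r))
*P-distribˡ p q r .at φ = begin
  ⟪ p *P (q ++ r) , φ ⟫                                ≡⟨ ⟪*P⟫ p (q ++ r) φ ⟩
  ⟪ p , (λ m → ⟪ q ++ r , (λ m′ → φ (m ⊕ m′)) ⟫) ⟫       ≡⟨ ⟪⟫-cong p (λ m → ⟪⟫-++ q r _) ⟩
  ⟪ p , (λ m → ⟪ q , (λ m′ → φ (m ⊕ m′)) ⟫ +ℚ ⟪ r , (λ m′ → φ (m ⊕ m′)) ⟫) ⟫ ≡⟨ ⟪⟫-+ p _ _ ⟩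
  ⟪ p , (λ m → ⟪ q , (λ m′ → φ (m ⊕ m′)) ⟫) ⟫ +ℚ ⟪ p , (λ m → ⟪ r , (λ m′ → φ (m ⊕ m′)) ⟫) ⟫
    ≡⟨ sym (cong₂ _+ℚ_ (⟪*P⟫ p q φ) (⟪*P⟫ p r φ)) ⟩
  ⟪ p *P q , φ ⟫ +ℚ ⟪ p *P r , φ ⟫                      ≡⟨ sym (⟪⟫-++ (p *P q) (p *P r) φ) ⟩
  ⟪ (p *P q) ++ (p *P r) , φ ⟫                         ∎
  where open ≡-Reasoning

*P-·P : ∀ (p q : Poly k) a → (p *P (a ·P q)) ≃ (a ·P (p *P q))
*P-·P p q a .at φ = begin
  ⟪ p *P (a ·P q) , φ ⟫                               ≡⟨ ⟪*P⟫ p (a ·P q) φ ⟩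
  ⟪ p , (λ m → ⟪ a ·P q , (λ m′ → φ (m ⊕ m′)) ⟫) ⟫      ≡⟨ ⟪⟫-cong p (λ m → ⟪·P⟫ a q _) ⟩
  ⟪ p , (λ m → a *ℚ ⟪ q , (λ m′ → φ (m ⊕ m′)) ⟫) ⟫       ≡⟨ ⟪⟫-* p a _ ⟩
  a *ℚ ⟪ p , (λ m → ⟪ q , (λ m′ → φ (m ⊕ m′)) ⟫) ⟫       ≡⟨ cong (a *ℚ_) (sym (⟪*P⟫ p q φ)) ⟩
  a *ℚ ⟪ p *P q , φ ⟫                                  ≡⟨ sym (⟪·P⟫ a (p *P q) φ) ⟩
  ⟪ a ·P (p *P q) , φ ⟫                               ∎
  where open ≡-Reasoning

-- Ideals and spanning sets

⟪lincomb⟫-+ : ∀ {d} (c c′ : Vec ℚ d) (B : Vec (Poly k) d) φ →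
  ⟪ lincomb (zipWith _+ℚ_ c c′) B , φ ⟫ ≡ ⟪ lincomb c B , φ ⟫ +ℚ ⟪ lincomb c′ B , φ ⟫
⟪lincomb⟫-+ [] [] [] φ = refl
⟪lincomb⟫-+ (a ∷ c) (a′ ∷ c′) (b ∷ B) φ
  rewrite ⟪⟫-++ ((a +ℚ a′) ·P b) (lincomb (zipWith _+ℚ_ c c′) B) φ
        | ⟪⟫-++ (a ·P b) (lincomb c B) φ | ⟪⟫-++ (a′ ·P b) (lincomb c′ B) φ
        | ⟪·P⟫ (a +ℚ a′) b φ | ⟪·P⟫ a b φ | ⟪·P⟫ a′ b φ | ⟪lincomb⟫-+ c c′ B φ =
  solve 5 (λ a a′ b x y → (a :+ a′) :* b :+ (x :+ y) := (a :* b :+ x) :+ (a′ :* b :+ y)) refl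
    a a′ ⟪ b , φ ⟫ ⟪ lincomb c B , φ ⟫ ⟪ lincomb c′ B , φ ⟫

⟪lincomb⟫-* : ∀ {d} a (c : Vec ℚ d) (B : Vec (Poly k) d) φ →
  ⟪ lincomb (V.map (a *ℚ_) c) B , φ ⟫ ≡ a *ℚ ⟪ lincomb c B , φ ⟫
⟪lincomb⟫-* a [] [] φ = sym (ℚP.*-zeroʳ a)
⟪lincomb⟫-* a (x ∷ c) (b ∷ B) φ
  rewrite ⟪⟫-++ ((a *ℚ x) ·P b) (lincomb (V.map (a *ℚ_) c) B) φ
        | ⟪⟫-++ (x ·P b) (lincomb c B) φ
        | ⟪·P⟫ (a *ℚ x) b φ | ⟪·P⟫ x b φ | ⟪lincomb⟫-* a c B φ =
  solve 4 (λ a x b y → a :* x :* b :+ a :* y := a :* (x :* b :+ y)) refl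
    a x ⟪ b , φ ⟫ ⟪ lincomb c B , φ ⟫

⟪lincomb⟫-0 : ∀ {d} (B : Vec (Poly k) d) φ → ⟪ lincomb (replicate d 0ℚ) B , φ ⟫ ≡ 0ℚ
⟪lincomb⟫-0 [] φ = refl
⟪lincomb⟫-0 (b ∷ B) φ
  rewrite ⟪⟫-++ (0ℚ ·P b) (lincomb (replicate _ 0ℚ) B) φ | ⟪·P⟫ 0ℚ b φ | ⟪lincomb⟫-0 B φ =
  trans (ℚP.+-identityʳ _) (ℚP.*-zeroˡ ⟪ b , φ ⟫)

⟪lincomb⟫-lookup : ∀ {d} (B : Vec (Poly k) d) j → Σ (Vec ℚ d) λ c → lincomb c B ≃ lookup B j
⟪lincomb⟫-lookup {d = suc d} (b ∷ B) zero = 1ℚ ∷ replicate d 0ℚ , mk≃ λ φ →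
  trans (⟪⟫-++ (1ℚ ·P b) (lincomb (replicate d 0ℚ) B) φ)
    (trans (cong₂ _+ℚ_ (trans (⟪·P⟫ 1ℚ b φ) (ℚP.*-identityˡ ⟪ b , φ ⟫)) (⟪lincomb⟫-0 B φ)) (ℚP.+-identityʳ ⟪ b , φ ⟫))
⟪lincomb⟫-lookup (b ∷ B) (suc j) with ⟪lincomb⟫-lookup B j
... | c , e = 0ℚ ∷ c , mk≃ λ φ → trans (⟪⟫-++ (0ℚ ·P b) (lincomb c B) φ)
    (trans (cong₂ _+ℚ_ (trans (⟪·P⟫ 0ℚ b φ) (ℚP.*-zeroˡ ⟪ b , φ ⟫)) (e .at φ)) (ℚP.+-identityˡ _))

⟪lincomb⟫-dual : ∀ {d} (c : Vec ℚ d) (B : Vec (Poly k) d) ψ j →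
  (∀ l → ⟪ lookup B l , ψ ⟫ ≡ (if does (j F.≟ l) then 1ℚ else 0ℚ)) →
  ⟪ lincomb c B , ψ ⟫ ≡ lookup c j
⟪lincomb⟫-dual (a ∷ c) (b ∷ B) ψ zero dual = trans (⟪⟫-++ (a ·P b) (lincomb c B) ψ)
  (trans (cong₂ _+ℚ_ (trans (⟪·P⟫ a b ψ) (trans (cong (a *ℚ_) (dual zero)) (ℚP.*-identityʳ a)))
                    (rest c B (λ l → dual (suc l))))
         (ℚP.+-identityʳ a))
  where
  rest : ∀ {d} (c : Vec ℚ d) (B : Vec (Poly _) d) → (∀ l → ⟪ lookup B l , ψ ⟫ ≡ 0ℚ) →
         ⟪ lincomb c B , ψ ⟫ ≡ 0ℚ
  rest [] [] _ = refl
  rest (a ∷ c) (b ∷ B) z = trans (⟪⟫-++ (a ·P b) (lincomb c B) ψ)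
    (cong₂ _+ℚ_ (trans (⟪·P⟫ a b ψ) (trans (cong (a *ℚ_) (z zero)) (ℚP.*-zeroʳ a)))
               (rest c B (λ l → z (suc l))))
⟪lincomb⟫-dual (a ∷ c) (b ∷ B) ψ (suc j) dual = trans (⟪⟫-++ (a ·P b) (lincomb c B) ψ)
  (trans (cong₂ _+ℚ_ (trans (⟪·P⟫ a b ψ) (trans (cong (a *ℚ_) (dual zero)) (ℚP.*-zeroʳ a)))
                    (⟪lincomb⟫-dual c B ψ j (λ l → dual (suc l))))
         (ℚP.+-identityˡ _))

module _ {Gen : Set} (gen : Gen → Poly k) where

  combination : List (Poly k × Gen) → Poly k
  combination l = ΣP (map (λ t → proj₁ t *P gen (proj₂ t)) l)

  record Ideal (p : Poly k) : Set where
    constructor mkIdeal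
    field
      witness  : List (Poly k × Gen)
      witness≃ : p ≃ combination witness

  InIdeal⇒Ideal : ∀ {p} → InIdeal gen p → Ideal p
  InIdeal⇒Ideal {p} (l , h) = mkIdeal l (mk≃ (≈P⇒⟪⟫ {p = p} {combination l} h))

  Ideal⇒InIdeal : ∀ {p} → Ideal p → InIdeal gen p
  Ideal⇒InIdeal {p} (mkIdeal l h) = l , ⟪⟫⇒≈P {p = p} {combination l} (h .at)

  Ideal-resp : ∀ {p q} → p ≃ q → Ideal q → Ideal p
  Ideal-resp e (mkIdeal l h) = mkIdeal l (mk≃ λ φ → trans (e .at φ) (h .at φ))

  Ideal-0 : Ideal 0P
  Ideal-0 = mkIdeal [] (mk≃ λ _ → refl)

  combination-++ : ∀ l l′ → combination (l ++ l′) ≃ (combination l ++ combination l′)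
  combination-++ []      l′ .at φ = refl
  combination-++ ((q , g) ∷ l) l′ .at φ = begin
    ⟪ (q *P gen g) ++ combination (l ++ l′) , φ ⟫  ≡⟨ ⟪⟫-++ (q *P gen g) _ φ ⟩
    ⟪ q *P gen g , φ ⟫ +ℚ ⟪ combination (l ++ l′) , φ ⟫
      ≡⟨ cong (⟪ q *P gen g , φ ⟫ +ℚ_) (trans (combination-++ l l′ .at φ) (⟪⟫-++ (combination l) _ φ)) ⟩
    ⟪ q *P gen g , φ ⟫ +ℚ (⟪ combination l , φ ⟫ +ℚ ⟪ combination l′ , φ ⟫)
      ≡⟨ sym (ℚP.+-assoc ⟪ q *P gen g , φ ⟫ ⟪ combination l , φ ⟫ ⟪ combination l′ , φ ⟫) ⟩
    ⟪ q *P gen g , φ ⟫ +ℚ ⟪ combination l , φ ⟫ +ℚ ⟪ combination l′ , φ ⟫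
      ≡⟨ cong (_+ℚ ⟪ combination l′ , φ ⟫) (sym (⟪⟫-++ (q *P gen g) (combination l) φ)) ⟩
    ⟪ combination ((q , g) ∷ l) , φ ⟫ +ℚ ⟪ combination l′ , φ ⟫
      ≡⟨ sym (⟪⟫-++ (combination ((q , g) ∷ l)) _ φ) ⟩
    ⟪ combination ((q , g) ∷ l) ++ combination l′ , φ ⟫ ∎
    where open ≡-Reasoning

  Ideal-++ : ∀ {p q} → Ideal p → Ideal q → Ideal (p ++ q)
  Ideal-++ {p} {q} (mkIdeal l h) (mkIdeal l′ h′) = mkIdeal (l ++ l′) (mk≃ λ φ → begin
    ⟪ p ++ q , φ ⟫                               ≡⟨ ⟪⟫-++ p q φ ⟩
    ⟪ p , φ ⟫ +ℚ ⟪ q , φ ⟫                        ≡⟨ cong₂ _+ℚ_ (h .at φ) (h′ .at φ) ⟩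
    ⟪ combination l , φ ⟫ +ℚ ⟪ combination l′ , φ ⟫   ≡⟨ sym (⟪⟫-++ (combination l) _ φ) ⟩
    ⟪ combination l ++ combination l′ , φ ⟫        ≡⟨ sym (combination-++ l l′ .at φ) ⟩
    ⟪ combination (l ++ l′) , φ ⟫                ∎)
    where open ≡-Reasoning

  Ideal-* : ∀ r {p} → Ideal p → Ideal (r *P p)
  Ideal-* r {p} (mkIdeal l h) = mkIdeal (scaled l) (mk≃ λ φ →
      trans (*P-congʳ r p (combination l) h .at φ) (eq l .at φ))
    where
    scaled : List (Poly k × Gen) → List (Poly k × Gen)
    scaled = map (λ t → r *P proj₁ t , proj₂ t)
    eq : ∀ l → (r *P combination l) ≃ combination (scaled l)
    eq []            = *P-zeroʳ r
    eq ((q , g) ∷ l) .at φ = begin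
      ⟪ r *P ((q *P gen g) ++ combination l) , φ ⟫        ≡⟨ *P-distribˡ r (q *P gen g) (combination l) .at φ ⟩
      ⟪ (r *P (q *P gen g)) ++ (r *P combination l) , φ ⟫ ≡⟨ ⟪⟫-++ (r *P (q *P gen g)) _ φ ⟩
      ⟪ r *P (q *P gen g) , φ ⟫ +ℚ ⟪ r *P combination l , φ ⟫
        ≡⟨ cong₂ _+ℚ_ (sym (*P-assoc r q (gen g) .at φ)) (eq l .at φ) ⟩
      ⟪ (r *P q) *P gen g , φ ⟫ +ℚ ⟪ combination (scaled l) , φ ⟫
        ≡⟨ sym (⟪⟫-++ ((r *P q) *P gen g) _ φ) ⟩
      ⟪ combination (scaled ((q , g) ∷ l)) , φ ⟫ ∎
      where open ≡-Reasoning

  Ideal-gen : ∀ g → Ideal (gen g)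
  Ideal-gen g = mkIdeal ((1P , g) ∷ []) (mk≃ λ φ → sym (begin
    ⟪ (1P *P gen g) ++ [] , φ ⟫             ≡⟨ ⟪⟫-++ (1P *P gen g) [] φ ⟩
    ⟪ 1P *P gen g , φ ⟫ +ℚ 0ℚ                ≡⟨ ℚP.+-identityʳ _ ⟩
    ⟪ 1P *P gen g , φ ⟫                     ≡⟨ ⟪*P⟫ 1P (gen g) φ ⟩
    ⟪ 1P {k} , (λ m → ⟪ gen g , (λ m′ → φ (m ⊕ m′)) ⟫) ⟫ ≡⟨ ⟪1P⟫ {k} (λ m → ⟪ gen g , (λ m′ → φ (m ⊕ m′)) ⟫) ⟩
    ⟪ gen g , (λ m′ → φ (replicate k 0 ⊕ m′)) ⟫     ≡⟨ ⟪⟫-cong (gen g) (λ m → cong φ (0⊕ m)) ⟩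
    ⟪ gen g , φ ⟫                           ∎))
    where open ≡-Reasoning

  Ideal-·P : ∀ a {p} → Ideal p → Ideal (a ·P p)
  Ideal-·P a {p} h = Ideal-resp (mk≃ λ φ → sym (begin
    ⟪ ((a , replicate k 0) ∷ []) *P p , φ ⟫                       ≡⟨ ⟪*P⟫ ((a , replicate k 0) ∷ []) p φ ⟩
    a *ℚ ⟪ p , (λ m → φ (replicate k 0 ⊕ m)) ⟫ +ℚ 0ℚ            ≡⟨ ℚP.+-identityʳ _ ⟩
    a *ℚ ⟪ p , (λ m → φ (replicate k 0 ⊕ m)) ⟫
      ≡⟨ cong (a *ℚ_) (⟪⟫-cong p (λ m → cong φ (0⊕ m))) ⟩
    a *ℚ ⟪ p , φ ⟫                                           ≡⟨ sym (⟪·P⟫ a p φ) ⟩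
    ⟪ a ·P p , φ ⟫                                          ∎))
    (Ideal-* ((a , replicate k 0) ∷ []) h)
    where open ≡-Reasoning

  -- Monomial multiples of the generators span the ideal linearly, so testing a functional on them
  -- suffices.
  Annihilates : (Monomial k → ℚ) → Set
  Annihilates ψ = ∀ g m → ⟪ gen g , (λ m′ → ψ (m ⊕ m′)) ⟫ ≡ 0ℚ

  Annihilates⇒≡0 : ∀ {ψ} → Annihilates ψ → ∀ {p} → Ideal p → ⟪ p , ψ ⟫ ≡ 0ℚ
  Annihilates⇒≡0 {ψ} ann (mkIdeal l h) = trans (h .at ψ) (go l)
    where
    go : ∀ l → ⟪ combination l , ψ ⟫ ≡ 0ℚ
    go [] = refl
    go ((q , g) ∷ l) = trans (⟪⟫-++ (q *P gen g) (combination l) ψ)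
      (cong₂ _+ℚ_ (trans (⟪*P⟫ q (gen g) ψ) (trans (⟪⟫-cong q (ann g)) (⟪⟫-0 q))) (go l))

  record Spanned {d} (B : Vec (Poly k) d) (p : Poly k) : Set where
    constructor mkSpanned
    field
      coeffs    : Vec ℚ d
      remainder : Ideal (p +P (-P lincomb coeffs B))

  module _ {d} (B : Vec (Poly k) d) where

    private
      ⟪-lc⟫ : ∀ p (c : Vec ℚ d) φ → ⟪ p +P (-P lincomb c B) , φ ⟫ ≡ ⟪ p , φ ⟫ +ℚ - ⟪ lincomb c B , φ ⟫
      ⟪-lc⟫ p c φ = trans (⟪⟫-++ p (-P lincomb c B) φ) (cong (⟪ p , φ ⟫ +ℚ_) (⟪-P⟫ (lincomb c B) φ))

    Spanned-resp : ∀ {p q} → p ≃ q → Spanned B q → Spanned B p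
    Spanned-resp {p} {q} e (mkSpanned c h) = mkSpanned c $ Ideal-resp (mk≃ λ φ → trans (⟪-lc⟫ p c φ) (trans (cong (_+ℚ - ⟪ lincomb c B , φ ⟫) (e .at φ)) (sym (⟪-lc⟫ q c φ)))) h

    Spanned-++ : ∀ {p q} → Spanned B p → Spanned B q → Spanned B (p ++ q)
    Spanned-++ {p} {q} (mkSpanned c h) (mkSpanned c′ h′) = mkSpanned (zipWith _+ℚ_ c c′) $ Ideal-resp (mk≃ λ φ → begin
      ⟪ (p ++ q) +P (-P lincomb (zipWith _+ℚ_ c c′) B) , φ ⟫
        ≡⟨ ⟪-lc⟫ (p ++ q) (zipWith _+ℚ_ c c′) φ ⟩
      ⟪ p ++ q , φ ⟫ +ℚ - ⟪ lincomb (zipWith _+ℚ_ c c′) B , φ ⟫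
        ≡⟨ cong₂ (λ x y → x +ℚ - y) (⟪⟫-++ p q φ) (⟪lincomb⟫-+ c c′ B φ) ⟩
      (⟪ p , φ ⟫ +ℚ ⟪ q , φ ⟫) +ℚ - (⟪ lincomb c B , φ ⟫ +ℚ ⟪ lincomb c′ B , φ ⟫)
        ≡⟨ solve 4 (λ x y u v → (x :+ y) :+ :- (u :+ v) := (x :+ :- u) :+ (y :+ :- v)) refl
             ⟪ p , φ ⟫ ⟪ q , φ ⟫ ⟪ lincomb c B , φ ⟫ ⟪ lincomb c′ B , φ ⟫ ⟩
      (⟪ p , φ ⟫ +ℚ - ⟪ lincomb c B , φ ⟫) +ℚ (⟪ q , φ ⟫ +ℚ - ⟪ lincomb c′ B , φ ⟫)
        ≡⟨ sym (cong₂ _+ℚ_ (⟪-lc⟫ p c φ) (⟪-lc⟫ q c′ φ)) ⟩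
      ⟪ p +P (-P lincomb c B) , φ ⟫ +ℚ ⟪ q +P (-P lincomb c′ B) , φ ⟫
        ≡⟨ sym (⟪⟫-++ (p +P (-P lincomb c B)) _ φ) ⟩
      ⟪ (p +P (-P lincomb c B)) ++ (q +P (-P lincomb c′ B)) , φ ⟫ ∎) (Ideal-++ h h′)
      where open ≡-Reasoning

    Spanned-·P : ∀ a {p} → Spanned B p → Spanned B (a ·P p)
    Spanned-·P a {p} (mkSpanned c h) = mkSpanned (V.map (a *ℚ_) c) $ Ideal-resp (mk≃ λ φ → begin
      ⟪ (a ·P p) +P (-P lincomb (V.map (a *ℚ_) c) B) , φ ⟫
        ≡⟨ ⟪-lc⟫ (a ·P p) (V.map (a *ℚ_) c) φ ⟩
      ⟪ a ·P p , φ ⟫ +ℚ - ⟪ lincomb (V.map (a *ℚ_) c) B , φ ⟫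
        ≡⟨ cong₂ (λ x y → x +ℚ - y) (⟪·P⟫ a p φ) (⟪lincomb⟫-* a c B φ) ⟩
      a *ℚ ⟪ p , φ ⟫ +ℚ - (a *ℚ ⟪ lincomb c B , φ ⟫)
        ≡⟨ solve 3 (λ a x y → a :* x :+ :- (a :* y) := a :* (x :+ :- y)) refl
             a ⟪ p , φ ⟫ ⟪ lincomb c B , φ ⟫ ⟩
      a *ℚ (⟪ p , φ ⟫ +ℚ - ⟪ lincomb c B , φ ⟫)
        ≡⟨ cong (a *ℚ_) (sym (⟪-lc⟫ p c φ)) ⟩
      a *ℚ ⟪ p +P (-P lincomb c B) , φ ⟫
        ≡⟨ sym (⟪·P⟫ a (p +P (-P lincomb c B)) φ) ⟩
      ⟪ a ·P (p +P (-P lincomb c B)) , φ ⟫ ∎) (Ideal-·P a h)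
      where open ≡-Reasoning

    Ideal⇒Spanned : ∀ {p} → Ideal p → Spanned B p
    Ideal⇒Spanned {p} h = mkSpanned (replicate d 0ℚ) $ Ideal-resp (mk≃ λ φ → trans (⟪-lc⟫ p (replicate d 0ℚ) φ)
      (trans (cong (λ x → ⟪ p , φ ⟫ +ℚ - x) (⟪lincomb⟫-0 B φ)) (ℚP.+-identityʳ ⟪ p , φ ⟫))) h

    Spanned-lookup : ∀ j → Spanned B (lookup B j)
    Spanned-lookup j with ⟪lincomb⟫-lookup B j
    ... | c , e = mkSpanned c $ Ideal-resp (mk≃ λ φ → trans (⟪-lc⟫ (lookup B j) c φ)
      (trans (cong (λ x → ⟪ lookup B j , φ ⟫ +ℚ - x) (e .at φ)) (ℚP.+-inverseʳ ⟪ lookup B j , φ ⟫))) Ideal-0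

    Spanned-*lincomb : ∀ {l} r (c : Vec ℚ l) (A : Vec (Poly k) l) →
      (∀ j → Spanned B (r *P lookup A j)) → Spanned B (r *P lincomb c A)
    Spanned-*lincomb r [] [] _ = Ideal⇒Spanned (Ideal-resp (*P-zeroʳ r) Ideal-0)
    Spanned-*lincomb r (a ∷ c) (b ∷ A) h = Spanned-resp (*P-distribˡ r (a ·P b) (lincomb c A))
      (Spanned-++ (Spanned-resp (*P-·P r b a) (Spanned-·P a (h zero)))
                  (Spanned-*lincomb r c A (λ j → h (suc j))))

    -- Write `p` as a combination of `A` plus an element of the ideal: the second part stays in the
    -- ideal after multiplication, so only the products of `r` with members of `A` need reducing.
    Spanned-*Spanned : ∀ {l} r (A : Vec (Poly k) l) {p} →
      (∀ j → Spanned B (r *P lookup A j)) → Spanned A p → Spanned B (r *P p)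
    Spanned-*Spanned r A {p} h (mkSpanned c m) = Spanned-resp (mk≃ λ φ → begin
      ⟪ r *P p , φ ⟫                                 ≡⟨ *P-congʳ r p _ split .at φ ⟩
      ⟪ r *P (lincomb c A ++ (p +P (-P lincomb c A))) , φ ⟫ ≡⟨ *P-distribˡ r (lincomb c A) _ .at φ ⟩
      ⟪ (r *P lincomb c A) ++ (r *P (p +P (-P lincomb c A))) , φ ⟫ ∎)
      (Spanned-++ (Spanned-*lincomb r c A h) (Ideal⇒Spanned (Ideal-* r m)))
      where
      open ≡-Reasoning
      split : p ≃ (lincomb c A ++ (p +P (-P lincomb c A)))
      split .at φ = begin
        ⟪ p , φ ⟫
          ≡⟨ solve 2 (λ x y → x := y :+ (x :+ :- y)) refl ⟪ p , φ ⟫ ⟪ lincomb c A , φ ⟫ ⟩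
        ⟪ lincomb c A , φ ⟫ +ℚ (⟪ p , φ ⟫ +ℚ - ⟪ lincomb c A , φ ⟫)
          ≡⟨ cong (⟪ lincomb c A , φ ⟫ +ℚ_) (sym (trans (⟪⟫-++ p (-P lincomb c A) φ)
               (cong (⟪ p , φ ⟫ +ℚ_) (⟪-P⟫ (lincomb c A) φ)))) ⟩
        ⟪ lincomb c A , φ ⟫ +ℚ ⟪ p +P (-P lincomb c A) , φ ⟫
          ≡⟨ sym (⟪⟫-++ (lincomb c A) _ φ) ⟩
        ⟪ lincomb c A ++ (p +P (-P lincomb c A)) , φ ⟫ ∎

  split-monomial : ∀ {d l} (m : Vec ℕ l) → V.sum m ≡ suc d →
    Σ (Fin l) λ i → Σ (Vec ℕ l) λ m′ → m ≡ unit i ⊕ m′ × V.sum m′ ≡ d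
  split-monomial (zero ∷ m) s with split-monomial m s
  ... | i , m′ , e , s′ = suc i , zero ∷ m′ , cong (0 ∷_) e , s′
  split-monomial (suc a ∷ m) s =
    zero , a ∷ m , cong (suc a ∷_) (sym (trans (cong (_⊕ m) 0-vec) (0⊕ m))) , ℕP.suc-injective s

  -- A monomial of degree `suc d′` is a variable times a monomial of degree `d′`. Modulo the ideal
  -- the variable is a combination of `A` and the rest one of `B`, so a finite table of products of
  -- `A` with `B` carries spanning up one degree.
  Spanned-step : ∀ {l r d d′} (A : Vec (Poly k) l) (B : Vec (Poly k) r) (C : Vec (Poly k) d) →
    (∀ i → Spanned A (var i)) →
    (∀ i j → Spanned C (lookup A i *P lookup B j)) →
    (∀ p → Homogeneous d′ p → Spanned B p) → (∀ p → Homogeneous (suc d′) p → Spanned C p)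
  Spanned-step A B C gens prods ih [] [] = Ideal⇒Spanned C Ideal-0
  Spanned-step A B C gens prods ih ((c , m) ∷ p) (s ∷ hom) with split-monomial m s
  ... | i , m′ , e , s′ = Spanned-++ C {(c , m) ∷ []} {p}
      (Spanned-resp C term (Spanned-*Spanned C (var i) B
        (λ j → Spanned-resp C (*P-comm (var i) (lookup B j))
          (Spanned-*Spanned C (lookup B j) A
            (λ i′ → Spanned-resp C (*P-comm (lookup B j) (lookup A i′)) (prods i′ j)) (gens i)))
        (ih ((c , m′) ∷ []) (s′ ∷ []))))
      (Spanned-step A B C gens prods ih p hom)
    where
    term : ((c , m) ∷ []) ≃ (var i *P ((c , m′) ∷ []))
    term .at φ = sym (trans (⟪var*⟫ i ((c , m′) ∷ []) φ) (cong (λ x → c *ℚ φ x +ℚ 0ℚ) (sym e)))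

mono : List (Fin k) → Poly k
mono w = ΠP (map var w)

*P-swap : ∀ (p q r : Poly k) → (p *P (q *P r)) ≃ (q *P (p *P r))
*P-swap p q r .at φ = begin
  ⟪ p *P (q *P r) , φ ⟫    ≡⟨ sym (*P-assoc p q r .at φ) ⟩
  ⟪ (p *P q) *P r , φ ⟫    ≡⟨ *P-cong (p *P q) (q *P p) r r (*P-comm p q) (mk≃ λ _ → refl) .at φ ⟩
  ⟪ (q *P p) *P r , φ ⟫    ≡⟨ *P-assoc q p r .at φ ⟩
  ⟪ q *P (p *P r) , φ ⟫    ∎
  where open ≡-Reasoning

mono-↭ : ∀ {w w′ : List (Fin k)} → w ↭ w′ → mono w ≃ mono w′
mono-↭ Perm.refl = mk≃ λ _ → refl
mono-↭ (Perm.prep x e) = *P-congʳ (var x) _ _ (mono-↭ e)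
mono-↭ {w = _ ∷ _ ∷ w} {w′ = _ ∷ _ ∷ w′} (Perm.swap x y e) .at φ = trans
  (*P-swap (var x) (var y) (mono w) .at φ)
  (*P-congʳ (var y) _ _ (*P-congʳ (var x) (mono w) (mono w′) (mono-↭ e)) .at φ)
mono-↭ (Perm.trans e e′) .at φ = trans (mono-↭ e .at φ) (mono-↭ e′ .at φ)

*P-1P : ∀ (p : Poly k) → (p *P 1P) ≃ p
*P-1P {k} p .at φ = trans (⟪*P⟫ p 1P φ)
  (⟪⟫-cong p (λ m → trans (⟪1P⟫ {k} (λ m′ → φ (m ⊕ m′))) (cong φ (⊕0 m))))

-- Evaluation at points

sum-⊕ : ∀ (m m′ : Monomial k) → V.sum (m ⊕ m′) ≡ V.sum m + V.sum m′
sum-⊕ [] [] = refl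
sum-⊕ (a ∷ m) (b ∷ m′) = trans (cong ((a + b) +_) (sum-⊕ m m′)) (interchange a b (V.sum m) (V.sum m′))

sum-0 : ∀ k → V.sum (replicate k 0) ≡ 0
sum-0 zero    = refl
sum-0 (suc k) = sum-0 k

sum-unit : ∀ (j : Fin k) → V.sum (unit j) ≡ 1
sum-unit {suc k} zero = cong suc (trans (cong V.sum (0-vec {k})) (sum-0 k))
sum-unit (suc j)      = sum-unit j

Homogeneous-* : ∀ {a b} (p q : Poly k) → Homogeneous a p → Homogeneous b q → Homogeneous (a + b) (p *P q)
Homogeneous-* []            q hp       hq = []
Homogeneous-* ((c , m) ∷ p) q (e ∷ hp) hq = AllP.++⁺
  (AllP.map⁺ (All.map (λ {u} e′ → trans (sum-⊕ m (proj₂ u)) (cong₂ _+_ e e′)) hq))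
  (Homogeneous-* p q hp hq)

Homogeneous-mono : ∀ (w : List (Fin k)) → Homogeneous (length w) (mono w)
Homogeneous-mono {k} []  = sum-0 k ∷ []
Homogeneous-mono (j ∷ w) = Homogeneous-* (var j) (mono w) (sum-unit j ∷ []) (Homogeneous-mono w)

Homogeneous-linear : ∀ (w : List (Fin k)) → Homogeneous 1 (ΣP (map var w))
Homogeneous-linear []      = []
Homogeneous-linear (j ∷ w) = AllP.++⁺ (sum-unit j ∷ []) (Homogeneous-linear w)

Homogeneous-^ : ∀ (p : Poly k) r → Homogeneous 1 p → Homogeneous r (p ^P r)
Homogeneous-^ {k} p zero h = sum-0 k ∷ []
Homogeneous-^ p (suc r) h = Homogeneous-* p (p ^P r) h (Homogeneous-^ p r h)

pow : ℚ → ℕ → ℚ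
pow x zero    = 1ℚ
pow x (suc a) = x *ℚ pow x a

pow-+ : ∀ x a b → pow x (a + b) ≡ pow x a *ℚ pow x b
pow-+ x zero    b = sym (ℚP.*-identityˡ _)
pow-+ x (suc a) b = trans (cong (x *ℚ_) (pow-+ x a b)) (sym (ℚP.*-assoc x (pow x a) (pow x b)))

_^v_ : (Fin k → ℚ) → Monomial k → ℚ
v ^v []      = 1ℚ
v ^v (a ∷ m) = pow (v zero) a *ℚ ((v ∘ suc) ^v m)

^v-⊕ : ∀ v (m m′ : Monomial k) → v ^v (m ⊕ m′) ≡ (v ^v m) *ℚ (v ^v m′)
^v-⊕ v [] [] = refl
^v-⊕ v (a ∷ m) (b ∷ m′) rewrite pow-+ (v zero) a b | ^v-⊕ (v ∘ suc) m m′ =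
  solve 4 (λ x y z w → x :* y :* (z :* w) := x :* z :* (y :* w)) refl
    (pow (v zero) a) (pow (v zero) b) ((v ∘ suc) ^v m) ((v ∘ suc) ^v m′)

^v-0 : ∀ (v : Fin k → ℚ) → v ^v (replicate k 0) ≡ 1ℚ
^v-0 {zero}  v = refl
^v-0 {suc k} v = trans (ℚP.*-identityˡ _) (^v-0 (v ∘ suc))

^v-unit : ∀ v (j : Fin k) → v ^v (unit j) ≡ v j
^v-unit {suc k} v zero = trans
  (cong₂ _*ℚ_ (ℚP.*-identityʳ (v zero)) (trans (cong ((v ∘ suc) ^v_) (0-vec {k})) (^v-0 (v ∘ suc))))
  (ℚP.*-identityʳ (v zero))
^v-unit v (suc j) = trans (ℚP.*-identityˡ _) (^v-unit (v ∘ suc) j)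

ev : (Fin k → ℚ) → Poly k → ℚ
ev v p = ⟪ p , v ^v_ ⟫

ev-* : ∀ v (p q : Poly k) → ev v (p *P q) ≡ ev v p *ℚ ev v q
ev-* v p q = begin
  ev v (p *P q)                                          ≡⟨ ⟪*P⟫ p q (v ^v_) ⟩
  ⟪ p , (λ m → ⟪ q , (λ m′ → v ^v (m ⊕ m′)) ⟫) ⟫
    ≡⟨ ⟪⟫-cong p (λ m → trans (⟪⟫-cong q (^v-⊕ v m)) (trans (⟪⟫-* q (v ^v m) (v ^v_)) (ℚP.*-comm (v ^v m) _))) ⟩
  ⟪ p , (λ m → ev v q *ℚ (v ^v m)) ⟫                        ≡⟨ ⟪⟫-* p (ev v q) (v ^v_) ⟩
  ev v q *ℚ ev v p                                        ≡⟨ ℚP.*-comm (ev v q) (ev v p) ⟩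
  ev v p *ℚ ev v q                                        ∎
  where open ≡-Reasoning

ev-var : ∀ v (j : Fin k) → ev v (var j) ≡ v j
ev-var v j = trans (⟪var⟫ j (v ^v_)) (^v-unit v j)

Πv : ∀ {A : Set} → (A → ℚ) → List A → ℚ
Πv v = L.foldr (λ i x → v i *ℚ x) 1ℚ

Σv : ∀ {A : Set} → (A → ℚ) → List A → ℚ
Σv v = L.foldr (λ i x → v i +ℚ x) 0ℚ

ev-mono : ∀ v (w : List (Fin k)) → ev v (mono w) ≡ Πv v w
ev-mono {k} v []  = trans (⟪1P⟫ {k} (v ^v_)) (^v-0 v)
ev-mono v (j ∷ w) = trans (ev-* v (var j) (mono w)) (cong₂ _*ℚ_ (ev-var v j) (ev-mono v w))

⟪linear⟫ : ∀ (w : List (Fin k)) φ → ⟪ ΣP (map var w) , φ ⟫ ≡ Σv (φ ∘ unit) w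
⟪linear⟫ []      φ = refl
⟪linear⟫ (j ∷ w) φ = trans (⟪⟫-++ (var j) (ΣP (map var w)) φ) (cong₂ _+ℚ_ (⟪var⟫ j φ) (⟪linear⟫ w φ))

Σv-cong : ∀ {A : Set} {f g : A → ℚ} → (∀ i → f i ≡ g i) → ∀ w → Σv f w ≡ Σv g w
Σv-cong e []      = refl
Σv-cong e (i ∷ w) = cong₂ _+ℚ_ (e i) (Σv-cong e w)

ev-linear : ∀ v (w : List (Fin k)) → ev v (ΣP (map var w)) ≡ Σv v w
ev-linear v w = trans (⟪linear⟫ w (v ^v_)) (Σv-cong (^v-unit v) w)

-- Evaluation at v of the homogeneous component of degree d.
Ev : ℕ → (Fin k → ℚ) → Monomial k → ℚ
Ev d v m = (if does (V.sum m ℕP.≟ d) then 1ℚ else 0ℚ) *ℚ (v ^v m)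

⟪⟫-congAll : ∀ (p : Poly k) {φ ψ} → All (λ t → φ (proj₂ t) ≡ ψ (proj₂ t)) p → ⟪ p , φ ⟫ ≡ ⟪ p , ψ ⟫
⟪⟫-congAll []            []       = refl
⟪⟫-congAll ((c , m) ∷ p) (e ∷ es) = cong₂ (λ x y → c *ℚ x +ℚ y) e (⟪⟫-congAll p es)

⟪Ev⟫ : ∀ d (v : Fin k → ℚ) {e} g → Homogeneous e g → ∀ m →
  ⟪ g , (λ m′ → Ev d v (m ⊕ m′)) ⟫ ≡ ((if does (V.sum m + e ℕP.≟ d) then 1ℚ else 0ℚ) *ℚ (v ^v m)) *ℚ ev v g
⟪Ev⟫ d v {e} g h m = trans
  (⟪⟫-congAll g (All.map (λ {t} s → trans
    (cong₂ (λ x y → (if does (x ℕP.≟ d) then 1ℚ else 0ℚ) *ℚ y)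
      (trans (sum-⊕ m (proj₂ t)) (cong (V.sum m +_) s)) (^v-⊕ v m (proj₂ t)))
    (sym (ℚP.*-assoc (if does (V.sum m + e ℕP.≟ d) then 1ℚ else 0ℚ) (v ^v m) (v ^v (proj₂ t))))) h))
  (⟪⟫-* g ((if does (V.sum m + e ℕP.≟ d) then 1ℚ else 0ℚ) *ℚ (v ^v m)) (v ^v_))

-- Multiples of `g` either miss degree `d` altogether or carry the factor `ev v g`.
⟪Ev⟫≡0 : ∀ d (v : Fin k → ℚ) {e} g → Homogeneous e g → d < e ⊎ ev v g ≡ 0ℚ →
  ∀ m → ⟪ g , (λ m′ → Ev d v (m ⊕ m′)) ⟫ ≡ 0ℚ
⟪Ev⟫≡0 d v {e} g h (inj₂ z)   m =
  trans (⟪Ev⟫ d v g h m) (trans (cong (((if does (V.sum m + e ℕP.≟ d) then 1ℚ else 0ℚ) *ℚ (v ^v m)) *ℚ_) z) (ℚP.*-zeroʳ ((if does (V.sum m + e ℕP.≟ d) then 1ℚ else 0ℚ) *ℚ (v ^v m))))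
⟪Ev⟫≡0 d v {e} g h (inj₁ d<e) m = trans (⟪Ev⟫ d v g h m)
  (trans (cong (λ b → ((if b then 1ℚ else 0ℚ) *ℚ (v ^v m)) *ℚ ev v g) (dec-false (V.sum m + e ℕP.≟ d) s≢d))
  (trans (cong (_*ℚ ev v g) (ℚP.*-zeroˡ (v ^v m))) (ℚP.*-zeroˡ (ev v g))))
  where
  s≢d : V.sum m + e ≢ d
  s≢d s≡d = ℕP.<⇒≱ d<e (ℕP.≤-trans (ℕP.m≤n+m e (V.sum m)) (ℕP.≤-reflexive s≡d))

⟪Ev⟫-mono : ∀ {d} (v : Fin k → ℚ) (w : List (Fin k)) → length w ≡ d → ⟪ mono w , Ev d v ⟫ ≡ Πv v w
⟪Ev⟫-mono v w refl = trans
  (⟪⟫-congAll (mono w) {Ev (length w) v} {v ^v_} (All.map (λ {t} s → one (proj₂ t) s) (Homogeneous-mono w)))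
  (ev-mono v w)
  where
  one : ∀ m → V.sum m ≡ length w → Ev (length w) v m ≡ v ^v m
  one m s = trans (cong (λ b → (if b then 1ℚ else 0ℚ) *ℚ (v ^v m)) (dec-true (V.sum m ℕP.≟ length w) s))
    (ℚP.*-identityˡ (v ^v m))

-- Basis monomials in degrees at most 3 and the functionals dual to them.

-- Indices 0, 1, 2 stand for the chain T ⊃ H ⊃ G, indices 3, …, 9 for the hyperplanes P₀, …, P₆.
Word : Set
Word = List (Fin 10)

powers : ℕ → Vec Word 7
powers d = tabulate (λ a → L.replicate d (3 F.↑ʳ a))

size : ℕ → ℕ
size 0 = 1
size 1 = 10
size 2 = 13
size 3 = 17
size _ = 0

words : ∀ d → Vec Word (size d)
words 0 = [] ∷ []
words 1 = (0F ∷ []) ∷ (1F ∷ []) ∷ (2F ∷ []) ∷ powers 1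
words 2 = (0F ∷ 0F ∷ []) ∷ (0F ∷ 1F ∷ []) ∷ (0F ∷ 2F ∷ []) ∷ (1F ∷ 1F ∷ []) ∷ (1F ∷ 2F ∷ []) ∷
          (2F ∷ 2F ∷ []) ∷ powers 2
words 3 = (0F ∷ 0F ∷ 0F ∷ []) ∷ (0F ∷ 0F ∷ 1F ∷ []) ∷ (0F ∷ 0F ∷ 2F ∷ []) ∷ (0F ∷ 1F ∷ 1F ∷ []) ∷
          (0F ∷ 1F ∷ 2F ∷ []) ∷ (0F ∷ 2F ∷ 2F ∷ []) ∷ (1F ∷ 1F ∷ 1F ∷ []) ∷ (1F ∷ 1F ∷ 2F ∷ []) ∷
          (1F ∷ 2F ∷ 2F ∷ []) ∷ (2F ∷ 2F ∷ 2F ∷ []) ∷ powers 3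
words (suc (suc (suc (suc _)))) = []

data Point : Set where
  chain : ℚ → ℚ → ℚ → Point
  axis  : Fin 7 → Point

coord : Point → Fin 10 → ℚ
coord (chain t y z) 0F = t
coord (chain t y z) 1F = y
coord (chain t y z) 2F = z
coord (chain t y z) (suc (suc (suc _))) = 0ℚ
coord (axis a) (suc (suc (suc b))) = if does (a F.≟ b) then 1ℚ else 0ℚ
coord (axis a) _ = 0ℚ

-- Coefficient extraction is written with point values, because vanishing on the ideal can then be
-- checked point by point. The weights are polarization: for a cubic form in two variables, half the
-- difference of its values at (1, 1) and (1, -1) is the sum of the coefficients of t²y and y³, half
-- their sum is that of t³ and ty², and the pure powers are subtracted by values at unit points. The
-- coefficient of the product of all three variables is an inclusion-exclusion over the points with
-- coordinates 0 and 1.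
Cubature : Set
Cubature = List (ℚ × Point)

-1ℚ -½ : ℚ
-1ℚ = - 1ℚ
-½  = - ½

axes : Vec Cubature 7
axes = tabulate (λ a → (1ℚ , axis a) ∷ [])

e₀ e₁ e₂ e₀₁ e₀₂ e₁₂ : Point
e₀  = chain 1ℚ 0ℚ 0ℚ
e₁  = chain 0ℚ 1ℚ 0ℚ
e₂  = chain 0ℚ 0ℚ 1ℚ
e₀₁ = chain 1ℚ 1ℚ 0ℚ
e₀₂ = chain 1ℚ 0ℚ 1ℚ
e₁₂ = chain 0ℚ 1ℚ 1ℚ

-- The coefficient of each basis monomial of degree d, as a weighted sum of point evaluations.
duals : ∀ d → Vec Cubature (size d)
duals 0 = ((1ℚ , e₀) ∷ []) ∷ []
duals 1 = ((1ℚ , e₀) ∷ []) ∷ ((1ℚ , e₁) ∷ []) ∷ ((1ℚ , e₂) ∷ []) ∷ axes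
duals 2 =
  ((1ℚ , e₀) ∷ []) ∷
  ((1ℚ , e₀₁) ∷ (-1ℚ , e₀) ∷ (-1ℚ , e₁) ∷ []) ∷
  ((1ℚ , e₀₂) ∷ (-1ℚ , e₀) ∷ (-1ℚ , e₂) ∷ []) ∷
  ((1ℚ , e₁) ∷ []) ∷
  ((1ℚ , e₁₂) ∷ (-1ℚ , e₁) ∷ (-1ℚ , e₂) ∷ []) ∷
  ((1ℚ , e₂) ∷ []) ∷ axes
duals 3 =
  ((1ℚ , e₀) ∷ []) ∷
  ((½ , e₀₁) ∷ (-½ , chain 1ℚ -1ℚ 0ℚ) ∷ (-1ℚ , e₁) ∷ []) ∷
  ((½ , e₀₂) ∷ (-½ , chain 1ℚ 0ℚ -1ℚ) ∷ (-1ℚ , e₂) ∷ []) ∷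
  ((½ , e₀₁) ∷ (½ , chain 1ℚ -1ℚ 0ℚ) ∷ (-1ℚ , e₀) ∷ []) ∷
  ((1ℚ , chain 1ℚ 1ℚ 1ℚ) ∷ (-1ℚ , e₀₁) ∷ (-1ℚ , e₀₂) ∷ (-1ℚ , e₁₂) ∷ (1ℚ , e₀) ∷ (1ℚ , e₁) ∷ (1ℚ , e₂) ∷ []) ∷
  ((½ , e₀₂) ∷ (½ , chain 1ℚ 0ℚ -1ℚ) ∷ (-1ℚ , e₀) ∷ []) ∷
  ((1ℚ , e₁) ∷ []) ∷
  ((½ , e₁₂) ∷ (-½ , chain 0ℚ 1ℚ -1ℚ) ∷ (-1ℚ , e₂) ∷ []) ∷
  ((½ , e₁₂) ∷ (½ , chain 0ℚ 1ℚ -1ℚ) ∷ (-1ℚ , e₁) ∷ []) ∷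
  ((1ℚ , e₂) ∷ []) ∷ axes
duals (suc (suc (suc (suc _)))) = []

apply : Cubature → Word → ℚ
apply c w = Σv (λ t → proj₁ t *ℚ Πv (coord (proj₂ t)) w) c

DualTo : ℕ → Set
DualTo d = ∀ (j l : Fin (size d)) →
  apply (lookup (duals d) j) (lookup (words d) l) ≡ (if does (j F.≟ l) then 1ℚ else 0ℚ)

dual? : ∀ d → Dec (DualTo d)
dual? d = FP.all? λ j → FP.all? λ l → _ ℚP.≟ _

duals₁ : DualTo 1
duals₁ = from-yes (dual? 1)

duals₂ : DualTo 2
duals₂ = from-yes (dual? 2)

duals₃ : DualTo 3
duals₃ = from-yes (dual? 3)

lengths : ∀ d → VA.All (λ w → length w ≡ d) (words d)
lengths 0 = refl VA.∷ VA.[]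
lengths 1 = from-yes (VA.all? (λ w → length w ℕP.≟ 1) (words 1))
lengths 2 = from-yes (VA.all? (λ w → length w ℕP.≟ 2) (words 2))
lengths 3 = from-yes (VA.all? (λ w → length w ℕP.≟ 3) (words 3))
lengths (suc (suc (suc (suc _)))) = VA.[]

insert : Fin 10 → Word → Word
insert q []      = q ∷ []
insert q (b ∷ w) = if does (q F.≤? b) then q ∷ b ∷ w else b ∷ insert q w

insert-↭ : ∀ q w → (q ∷ w) ↭ insert q w
insert-↭ q []      = Perm.refl
insert-↭ q (b ∷ w) with does (q F.≤? b)
... | true  = Perm.refl
... | false = Perm.trans (Perm.swap q b Perm.refl) (Perm.prep b (insert-↭ q w))

-- The pairs of core variables whose product is zero in the Chow ring: distinct, and at least one of
-- them a hyperplane.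
Isolated : Fin 10 → Fin 10 → Set
Isolated q b = q ≢ b × (3 ≤ toℕ q ⊎ 3 ≤ toℕ b)

HeadIsolated : Fin 10 → Word → Set
HeadIsolated q []      = ⊥
HeadIsolated q (b ∷ w) = Isolated q b

headIsolated? : ∀ q w → Dec (HeadIsolated q w)
headIsolated? q []      = no λ ()
headIsolated? q (b ∷ w) = ¬? (q F.≟ b) ×-dec (3 ℕP.≤? toℕ q ⊎-dec 3 ℕP.≤? toℕ b)

-- Words are kept nondecreasing. Comparing `q` with the first letter is enough to detect a zero
-- product: a listed word is either a word in the chain letters or a power of one hyperplane letter.
Closed : ℕ → Set
Closed d = ∀ (q : Fin 10) (j : Fin (size d)) →
  (∃ λ (l : Fin (size (suc d))) → insert q (lookup (words d) j) ≡ lookup (words (suc d)) l)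
  ⊎ HeadIsolated q (lookup (words d) j)

closed? : ∀ d → Dec (Closed d)
closed? d = FP.all? λ q → FP.all? λ j →
  FP.any? (λ l → LP.≡-dec F._≟_ _ _) ⊎-dec headIsolated? q _

closed₀ : Closed 0
closed₀ = from-yes (closed? 0)

closed₁ : Closed 1
closed₁ = from-yes (closed? 1)

closed₂ : Closed 2
closed₂ = from-yes (closed? 2)

-- Dimensions of the graded pieces from spanning and duality.

module Graded {Gen : Set} (gen : Gen → Poly k) (core : Fin 10 → Fin k) where

  basis : ∀ d → Vec (Poly k) (size d)
  basis d = V.map (mono ∘ map core) (words d)

  basis-homogeneous : ∀ d → VA.All (Homogeneous d) (basis d)
  basis-homogeneous d = VAP.map⁺ (VA.map (λ {w} e →
    subst (λ i → Homogeneous i (mono (map core w))) (trans (LP.length-map core w) e)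
      (Homogeneous-mono (map core w))) (lengths d))

  basis₁ : ∀ q → lookup (basis 1) q ≡ mono (core q ∷ [])
  basis₁ 0F = refl
  basis₁ 1F = refl
  basis₁ 2F = refl
  basis₁ 3F = refl
  basis₁ 4F = refl
  basis₁ 5F = refl
  basis₁ 6F = refl
  basis₁ 7F = refl
  basis₁ 8F = refl
  basis₁ 9F = refl

  module _ (linear : ∀ i → Spanned gen (basis 1) (var i))
           (isolated : ∀ {q b} → Isolated q b → Ideal gen (var (core q) *P var (core b))) where

    private
      -- Sorting the new letter into the word yields a listed basis monomial, unless the letter and
      -- the first one of the word already multiply into the ideal.
      products : ∀ d → Closed d → ∀ q j → Spanned gen (basis (suc d)) (lookup (basis 1) q *P lookup (basis d) j)
      products d closed q j
        rewrite basis₁ q | VP.lookup-map j (mono ∘ map core) (words d) =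
        Spanned-resp gen (basis (suc d)) (*P-cong _ (var (core q)) _ _ (*P-1P (var (core q))) (mk≃ λ _ → refl))
          (go (closed q j))
        where
        w = lookup (words d) j
        go : (∃ λ l → insert q w ≡ lookup (words (suc d)) l) ⊎ HeadIsolated q w →
             Spanned gen (basis (suc d)) (mono (map core (q ∷ w)))
        go (inj₁ (l , e)) = Spanned-resp gen (basis (suc d))
          (mono-↭ (PermP.map⁺ core (insert-↭ q w)))
          (subst (Spanned gen (basis (suc d)))
            (trans (VP.lookup-map l (mono ∘ map core) (words (suc d))) (cong (mono ∘ map core) (sym e)))
            (Spanned-lookup gen (basis (suc d)) l))
        go (inj₂ h) = bad w h
          where
          bad : ∀ w → HeadIsolated q w → Spanned gen (basis (suc d)) (mono (map core (q ∷ w)))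
          bad (b ∷ w) h = Ideal⇒Spanned gen (basis (suc d)) (Ideal-resp gen (mk≃ λ φ → trans
            (sym (*P-assoc (var (core q)) (var (core b)) (mono (map core w)) .at φ))
            (*P-comm _ (mono (map core w)) .at φ)) (Ideal-* gen (mono (map core w)) (isolated h)))

      spans₀ : ∀ p → Homogeneous 0 p → Spanned gen (basis 0) p
      spans₀ [] [] = Ideal⇒Spanned gen (basis 0) (Ideal-0 gen)
      spans₀ ((c , m) ∷ p) (s ∷ h) = Spanned-++ gen (basis 0) {(c , m) ∷ []} {p}
        (Spanned-resp gen (basis 0) (mk≃ λ φ → sym (trans (⟪·P⟫ c 1P φ)
            (trans (cong (c *ℚ_) (⟪1P⟫ {k} φ)) (trans (cong (λ m → c *ℚ φ m) (sym (zeros m s))) (sym (ℚP.+-identityʳ _))))))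
          (Spanned-·P gen (basis 0) c (Spanned-lookup gen (basis 0) zero)))
        (spans₀ p h)
        where
        zeros : ∀ {l} (m : Vec ℕ l) → V.sum m ≡ 0 → m ≡ replicate l 0
        zeros []         _ = refl
        zeros (zero ∷ m) s = cong (0 ∷_) (zeros m s)

      spans-suc : ∀ d → Closed d → (∀ p → Homogeneous d p → Spanned gen (basis d) p) →
        ∀ p → Homogeneous (suc d) p → Spanned gen (basis (suc d)) p
      spans-suc d closed = Spanned-step gen (basis 1) (basis d) (basis (suc d)) linear (products d closed)

    spans₁ : ∀ p → Homogeneous 1 p → Spanned gen (basis 1) p
    spans₁ = spans-suc 0 closed₀ spans₀

    spans₂ : ∀ p → Homogeneous 2 p → Spanned gen (basis 2) p
    spans₂ = spans-suc 1 closed₁ spans₁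

    spans₃ : ∀ p → Homogeneous 3 p → Spanned gen (basis 3) p
    spans₃ = spans-suc 2 closed₂ spans₂

  module _ (extend : Point → Fin k → ℚ) (extend-core : ∀ u q → extend u (core q) ≡ coord u q)
           (annihilates : ∀ {d} → d ≤ 3 → ∀ u → Annihilates gen (Ev d (extend u))) where

    private
      functional : ℕ → Cubature → Monomial k → ℚ
      functional d c m = Σv (λ t → proj₁ t *ℚ Ev d (extend (proj₂ t)) m) c

      ⟪functional⟫ : ∀ d c p → ⟪ p , functional d c ⟫ ≡ Σv (λ t → proj₁ t *ℚ ⟪ p , Ev d (extend (proj₂ t)) ⟫) c
      ⟪functional⟫ d []            p = ⟪⟫-0 p
      ⟪functional⟫ d ((a , u) ∷ c) p = trans (⟪⟫-+ p (λ m → a *ℚ Ev d (extend u) m) (functional d c))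
        (cong₂ _+ℚ_ (⟪⟫-* p a (Ev d (extend u))) (⟪functional⟫ d c p))

      functional-ideal : ∀ {d} → d ≤ 3 → ∀ c {p} → Ideal gen p → ⟪ p , functional d c ⟫ ≡ 0ℚ
      functional-ideal {d} d≤3 c {p} h = trans (⟪functional⟫ d c p) (zeros c)
        where
        zeros : ∀ c → Σv (λ t → proj₁ t *ℚ ⟪ p , Ev d (extend (proj₂ t)) ⟫) c ≡ 0ℚ
        zeros []            = refl
        zeros ((a , u) ∷ c) = cong₂ _+ℚ_
          (trans (cong (a *ℚ_) (Annihilates⇒≡0 gen {Ev d (extend u)} (annihilates d≤3 u) h)) (ℚP.*-zeroʳ a)) (zeros c)

      Πv-core : ∀ u w → Πv (extend u) (map core w) ≡ Πv (coord u) w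
      Πv-core u []      = refl
      Πv-core u (q ∷ w) = cong₂ _*ℚ_ (extend-core u q) (Πv-core u w)

      functional-basis : ∀ d c l → ⟪ lookup (basis d) l , functional d c ⟫ ≡ apply c (lookup (words d) l)
      functional-basis d c l rewrite VP.lookup-map l (mono ∘ map core) (words d) = trans
        (⟪functional⟫ d c (mono (map core w)))
        (Σv-cong (λ t → cong (proj₁ t *ℚ_) (trans
          (⟪Ev⟫-mono (extend (proj₂ t)) (map core w) (trans (LP.length-map core w) (VAP.lookup⁺ (lengths d) l)))
          (Πv-core (proj₂ t) w))) c)
        where w = lookup (words d) l

    independent : ∀ {d} → d ≤ 3 → DualTo d → ∀ c → InIdeal gen (lincomb c (basis d)) → ∀ j → lookup c j ≡ 0ℚ
    independent {d} d≤3 dual c h j = trans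
      (sym (⟪lincomb⟫-dual c (basis d) (functional d (lookup (duals d) j)) j
        (λ l → trans (functional-basis d (lookup (duals d) j) l) (dual j l))))
      (functional-ideal d≤3 (lookup (duals d) j) {lincomb c (basis d)} (InIdeal⇒Ideal gen h))

  notLogConcave :
    (∀ i → Spanned gen (basis 1) (var i)) →
    (∀ {q b} → Isolated q b → Ideal gen (var (core q) *P var (core b))) →
    (extend : Point → Fin k → ℚ) → (∀ u q → extend u (core q) ≡ coord u q) →
    (∀ {d} → d ≤ 3 → ∀ u → Annihilates gen (Ev d (extend u))) →
    NotLogConcave gen
  notLogConcave linear isolated extend extend-core ann =
    1 , 10 , 13 , 17 ,
    dimension (s≤s z≤n) (spans₁ linear isolated) duals₁ ,
    dimension (s≤s (s≤s z≤n)) (spans₂ linear isolated) duals₂ ,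
    dimension (s≤s (s≤s (s≤s z≤n))) (spans₃ linear isolated) duals₃ ,
    -- The inequality is tight: `suc (13 * 13)` and `10 * 17` are both 170.
    ℕP.≤-refl
    where
    dimension : ∀ {d} → d ≤ 3 → (∀ p → Homogeneous d p → Spanned gen (basis d) p) → DualTo d →
                DegreeDim gen d (size d)
    dimension {d} d≤3 spans dual =
      basis d , basis-homogeneous d ,
      (λ p h → Spanned.coeffs (spans p h) , Ideal⇒InIdeal gen (Spanned.remainder (spans p h))) ,
      independent extend extend-core ann d≤3 dual

-- Matroids

∈⋃⁺ : ∀ {e} {X : Subset n} {l} → X ∈ˡ l → e ∈ X → e ∈ ⋃ l
∈⋃⁺ {X = X} {l = _ ∷ l} (here refl) e∈X = SP.p⊆p∪q (⋃ l) e∈X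
∈⋃⁺ {l = Y ∷ l} (there X∈l) e∈X = SP.q⊆p∪q Y (⋃ l) (∈⋃⁺ X∈l e∈X)

∈⋃⁻ : ∀ {e} (l : List (Subset n)) → e ∈ ⋃ l → ∃ λ X → X ∈ˡ l × e ∈ X
∈⋃⁻ [] e∈ = ⊥-elim (SP.∉⊥ e∈)
∈⋃⁻ (Y ∷ l) e∈ with SP.x∈p∪q⁻ Y (⋃ l) e∈
... | inj₁ e∈Y = Y , here refl , e∈Y
... | inj₂ e∈l with ∈⋃⁻ l e∈l
...   | X , X∈l , e∈X = X , there X∈l , e∈X

∪-lub : ∀ {A B C : Subset n} → A ⊆ C → B ⊆ C → A ∪ B ⊆ C
∪-lub {A = A} {B} A⊆C B⊆C = [ A⊆C , B⊆C ]′ ∘ SP.x∈p∪q⁻ A B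

∪-mono : ∀ {A B C D : Subset n} → A ⊆ C → B ⊆ D → A ∪ B ⊆ C ∪ D
∪-mono {C = C} {D} A⊆C B⊆D = ∪-lub (λ e → SP.p⊆p∪q D (A⊆C e)) (λ e → SP.q⊆p∪q C D (B⊆D e))

⁅⁆⊆ : ∀ {e} {A : Subset n} → e ∈ A → ⁅ e ⁆ ⊆ A
⁅⁆⊆ {e = e} {A} e∈A x∈ = subst (_∈ A) (sym (SP.x∈⁅y⁆⇒x≡y e x∈)) e∈A

lookup-injective : ∀ {A : Set} {xs : List A} → Unique xs → ∀ {i j} → L.lookup xs i ≡ L.lookup xs j → i ≡ j
lookup-injective (_ ∷ _)    {zero}  {zero}  _ = refl
lookup-injective (x≢ ∷ _)   {zero}  {suc j} e = ⊥-elim (All.lookup x≢ (MP.∈-lookup j) e)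
lookup-injective (x≢ ∷ _)   {suc i} {zero}  e = ⊥-elim (All.lookup x≢ (MP.∈-lookup i) (sym e))
lookup-injective (_ ∷ uniq) {suc i} {suc j} e = cong suc (lookup-injective uniq e)

module Rank (M : Matroid n) where
  open Matroid M public

  rk-∪ : ∀ A B → rk (A ∪ B) ≤ rk A + rk B
  rk-∪ A B = ℕP.≤-trans (ℕP.m≤m+n _ (rk (A ∩ B))) (rk-submod A B)

  -- The points of `B` are added one at a time. Submodularity for `A ∪ ⁅ e ⁆` and `A ∪ C`, whose
  -- intersection contains `A`, shows that two sets which do not raise the rank of `A` do not raise
  -- it together.
  rk-absorb : ∀ A B → (∀ {e} → e ∈ B → rk (A ∪ ⁅ e ⁆) ≤ rk A) → rk (A ∪ B) ≤ rk A
  rk-absorb A B h = ℕP.≤-trans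
    (rk-mono (∪-mono {A = A} (λ e → e) (λ {e} e∈B →
      ∈⋃⁺ (MP.∈-map⁺ ⁅_⁆ (MP.∈-filter⁺ (SP._∈? B) (MP.∈-allFin e) e∈B)) (SP.x∈⁅x⁆ e))))
    (go (filter (SP._∈? B) (allFin n)) (All.map h (AllP.all-filter (SP._∈? B) (allFin n))))
    where
    go : ∀ l → All (λ e → rk (A ∪ ⁅ e ⁆) ≤ rk A) l → rk (A ∪ ⋃ (map ⁅_⁆ l)) ≤ rk A
    go [] [] = rk-mono (∪-lub {A = A} (λ e → e) SP.⊥⊆)
    go (e ∷ l) (e≤ ∷ h) = ℕP.+-cancelʳ-≤ (rk A) _ _ (begin
      rk (A ∪ (⁅ e ⁆ ∪ C)) + rk A
        ≤⟨ ℕP.+-mono-≤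
             (rk-mono (∪-lub (λ x → SP.p⊆p∪q (A ∪ C) (SP.p⊆p∪q ⁅ e ⁆ x))
                             (∪-mono (SP.q⊆p∪q A ⁅ e ⁆) (SP.q⊆p∪q A C))))
             (rk-mono (λ x → SP.x∈p∩q⁺ (SP.p⊆p∪q ⁅ e ⁆ x , SP.p⊆p∪q C x))) ⟩
      rk ((A ∪ ⁅ e ⁆) ∪ (A ∪ C)) + rk ((A ∪ ⁅ e ⁆) ∩ (A ∪ C))
        ≤⟨ rk-submod (A ∪ ⁅ e ⁆) (A ∪ C) ⟩
      rk (A ∪ ⁅ e ⁆) + rk (A ∪ C)      ≤⟨ ℕP.+-mono-≤ e≤ (go l h) ⟩
      rk A + rk A                      ∎)
      where
      open ℕP.≤-Reasoning
      C = ⋃ (map ⁅_⁆ l)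

  ∈cl⁺ : ∀ {A e} → rk (A ∪ ⁅ e ⁆) ≤ rk A → e ∈ cl M A
  ∈cl⁺ {A} {e} h = VP.lookup⇒[]= e _ (trans (VP.lookup∘tabulate _ e)
    (Equivalence.to BoolP.T-≡ (ℕP.≡⇒≡ᵇ _ _ (ℕP.≤-antisym h (rk-mono (SP.p⊆p∪q ⁅ e ⁆))))))

  ∈cl⁻ : ∀ {A e} → e ∈ cl M A → rk (A ∪ ⁅ e ⁆) ≤ rk A
  ∈cl⁻ {A} {e} h = ℕP.≤-reflexive (ℕP.≡ᵇ⇒≡ _ _ (Equivalence.from BoolP.T-≡
    (trans (sym (VP.lookup∘tabulate _ e)) (VP.[]=⇒lookup h))))

  ⊆cl : ∀ A → A ⊆ cl M A
  ⊆cl A e∈A = ∈cl⁺ (rk-mono (∪-lub {A = A} (λ x → x) (⁅⁆⊆ e∈A)))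

  rk-cl : ∀ A → rk (cl M A) ≤ rk A
  rk-cl A = ℕP.≤-trans (rk-mono (SP.q⊆p∪q A (cl M A))) (rk-absorb A (cl M A) ∈cl⁻)

  rk-⋃⊆ : ∀ {Y l} → All (_⊆ Y) l → rk (⋃ l) ≤ rk Y
  rk-⋃⊆ {l = l} h = rk-mono λ e∈ → let _ , X∈l , e∈X = ∈⋃⁻ l e∈ in All.lookup h X∈l e∈X

  -- Members contained in Y together contribute at most rk Y, and every other member at most 1;
  -- if some member is contained in Y, its own list entry gives the extra 1.
  rk-⋃ : ∀ Y l → All (λ X → X ⊆ Y ⊎ rk X ≤ 1) l → rk (⋃ l) ≤ length l ⊎ rk (Y ∪ ⋃ l) < rk Y + length l
  rk-⋃ Y [] [] = inj₁ (ℕP.≤-reflexive rk-⊥)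
  rk-⋃ Y (X ∷ l) (inj₂ rkX≤1 ∷ h) with rk-⋃ Y l h
  ... | inj₁ b = inj₁ (ℕP.≤-trans (rk-∪ X (⋃ l)) (ℕP.+-mono-≤ rkX≤1 b))
  ... | inj₂ b = inj₂ (begin
    suc (rk (Y ∪ (X ∪ ⋃ l)))     ≤⟨ s≤s (rk-mono (∪-lub (λ e → SP.q⊆p∪q X _ (SP.p⊆p∪q (⋃ l) e))
                                      (∪-mono (λ e → e) (SP.q⊆p∪q Y (⋃ l))))) ⟩
    suc (rk (X ∪ (Y ∪ ⋃ l)))     ≤⟨ s≤s (ℕP.≤-trans (rk-∪ X _) (ℕP.+-monoˡ-≤ _ rkX≤1)) ⟩
    suc (suc (rk (Y ∪ ⋃ l)))     ≤⟨ s≤s b ⟩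
    suc (rk Y + length l)        ≡⟨ sym (ℕP.+-suc (rk Y) (length l)) ⟩
    rk Y + suc (length l)        ∎)
    where open ℕP.≤-Reasoning
  rk-⋃ Y (X ∷ l) (inj₁ X⊆Y ∷ h) = inj₂ (begin
    suc (rk (Y ∪ (X ∪ ⋃ l)))     ≤⟨ s≤s (rk-mono (∪-lub (SP.p⊆p∪q (⋃ l)) (∪-mono X⊆Y (λ e → e)))) ⟩
    suc (rk (Y ∪ ⋃ l))           ≤⟨ s≤s (tail (rk-⋃ Y l h)) ⟩
    suc (rk Y + length l)        ≡⟨ sym (ℕP.+-suc (rk Y) (length l)) ⟩
    rk Y + suc (length l)        ∎)
    where
    open ℕP.≤-Reasoning
    tail : rk (⋃ l) ≤ length l ⊎ rk (Y ∪ ⋃ l) < rk Y + length l → rk (Y ∪ ⋃ l) ≤ rk Y + length l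
    tail (inj₁ b) = ℕP.≤-trans (rk-∪ Y (⋃ l)) (ℕP.+-monoʳ-≤ (rk Y) b)
    tail (inj₂ b) = ℕP.<⇒≤ b

  -- Here `l` lists the members of S strictly below the given one, whose rank is `ρ`. If they
  -- contribute rank at most one each, the loss in the exponent is made up by their number and the
  -- degree is at least `ρ`. Otherwise the join has rank at most `rk Y + length l - 1`, and the
  -- degree is at least `ρ - rk Y + 1`; this 1 is why a gap of 3 suffices.
  4≤degree : ∀ Y l {ρ} → All (λ X → X ⊆ Y ⊎ rk X ≤ 1) l → 4 ≤ ρ → 3 + rk Y ≤ ρ → 4 ≤ length l + (ρ ∸ rk (⋁ M l))
  4≤degree Y l {ρ} h 4≤ρ 3+Y≤ρ = ℕP.≤-trans (bound (rk-⋃ Y l h)) (ℕP.+-monoʳ-≤ (length l) (ℕP.∸-monoʳ-≤ ρ (rk-cl (⋃ l))))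
    where
    open ℕP.≤-Reasoning
    x = rk (⋃ l)
    bound : x ≤ length l ⊎ rk (Y ∪ ⋃ l) < rk Y + length l → 4 ≤ length l + (ρ ∸ x)
    bound (inj₁ b) = begin
      4                    ≤⟨ 4≤ρ ⟩
      ρ                    ≤⟨ ℕP.m≤n+m∸n ρ x ⟩
      x + (ρ ∸ x)          ≤⟨ ℕP.+-monoˡ-≤ (ρ ∸ x) b ⟩
      length l + (ρ ∸ x)   ∎
    bound (inj₂ b) = ℕP.+-cancelˡ-≤ (rk Y) _ _ (begin
      rk Y + 4                      ≡⟨ ℕP.+-comm (rk Y) 4 ⟩
      suc (3 + rk Y)                ≤⟨ s≤s 3+Y≤ρ ⟩
      suc ρ                         ≤⟨ s≤s (ℕP.m≤n+m∸n ρ x) ⟩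
      suc x + (ρ ∸ x)               ≤⟨ ℕP.+-monoˡ-≤ (ρ ∸ x) (ℕP.≤-trans (s≤s (rk-mono (SP.q⊆p∪q Y (⋃ l)))) b) ⟩
      rk Y + length l + (ρ ∸ x)     ≡⟨ ℕP.+-assoc (rk Y) (length l) _ ⟩
      rk Y + (length l + (ρ ∸ x))   ∎)

-- Sums, products and enumerations over lists of indices.

Σv-++ : ∀ (f : A → ℚ) u w → Σv f (u ++ w) ≡ Σv f u +ℚ Σv f w
Σv-++ f []      w = sym (ℚP.+-identityˡ _)
Σv-++ f (i ∷ u) w = trans (cong (f i +ℚ_) (Σv-++ f u w)) (sym (ℚP.+-assoc (f i) (Σv f u) (Σv f w)))

Σv-filter : ∀ {P : Pred A 0ℓ} (P? : Decidable P) (f : A → ℚ) w →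
            Σv f (filter P? w) ≡ Σv (λ i → if does (P? i) then f i else 0ℚ) w
Σv-filter P? f [] = refl
Σv-filter P? f (i ∷ w) with does (P? i)
... | true  = cong (f i +ℚ_) (Σv-filter P? f w)
... | false = trans (Σv-filter P? f w) (sym (ℚP.+-identityˡ _))

Σv-zero : ∀ (h : Fin k → A) (f : A → ℚ) → (∀ r → f (h r) ≡ 0ℚ) → Σv f (L.tabulate h) ≡ 0ℚ
Σv-zero {zero}  h f z = refl
Σv-zero {suc k} h f z = cong₂ _+ℚ_ (z zero) (Σv-zero (h ∘ suc) f (z ∘ suc))

Σv-single : ∀ (h : Fin k → A) (f : A → ℚ) r → (∀ r′ → r′ ≢ r → f (h r′) ≡ 0ℚ) → Σv f (L.tabulate h) ≡ f (h r)
Σv-single h f zero    z = trans (cong (f (h zero) +ℚ_) (Σv-zero (h ∘ suc) f (λ r → z (suc r) λ ())))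
  (ℚP.+-identityʳ _)
Σv-single h f (suc r) z = trans
  (cong₂ _+ℚ_ (z zero λ ()) (Σv-single (h ∘ suc) f r (λ r′ ne → z (suc r′) (ne ∘ FP.suc-injective))))
  (ℚP.+-identityˡ _)

ev-^ : ∀ v (p : Poly k) r → ev v (p ^P r) ≡ pow (ev v p) r
ev-^ {k} v p zero = trans (⟪1P⟫ {k} (v ^v_)) (^v-0 v)
ev-^ v p (suc r)  = trans (ev-* v p (p ^P r)) (cong (ev v p *ℚ_) (ev-^ v p r))

Πv-zero : ∀ {v : A → ℚ} {i w} → i ∈ˡ w → v i ≡ 0ℚ → Πv v w ≡ 0ℚ
Πv-zero {v = v} {w = _ ∷ w} (here refl) z = trans (cong (_*ℚ Πv v w) z) (ℚP.*-zeroˡ (Πv v w))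
Πv-zero {v = v} {w = j ∷ w} (there i∈w) z = trans (cong (v j *ℚ_) (Πv-zero {v = v} i∈w z)) (ℚP.*-zeroʳ (v j))

pow-zero : ∀ {x r} → x ≡ 0ℚ → 0 < r → pow x r ≡ 0ℚ
pow-zero {r = suc r} refl _ = ℚP.*-zeroˡ (pow 0ℚ r)

mono-singleton : ∀ (i : Fin k) → var i ≃ mono (i ∷ [])
mono-singleton {k} i .at φ = sym (trans (⟪var*⟫ i 1P φ)
  (trans (⟪1P⟫ {k} (λ m → φ (unit i ⊕ m))) (trans (cong φ (⊕0 (unit i))) (sym (⟪var⟫ i φ)))))

-- `ChowGen` multiplies the variables of S in index order. Duplicate-free lists with the same
-- members are permutations of each other, so that order need not be known.
elements-↭ : ∀ (S : Subset k) l → Unique l → (∀ {i} → i ∈ S → i ∈ˡ l) → (∀ {i} → i ∈ˡ l → i ∈ S) →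
             filter (λ i → i SP.∈? S) (allFin k) ↭ l
elements-↭ {k} S l uniq ⊆l l⊆ = ∼bag⇒↭ (MPK.unique∧set⇒bag (UP.filter⁺ (λ i → i SP.∈? S) (UP.allFin⁺ k)) uniq
  (mk⇔ (⊆l ∘ proj₂ ∘ MP.∈-filter⁻ (λ i → i SP.∈? S) {xs = allFin k})
       (λ i∈l → MP.∈-filter⁺ (λ i → i SP.∈? S) (MP.∈-allFin _) (l⊆ i∈l))))

-- The Chow ring of a configuration

-- The relations of degree 2 come from the last three fields, always taken at the member `T`. By
-- `rkT` the set S = {P a} leaves exponent 1 and gives x_P x_T. By `P∨G` and `P∨P` a hyperplane
-- together with `G`, `H` or another hyperplane has join of full rank in `T`, so the exponent is 0
-- and the product of the two variables is itself a generator.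
record Configuration (M : Matroid n) : Set where
  open Matroid M
  field
    T H G   : Subset n
    P       : Fin 7 → Subset n
    G⊆H     : G ⊆ H
    H⊆T     : H ⊆ T
    P⊆T     : ∀ a → P a ⊆ T
    rk-⁅⁆   : ∀ e → rk ⁅ e ⁆ ≡ 1
    4≤rkG   : 4 ≤ rk G
    rkG≪rkH : 3 + rk G ≤ rk H
    rkH≪rkT : 3 + rk H ≤ rk T
    rkT     : ∀ a → rk T ≡ suc (rk (P a))
    P∨G     : ∀ a → rk T ≤ rk (P a ∪ G)
    P∨P     : ∀ {a b} → a ≢ b → rk T ≤ rk (P a ∪ P b)

  coreSet : Fin 10 → Subset n
  coreSet 0F = T
  coreSet 1F = H
  coreSet 2F = G
  coreSet (suc (suc (suc a))) = P a

  singletons : List (Subset n)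
  singletons = map ⁅_⁆ (allFin n)

  building : List (Subset n)
  building = map coreSet (allFin 10) ++ singletons

module Chow {M : Matroid n} (C : Configuration M) where
  open Rank M
  open Configuration C

  s : ℕ
  s = length singletons

  Index : Set
  Index = Fin (10 + s)

  flat : Index → Subset n
  flat = L.lookup building

  core : Fin 10 → Index
  core q = q F.↑ˡ s

  atom : Fin s → Index
  atom r = 10 F.↑ʳ r

  flat-core : ∀ q → flat (core q) ≡ coreSet q
  flat-core 0F = refl
  flat-core 1F = refl
  flat-core 2F = refl
  flat-core 3F = refl
  flat-core 4F = refl
  flat-core 5F = refl
  flat-core 6F = refl
  flat-core 7F = refl
  flat-core 8F = refl
  flat-core 9F = refl

  point : ∀ r → ∃ λ e → flat (atom r) ≡ ⁅ e ⁆
  point r with MP.∈-map⁻ ⁅_⁆ (MP.∈-lookup {xs = singletons} r)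
  ... | e , _ , eq = e , eq

  data Kind : Index → Set where
    isCore : ∀ q → Kind (core q)
    isAtom : ∀ r → Kind (atom r)

  kind : ∀ i → Kind i
  kind i with F.splitAt 10 i | FP.join-splitAt 10 s i
  ... | inj₁ q | refl = isCore q
  ... | inj₂ r | refl = isAtom r

  rkG≤rkP : ∀ a → 4 + rk G ≤ rk (P a)
  rkG≤rkP a = ℕP.≤-pred (begin
    5 + rk G       ≤⟨ ℕP.n≤1+n _ ⟩
    3 + (3 + rk G)  ≤⟨ ℕP.+-monoʳ-≤ 3 rkG≪rkH ⟩
    3 + rk H       ≤⟨ rkH≪rkT ⟩
    rk T            ≡⟨ rkT a ⟩
    suc (rk (P a))  ∎)
    where open ℕP.≤-Reasoning

  rkH<rkP : ∀ a → rk H < rk (P a)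
  rkH<rkP a = ℕP.≤-pred (ℕP.≤-trans (ℕP.n≤1+n _) (ℕP.≤-trans rkH≪rkT (ℕP.≤-reflexive (rkT a))))

  rkP<rkT : ∀ a → rk (P a) < rk T
  rkP<rkT a = ℕP.≤-reflexive (sym (rkT a))

  rkG<rkH : rk G < rk H
  rkG<rkH = ℕP.≤-trans (s≤s (ℕP.m≤n+m (rk G) 2)) rkG≪rkH

  rkH<rkT : rk H < rk T
  rkH<rkT = ℕP.≤-trans (s≤s (ℕP.m≤n+m (rk H) 2)) rkH≪rkT

  ⊈-rk : ∀ {A B} → rk B < rk A → ¬ A ⊆ B
  ⊈-rk lt A⊆B = ℕP.<⇒≱ lt (rk-mono A⊆B)

  G⊈P : ∀ a → ¬ G ⊆ P a
  G⊈P a G⊆P = ⊈-rk (ℕP.<-≤-trans (rkP<rkT a) (P∨G a)) (∪-lub {A = P a} (λ e → e) G⊆P)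

  P⊈P : ∀ {a b} → a ≢ b → ¬ P a ⊆ P b
  P⊈P {a} {b} a≢b Pa⊆Pb = ⊈-rk (ℕP.<-≤-trans (rkP<rkT b) (P∨P a≢b)) (∪-lub {A = P a} Pa⊆Pb (λ e → e))

  -- All strict inclusions among the core sets; `core-⊆` rules out any other, by rank or because a
  -- hyperplane containing `G` would violate `P∨G`.
  data _◁_ : Fin 10 → Fin 10 → Set where
    H◁T : 1F ◁ 0F
    G◁T : 2F ◁ 0F
    G◁H : 2F ◁ 1F
    P◁T : ∀ a → suc (suc (suc a)) ◁ 0F

  core-⊆ : ∀ q b → coreSet q ⊆ coreSet b → q ≡ b ⊎ q ◁ b
  core-⊆ 0F 0F _ = inj₁ refl
  core-⊆ 0F 1F h = ⊥-elim (⊈-rk rkH<rkT h)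
  core-⊆ 0F 2F h = ⊥-elim (⊈-rk (ℕP.<-trans rkG<rkH rkH<rkT) h)
  core-⊆ 0F (suc (suc (suc b))) h = ⊥-elim (⊈-rk (rkP<rkT b) h)
  core-⊆ 1F 0F _ = inj₂ H◁T
  core-⊆ 1F 1F _ = inj₁ refl
  core-⊆ 1F 2F h = ⊥-elim (⊈-rk rkG<rkH h)
  core-⊆ 1F (suc (suc (suc b))) h = ⊥-elim (G⊈P b (λ e → h (G⊆H e)))
  core-⊆ 2F 0F _ = inj₂ G◁T
  core-⊆ 2F 1F _ = inj₂ G◁H
  core-⊆ 2F 2F _ = inj₁ refl
  core-⊆ 2F (suc (suc (suc b))) h = ⊥-elim (G⊈P b h)
  core-⊆ (suc (suc (suc a))) 0F _ = inj₂ (P◁T a)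
  core-⊆ (suc (suc (suc a))) 1F h = ⊥-elim (⊈-rk (rkH<rkP a) h)
  core-⊆ (suc (suc (suc a))) 2F h = ⊥-elim (⊈-rk (ℕP.<-trans rkG<rkH (rkH<rkP a)) h)
  core-⊆ (suc (suc (suc a))) (suc (suc (suc b))) h with a F.≟ b
  ... | yes refl = inj₁ refl
  ... | no a≢b   = ⊥-elim (P⊈P a≢b h)

  4≤rk-core : ∀ q → 4 ≤ rk (coreSet q)
  4≤rk-core 0F = ℕP.≤-trans 4≤rkG (ℕP.<⇒≤ (ℕP.<-trans rkG<rkH rkH<rkT))
  4≤rk-core 1F = ℕP.≤-trans 4≤rkG (ℕP.<⇒≤ rkG<rkH)
  4≤rk-core 2F = 4≤rkG
  4≤rk-core (suc (suc (suc a))) = ℕP.≤-trans 4≤rkG (ℕP.≤-trans (ℕP.m≤n+m (rk G) 4) (rkG≤rkP a))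

  core⊈⁅⁆ : ∀ q e → ¬ coreSet q ⊆ ⁅ e ⁆
  core⊈⁅⁆ q e = ⊈-rk (ℕP.≤-trans (s≤s (ℕP.≤-reflexive (rk-⁅⁆ e))) (ℕP.≤-trans (s≤s (s≤s z≤n)) (4≤rk-core q)))

  building-unique : Unique building
  building-unique = UP.++⁺
    (UP.map⁺ coreSet-injective (UP.allFin⁺ 10))
    (UP.map⁺ ⁅⁆-injective (UP.allFin⁺ n))
    (λ (inCore , inAtoms) → disjoint (MP.∈-map⁻ coreSet {xs = allFin 10} inCore) (MP.∈-map⁻ ⁅_⁆ {xs = allFin n} inAtoms))
    where
    ◁-asym : ∀ {q b} → q ◁ b → b ◁ q → ⊥
    ◁-asym H◁T ()
    ◁-asym G◁T ()
    ◁-asym G◁H ()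
    ◁-asym (P◁T a) ()
    coreSet-injective : ∀ {q b} → coreSet q ≡ coreSet b → q ≡ b
    coreSet-injective {q} {b} e with core-⊆ q b (SP.⊆-reflexive e) | core-⊆ b q (SP.⊆-reflexive (sym e))
    ... | inj₁ q≡b | _        = q≡b
    ... | inj₂ _   | inj₁ b≡q = sym b≡q
    ... | inj₂ lt  | inj₂ gt  = ⊥-elim (◁-asym lt gt)
    ⁅⁆-injective : ∀ {e e′ : Fin n} → ⁅ e ⁆ ≡ ⁅ e′ ⁆ → e ≡ e′
    ⁅⁆-injective {e} {e′} eq = SP.x∈⁅y⁆⇒x≡y e′ (subst (e ∈_) eq (SP.x∈⁅x⁆ e))
    disjoint : ∀ {X} → (∃ λ q → q ∈ˡ allFin 10 × X ≡ coreSet q) → (∃ λ e → e ∈ˡ allFin n × X ≡ ⁅ e ⁆) → ⊥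
    disjoint (q , _ , refl) (e , _ , eq) = core⊈⁅⁆ q e (SP.⊆-reflexive eq)

  flat-injective : ∀ {i j} → flat i ≡ flat j → i ≡ j
  flat-injective = lookup-injective building-unique

  flat⊆atom : ∀ i r → flat i ⊆ flat (atom r) → i ≡ atom r
  flat⊆atom i r h with kind i | point r
  ... | isCore q | e , eq = ⊥-elim (core⊈⁅⁆ q e (subst₂ _⊆_ (flat-core q) eq h))
  ... | isAtom r′ | e , eq with point r′
  ...   | e′ , eq′ = flat-injective (trans eq′ (trans (cong ⁅_⁆ (SP.x∈⁅y⁆⇒x≡y e
            (subst₂ _⊆_ eq′ eq h (SP.x∈⁅x⁆ e′)))) (sym eq)))

  rk-atom : ∀ r → rk (flat (atom r)) ≡ 1
  rk-atom r with point r
  ... | e , eq = trans (cong rk eq) (rk-⁅⁆ e)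

  T⊆flat : ∀ i → T ⊆ flat i → i ≡ core 0F
  T⊆flat i h with kind i
  ... | isAtom r = sym (flat⊆atom (core 0F) r h)
  ... | isCore q with core-⊆ 0F q (subst (T ⊆_) (flat-core q) h)
  ...   | inj₁ refl = refl

  above : Index → List Index
  above j = filter (λ i → flat j SP.⊆? flat i) (allFin (10 + s))

  h : Index → Poly (10 + s)
  h j = ΣP (map var (above j))

  Σv-above-T : ∀ f → Σv f (above (core 0F)) ≡ f (core 0F)
  Σv-above-T f = begin
    Σv f (above (core 0F))
      ≡⟨ Σv-filter (λ i → T SP.⊆? flat i) f (allFin (10 + s)) ⟩
    Σv (λ i → if does (T SP.⊆? flat i) then f i else 0ℚ) (allFin (10 + s))
      ≡⟨ Σv-single (λ i → i) (λ i → if does (T SP.⊆? flat i) then f i else 0ℚ) (core 0F)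
           (λ i i≢ → cong (λ b → if b then f i else 0ℚ) (dec-false (T SP.⊆? flat i) (λ T⊆ → i≢ (T⊆flat i T⊆)))) ⟩
    (if does (T SP.⊆? flat (core 0F)) then f (core 0F) else 0ℚ)
      ≡⟨ cong (λ b → if b then f (core 0F) else 0ℚ) (dec-true (T SP.⊆? T) (λ e → e)) ⟩
    f (core 0F) ∎
    where open ≡-Reasoning

  _below_ : Fin s → Fin 10 → Bool
  r below q = does (flat (atom r) SP.⊆? coreSet q)

  Σv-above-atom : ∀ f r → Σv f (above (atom r)) ≡ Σv (λ q → if r below q then f (core q) else 0ℚ) (allFin 10) +ℚ f (atom r)
  Σv-above-atom f r = begin
    Σv f (above (atom r))
      ≡⟨ Σv-filter (λ i → flat (atom r) SP.⊆? flat i) f (allFin (10 + s)) ⟩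
    Σv g (map core (allFin 10) ++ L.tabulate atom)
      ≡⟨ Σv-++ g (map core (allFin 10)) (L.tabulate atom) ⟩
    Σv g (map core (allFin 10)) +ℚ Σv g (L.tabulate atom)
      ≡⟨ cong (Σv g (map core (allFin 10)) +ℚ_) (Σv-single atom g r (λ r′ r′≢r →
           cong (λ b → if b then f (atom r′) else 0ℚ) (dec-false (flat (atom r) SP.⊆? flat (atom r′))
             (λ ⊆ → r′≢r (sym (FP.↑ʳ-injective 10 r r′ (flat⊆atom (atom r) r′ ⊆))))))) ⟩
    Σv g (map core (allFin 10)) +ℚ g (atom r)
      ≡⟨ cong (λ b → Σv g (map core (allFin 10)) +ℚ (if b then f (atom r) else 0ℚ))
           (dec-true (flat (atom r) SP.⊆? flat (atom r)) (λ e → e)) ⟩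
    Σv (λ q → if r below q then f (core q) else 0ℚ) (allFin 10) +ℚ f (atom r) ∎
    where
    open ≡-Reasoning
    g : Index → ℚ
    g i = if does (flat (atom r) SP.⊆? flat i) then f i else 0ℚ

  -- The value at an atom is forced by the linear relation of that atom.
  extend : Point → Index → ℚ
  extend u i = [ coord u , (λ r → - Σv (λ q → if r below q then coord u q else 0ℚ) (allFin 10)) ]′ (F.splitAt 10 i)

  extend-core : ∀ u q → extend u (core q) ≡ coord u q
  extend-core u q rewrite FP.splitAt-↑ˡ 10 q s = refl

  extend-atom : ∀ u r → extend u (atom r) ≡ - Σv (λ q → if r below q then coord u q else 0ℚ) (allFin 10)
  extend-atom u r rewrite FP.splitAt-↑ʳ 10 s r = refl

  Σ-extend-atom : ∀ u r → Σv (extend u) (above (atom r)) ≡ 0ℚ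
  Σ-extend-atom u r = begin
    Σv (extend u) (above (atom r))     ≡⟨ Σv-above-atom (extend u) r ⟩
    Σv (λ q → if r below q then extend u (core q) else 0ℚ) (allFin 10) +ℚ extend u (atom r)
      ≡⟨ cong₂ _+ℚ_ (Σv-cong (λ q → cong (if r below q then_else 0ℚ) (extend-core u q)) (allFin 10)) (extend-atom u r) ⟩
    Σv (λ q → if r below q then coord u q else 0ℚ) (allFin 10)
      +ℚ - Σv (λ q → if r below q then coord u q else 0ℚ) (allFin 10)
      ≡⟨ ℚP.+-inverseʳ (Σv (λ q → if r below q then coord u q else 0ℚ) (allFin 10)) ⟩
    0ℚ ∎
    where open ≡-Reasoning

  elements : Subset (10 + s) → List Index
  elements S = filter (λ i → i SP.∈? S) (allFin (10 + s))

  strictlyBelow : Subset (10 + s) → Index → List Index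
  strictlyBelow S j = filter (λ i → flat i ⊂? flat j) (elements S)

  exponent : Subset (10 + s) → Index → ℕ
  exponent S j = rk (flat j) ∸ rk (⋁ M (map flat (strictlyBelow S j)))

  gen : Subset (10 + s) × Index → Poly (10 + s)
  gen = ChowGen M building

  gen-homogeneous : ∀ S j → Homogeneous (length (elements S) + exponent S j) (gen (S , j))
  gen-homogeneous S j = Homogeneous-* (mono (elements S)) (h j ^P exponent S j)
    (Homogeneous-mono (elements S)) (Homogeneous-^ (h j) (exponent S j) (Homogeneous-linear (above j)))

  ev-gen : ∀ v S j → ev v (gen (S , j)) ≡ Πv v (elements S) *ℚ pow (Σv v (above j)) (exponent S j)
  ev-gen v S j = trans (ev-* v (mono (elements S)) (h j ^P exponent S j))
    (cong₂ _*ℚ_ (ev-mono v (elements S)) (trans (ev-^ v (h j) (exponent S j))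
      (cong (λ x → pow x (exponent S j)) (ev-linear v (above j)))))

  -- The linear form being zero at `v` is not enough, since its exponent could be 0. The set `Y`
  -- bounds the join of the members below `j` at which `v` is nonzero, and its smaller rank makes
  -- the exponent positive.
  Vanishes : (Index → ℚ) → Index → Set
  Vanishes v j = Σv v (above j) ≡ 0ℚ × ∃ λ Y → rk Y < rk (flat j) ×
    (∀ i → v i ≢ 0ℚ → flat i ⊆ flat j → ¬ flat j ⊆ flat i → flat i ⊆ Y)

  HighDegree : (Index → ℚ) → Index → Set
  HighDegree v j = 4 ≤ rk (flat j) × ∃ λ Y → 3 + rk Y ≤ rk (flat j) ×
    (∀ i → v i ≢ 0ℚ → flat i ⊆ flat j → ¬ flat j ⊆ flat i → flat i ⊆ Y ⊎ rk (flat i) ≤ 1)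

  -- If S has a member at which `v` is zero, the monomial factor already vanishes. So only sets S
  -- supported where `v` is nonzero matter, and for these the two conditions apply.
  gen-low : ∀ v S j → Vanishes v j ⊎ HighDegree v j →
            4 ≤ length (elements S) + exponent S j ⊎ ev v (gen (S , j)) ≡ 0ℚ
  gen-low v S j cond with any? (λ i → v i ℚP.≟ 0ℚ) (elements S)
  ... | yes some with find some
  ...   | i , i∈S , z = inj₂ (trans (ev-gen v S j)
          (trans (cong (_*ℚ pow (Σv v (above j)) (exponent S j)) (Πv-zero {v = v} i∈S z)) (ℚP.*-zeroˡ (pow (Σv v (above j)) (exponent S j)))))
  gen-low v S j cond | no none = go cond
    where
    nonzero : All (λ i → v i ≢ 0ℚ) (elements S)
    nonzero = AllP.¬Any⇒All¬ (elements S) none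
    belows : ∀ {Q : Pred (Subset n) 0ℓ} → (∀ i → v i ≢ 0ℚ → flat i ⊆ flat j → ¬ flat j ⊆ flat i → Q (flat i)) →
             All Q (map flat (strictlyBelow S j))
    belows f = AllP.map⁺ (All.zipWith (λ {i} ((sub , nsub) , nz) → f i nz sub nsub)
      (AllP.all-filter (λ i → flat i ⊂? flat j) (elements S) , AllP.filter⁺ (λ i → flat i ⊂? flat j) nonzero))
    go : Vanishes v j ⊎ HighDegree v j → 4 ≤ length (elements S) + exponent S j ⊎ ev v (gen (S , j)) ≡ 0ℚ
    go (inj₁ (z , Y , Y< , f)) = inj₂ (trans (ev-gen v S j)
      (trans (cong (Πv v (elements S) *ℚ_) (pow-zero {r = exponent S j} z
        (ℕP.m<n⇒0<n∸m (ℕP.≤-<-trans (ℕP.≤-trans (rk-cl _) (rk-⋃⊆ {Y} (belows f))) Y<))))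
        (ℚP.*-zeroʳ (Πv v (elements S)))))
    go (inj₂ (4≤ , Y , gap , f)) = inj₁ (ℕP.≤-trans
      (4≤degree Y (map flat (strictlyBelow S j)) (belows f) 4≤ gap)
      (ℕP.+-monoˡ-≤ (exponent S j) (ℕP.≤-trans
        (ℕP.≤-reflexive (LP.length-map flat (strictlyBelow S j)))
        (LP.length-filter (λ i → flat i ⊂? flat j) (elements S)))))

  coreBelow : ∀ b (v : Index → ℚ) i → flat i ⊆ flat (core b) → ¬ flat (core b) ⊆ flat i → v i ≢ 0ℚ →
              (∃ λ q → i ≡ core q × q ◁ b × v (core q) ≢ 0ℚ) ⊎ (∃ λ r → i ≡ atom r)
  coreBelow b v i sub nsub nz with kind i
  ... | isAtom r = inj₂ (r , refl)
  ... | isCore q with core-⊆ q b (subst₂ _⊆_ (flat-core q) (flat-core b) sub)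
  ...   | inj₁ refl = ⊥-elim (nsub (λ e → e))
  ...   | inj₂ lt   = inj₁ (q , refl , lt , nz)

  highDegree : ∀ u b Y → 3 + rk Y ≤ rk (coreSet b) →
               (∀ q → q ◁ b → extend u (core q) ≢ 0ℚ → coreSet q ⊆ Y) → HighDegree (extend u) (core b)
  highDegree u b Y gap f = subst (4 ≤_) eq (4≤rk-core b) , Y , subst (3 + rk Y ≤_) eq gap , bound
    where
    eq = sym (cong rk (flat-core b))
    bound : ∀ i → extend u i ≢ 0ℚ → flat i ⊆ flat (core b) → ¬ flat (core b) ⊆ flat i → flat i ⊆ Y ⊎ rk (flat i) ≤ 1
    bound i nz sub nsub with coreBelow b (extend u) i sub nsub nz
    ... | inj₁ (q , refl , lt , nz′) = inj₁ (subst (_⊆ Y) (sym (flat-core q)) (f q lt nz′))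
    ... | inj₂ (r , refl)            = inj₂ (ℕP.≤-reflexive (rk-atom r))

  -- On axis `a` the only nonzero core coordinate is that of `P a`, so the forced value at an atom
  -- is zero unless the atom lies in `P a`.
  atom⊆P : ∀ a r → extend (axis a) (atom r) ≢ 0ℚ → flat (atom r) ⊆ P a
  atom⊆P a r nz with flat (atom r) SP.⊆? P a
  ... | yes sub = sub
  ... | no ¬sub = ⊥-elim (nz (trans (extend-atom (axis a) r)
                    (cong -_ (Σv-zero (λ q → q) (λ q → if r below q then coord (axis a) q else 0ℚ) term))))
    where
    if-0 : ∀ b → (if b then 0ℚ else 0ℚ) ≡ 0ℚ
    if-0 true  = refl
    if-0 false = refl
    term : ∀ q → (if r below q then coord (axis a) q else 0ℚ) ≡ 0ℚ
    term 0F = if-0 (r below 0F)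
    term 1F = if-0 (r below 1F)
    term 2F = if-0 (r below 2F)
    term q@(suc (suc (suc b))) with a F.≟ b
    ... | yes refl = cong (λ c → if c then 1ℚ else 0ℚ) (dec-false (flat (atom r) SP.⊆? P a) ¬sub)
    ... | no _     = if-0 (r below q)

  -- Only the generators at `T` distinguish the two kinds of points. On the chain the hyperplane
  -- coordinates are zero, so the core sets that matter below `T` lie in `H` and the degree is at
  -- least 4. On axis `a` the coordinate of `T` is zero, hence so is the linear form of `T`, and
  -- everything that matters below `T` lies in `P a`, which has smaller rank than `T`. The linear
  -- forms of atoms vanish by the choice of `extend`.
  generator-condition : ∀ u j → Vanishes (extend u) j ⊎ HighDegree (extend u) j
  generator-condition u j with kind j
  ... | isAtom r = inj₁ (Σ-extend-atom u r , Sub.⊥ ,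
        ℕP.≤-reflexive (trans (cong suc rk-⊥) (sym (rk-atom r))) ,
        λ i _ sub nsub → ⊥-elim (nsub (SP.⊆-reflexive (cong flat (sym (flat⊆atom i r sub))))))
  ... | isCore 1F = inj₂ (highDegree u 1F G rkG≪rkH λ { _ G◁H _ → λ e → e })
  ... | isCore 2F = inj₂ (highDegree u 2F Sub.⊥
        (ℕP.≤-trans (ℕP.≤-reflexive (cong (3 +_) rk-⊥)) (ℕP.≤-trans (ℕP.n≤1+n 3) 4≤rkG)) λ _ ())
  ... | isCore (suc (suc (suc b))) = inj₂ (highDegree u (suc (suc (suc b))) Sub.⊥
        (ℕP.≤-trans (ℕP.≤-reflexive (cong (3 +_) rk-⊥))
          (ℕP.≤-trans (ℕP.n≤1+n 3) (4≤rk-core (suc (suc (suc b)))))) λ _ ())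
  generator-condition u@(chain _ _ _) j | isCore 0F = inj₂ (highDegree u 0F H rkH≪rkT contained)
    where
    contained : ∀ q → q ◁ 0F → extend u (core q) ≢ 0ℚ → coreSet q ⊆ H
    contained _ H◁T     _  = λ e → e
    contained _ G◁T     _  = G⊆H
    contained q (P◁T a) nz = ⊥-elim (nz (extend-core u q))
  generator-condition u@(axis a) j | isCore 0F =
    inj₁ (trans (Σv-above-T (extend u)) (extend-core u 0F) , P a , rkP<rkT a , contained)
    where
    contained : ∀ i → extend u i ≢ 0ℚ → flat i ⊆ T → ¬ T ⊆ flat i → flat i ⊆ P a
    contained i nz sub nsub with coreBelow 0F (extend u) i sub nsub nz
    ... | inj₂ (r , refl) = atom⊆P a r nz
    ... | inj₁ (_ , refl , H◁T , nz′) = ⊥-elim (nz′ (extend-core u 1F))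
    ... | inj₁ (_ , refl , G◁T , nz′) = ⊥-elim (nz′ (extend-core u 2F))
    ... | inj₁ (q , refl , P◁T b , nz′) with a F.≟ b | extend-core u q
    ...   | yes refl | _ = SP.⊆-reflexive (flat-core q)
    ...   | no  _    | z = ⊥-elim (nz′ z)

  annihilates : ∀ {d} → d ≤ 3 → ∀ u → Annihilates gen (Ev d (extend u))
  annihilates {d} d≤3 u (S , j) = ⟪Ev⟫≡0 d (extend u) (gen (S , j)) (gen-homogeneous S j)
    ([ inj₁ ∘ ℕP.≤-trans (s≤s d≤3) , inj₂ ]′ (gen-low (extend u) S j (generator-condition u j)))

  module Gr = Graded gen core

  h-T : h (core 0F) ≃ var (core 0F)
  h-T .at φ = trans (⟪linear⟫ (above (core 0F)) φ) (trans (Σv-above-T (φ ∘ unit)) (sym (⟪var⟫ (core 0F) φ)))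

  product-Ideal : ∀ S j l → elements S ↭ l → Ideal gen (mono l *P (h j ^P exponent S j))
  product-Ideal S j l e = Ideal-resp gen
    (*P-cong (mono l) (mono (elements S)) _ _ (mk≃ λ φ → sym (mono-↭ e .at φ)) (mk≃ λ _ → refl))
    (Ideal-gen gen (S , j))

  rk≤rk-strictlyBelow : ∀ S j X → X ⊆ ⋃ (map flat (strictlyBelow S j)) → rk X ≤ rk (⋁ M (map flat (strictlyBelow S j)))
  rk≤rk-strictlyBelow S j X sub = rk-mono (λ e → ⊆cl _ (sub e))

  flat⊆strictlyBelow : ∀ {S j i} → i ∈ S → flat i ⊆ flat j → ¬ flat j ⊆ flat i → flat i ⊆ ⋃ (map flat (strictlyBelow S j))
  flat⊆strictlyBelow {S} {j} {i} i∈S sub nsub e = ∈⋃⁺ (MP.∈-map⁺ flat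
    (MP.∈-filter⁺ (λ i → flat i ⊂? flat j) (MP.∈-filter⁺ (λ i → i SP.∈? S) (MP.∈-allFin i) i∈S) (sub , nsub))) e

  -- This is the generator for empty S: an atom has rank 1 and the empty join rank 0, so the
  -- exponent is 1.
  atom-relation : ∀ r → Ideal gen (h (atom r))
  atom-relation r = Ideal-resp gen (mk≃ λ φ → sym (begin
    ⟪ 1P *P (h j *P 1P) , φ ⟫   ≡⟨ *P-comm 1P (h j *P 1P) .at φ ⟩
    ⟪ (h j *P 1P) *P 1P , φ ⟫   ≡⟨ *P-1P (h j *P 1P) .at φ ⟩
    ⟪ h j *P 1P , φ ⟫           ≡⟨ *P-1P (h j) .at φ ⟩
    ⟪ h j , φ ⟫                 ∎))
    (subst (Ideal gen) eq (Ideal-gen gen (Sub.⊥ , j)))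
    where
    open ≡-Reasoning
    j = atom r
    none : elements Sub.⊥ ≡ []
    none = LP.filter-none (λ i → i SP.∈? Sub.⊥) (All.universal (λ _ → SP.∉⊥) (allFin (10 + s)))
    eq : gen (Sub.⊥ , j) ≡ 1P *P (h j ^P 1)
    eq = trans
      (cong (λ l → mono l *P (h j ^P (rk (flat j) ∸ rk (⋁ M (map flat (filter (λ i → flat i ⊂? flat j) l)))))) none)
      (cong (λ e → 1P *P (h j ^P e)) (cong₂ _∸_ (rk-atom r)
        (ℕP.n≤0⇒n≡0 (ℕP.≤-trans (rk-cl Sub.⊥) (ℕP.≤-reflexive rk-⊥)))))

  linear-core : ∀ q → Spanned gen (Gr.basis 1) (var (core q))
  linear-core q = Spanned-resp gen (Gr.basis 1) (mono-singleton (core q))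
    (subst (Spanned gen (Gr.basis 1)) (Gr.basis₁ q) (Spanned-lookup gen (Gr.basis 1) q))

  linear : ∀ i → Spanned gen (Gr.basis 1) (var i)
  linear i with kind i
  ... | isCore q = linear-core q
  ... | isAtom r = Spanned-resp gen (Gr.basis 1) (mk≃ λ φ → begin
      ⟪ var (atom r) , φ ⟫
        ≡⟨ ⟪var⟫ (atom r) φ ⟩
      φ (unit (atom r))
        ≡⟨ solve 2 (λ x y → x := (y :+ x) :+ con -1ℚ :* y) refl
             (φ (unit (atom r))) (Σv (λ q → if r below q then φ (unit (core q)) else 0ℚ) (allFin 10)) ⟩
      (Σv (λ q → if r below q then φ (unit (core q)) else 0ℚ) (allFin 10) +ℚ φ (unit (atom r)))
        +ℚ -1ℚ *ℚ Σv (λ q → if r below q then φ (unit (core q)) else 0ℚ) (allFin 10)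
        ≡⟨ cong₂ _+ℚ_ (sym (trans (⟪linear⟫ (above (atom r)) φ) (Σv-above-atom (φ ∘ unit) r)))
                     (sym (trans (⟪·P⟫ -1ℚ (cores (allFin 10)) φ) (cong (-1ℚ *ℚ_) (⟪cores⟫ (allFin 10) φ)))) ⟩
      ⟪ h (atom r) , φ ⟫ +ℚ ⟪ -1ℚ ·P cores (allFin 10) , φ ⟫
        ≡⟨ sym (⟪⟫-++ (h (atom r)) _ φ) ⟩
      ⟪ h (atom r) ++ (-1ℚ ·P cores (allFin 10)) , φ ⟫ ∎)
    (Spanned-++ gen (Gr.basis 1) (Ideal⇒Spanned gen (Gr.basis 1) (atom-relation r))
      (Spanned-·P gen (Gr.basis 1) -1ℚ (spanned-cores (allFin 10))))
    where
    open ≡-Reasoning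
    cores : List (Fin 10) → Poly (10 + s)
    cores l = ΣP (map (λ q → if r below q then var (core q) else 0P) l)
    ⟪cores⟫ : ∀ l φ → ⟪ cores l , φ ⟫ ≡ Σv (λ q → if r below q then φ (unit (core q)) else 0ℚ) l
    ⟪cores⟫ []      φ = refl
    ⟪cores⟫ (q ∷ l) φ with r below q
    ... | true  = trans (⟪⟫-++ (var (core q)) (cores l) φ) (cong₂ _+ℚ_ (⟪var⟫ (core q) φ) (⟪cores⟫ l φ))
    ... | false = trans (⟪cores⟫ l φ) (sym (ℚP.+-identityˡ _))
    spanned-cores : ∀ l → Spanned gen (Gr.basis 1) (cores l)
    spanned-cores []      = Ideal⇒Spanned gen (Gr.basis 1) (Ideal-0 gen)
    spanned-cores (q ∷ l) with r below q
    ... | true  = Spanned-++ gen (Gr.basis 1) (linear-core q) (spanned-cores l)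
    ... | false = spanned-cores l

  -- For `T` take S = {P a}: one power of x_T remains, because `P a` has corank 1 in `T` and no
  -- other member contains `T`. For any other core set take both variables into S: their join has
  -- the rank of `T`, and nothing remains of the second factor.
  P-product : ∀ a b → suc (suc (suc a)) ≢ b → Ideal gen (var (core (suc (suc (suc a)))) *P var (core b))
  P-product a 0F _ = finish (exponent S (core 0F)) e≤1 (product-Ideal S (core 0F) (p ∷ []) els)
    where
    p = core (suc (suc (suc a)))
    S = ⁅ p ⁆
    els : elements S ↭ p ∷ []
    els = elements-↭ S (p ∷ []) ([] ∷ []) (λ i∈ → here (SP.x∈⁅y⁆⇒x≡y p i∈)) λ { (here refl) → SP.x∈⁅x⁆ p }
    e≤1 : exponent S (core 0F) ≤ 1
    e≤1 = ℕP.≤-trans (ℕP.∸-monoʳ-≤ (rk T) (rk≤rk-strictlyBelow S (core 0F) (P a)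
        (subst (_⊆ ⋃ (map flat (strictlyBelow S (core 0F)))) (flat-core (suc (suc (suc a))))
          (flat⊆strictlyBelow {S} {core 0F} {p} (SP.x∈⁅x⁆ p)
            (subst (_⊆ T) (sym (flat-core (suc (suc (suc a))))) (P⊆T a))
            (λ T⊆ → ⊈-rk (rkP<rkT a) (subst (T ⊆_) (flat-core (suc (suc (suc a)))) T⊆))))))
      (ℕP.≤-reflexive (trans (cong (_∸ rk (P a)) (rkT a)) (ℕP.m+n∸n≡m 1 (rk (P a)))))
    -- Only `e ≤ 1` has been established. For `e` equal to 0 the variable of `P a` itself would lie
    -- in the ideal, and the product with it.
    finish : ∀ e → e ≤ 1 → Ideal gen (mono (p ∷ []) *P (h (core 0F) ^P e)) → Ideal gen (var p *P var (core 0F))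
    finish 0 _ m = Ideal-resp gen (*P-comm (var p) (var (core 0F))) (Ideal-* gen (var (core 0F))
      (Ideal-resp gen (mk≃ λ φ → trans (mono-singleton p .at φ) (sym (*P-1P (mono (p ∷ [])) .at φ))) m))
    finish 1 _ m = Ideal-resp gen (*P-cong (var p) (mono (p ∷ [])) _ _ (mono-singleton p)
      (mk≃ λ φ → trans (sym (h-T .at φ)) (sym (*P-1P (h (core 0F)) .at φ)))) m
    finish (suc (suc _)) (s≤s ()) _
  P-product a b@(suc b′) p≢b = Ideal-resp gen
      (mk≃ λ φ → trans (*P-congʳ (var p) _ _ (mono-singleton q) .at φ) (sym (*P-1P (mono (p ∷ q ∷ [])) .at φ)))
      (subst (λ e → Ideal gen (mono (p ∷ q ∷ []) *P (h (core 0F) ^P e))) e≡0 (product-Ideal S (core 0F) (p ∷ q ∷ []) els))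
    where
    p′ = suc (suc (suc a))
    p = core p′
    q = core b
    S = ⁅ p ⁆ ∪ ⁅ q ⁆
    els : elements S ↭ p ∷ q ∷ []
    els = elements-↭ S (p ∷ q ∷ []) (((λ p≡q → p≢b (FP.↑ˡ-injective s _ _ p≡q)) ∷ []) ∷ [] ∷ [])
      (λ i∈ → [ (λ x → here (SP.x∈⁅y⁆⇒x≡y p x)) , (λ x → there (here (SP.x∈⁅y⁆⇒x≡y q x))) ]′ (SP.x∈p∪q⁻ ⁅ p ⁆ ⁅ q ⁆ i∈))
      λ { (here refl) → SP.p⊆p∪q ⁅ q ⁆ (SP.x∈⁅x⁆ p) ; (there (here refl)) → SP.q⊆p∪q ⁅ p ⁆ ⁅ q ⁆ (SP.x∈⁅x⁆ q) }
    joins : ∀ b → p′ ≢ b → 0F ≢ b → coreSet b ⊆ T × rk (coreSet b) < rk T × rk T ≤ rk (P a ∪ coreSet b)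
    joins 0F _ 0≢0 = ⊥-elim (0≢0 refl)
    joins 1F _ _ = H⊆T , rkH<rkT , ℕP.≤-trans (P∨G a) (rk-mono (∪-mono {A = P a} (λ e → e) G⊆H))
    joins 2F _ _ = (λ e → H⊆T (G⊆H e)) , ℕP.<-trans rkG<rkH rkH<rkT , P∨G a
    joins (suc (suc (suc c))) p≢c _ = P⊆T c , rkP<rkT c , P∨P (λ a≡c → p≢c (cong (λ x → suc (suc (suc x))) a≡c))
    member : ∀ c → core c ∈ S → coreSet c ⊆ T → rk (coreSet c) < rk T →
             coreSet c ⊆ ⋃ (map flat (strictlyBelow S (core 0F)))
    member c c∈S c⊆T lt = subst (_⊆ ⋃ (map flat (strictlyBelow S (core 0F)))) (flat-core c)
      (flat⊆strictlyBelow {S} {core 0F} {core c} c∈S (subst (_⊆ T) (sym (flat-core c)) c⊆T)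
        (λ T⊆ → ⊈-rk lt (subst (T ⊆_) (flat-core c) T⊆)))
    e≡0 : exponent S (core 0F) ≡ 0
    e≡0 with joins b p≢b (λ ())
    ... | b⊆T , lt , spans = ℕP.m≤n⇒m∸n≡0 (ℕP.≤-trans spans (rk≤rk-strictlyBelow S (core 0F) (P a ∪ coreSet b)
      (∪-lub (member p′ (SP.p⊆p∪q ⁅ q ⁆ (SP.x∈⁅x⁆ p)) (P⊆T a) (rkP<rkT a))
             (member b (SP.q⊆p∪q ⁅ p ⁆ ⁅ q ⁆ (SP.x∈⁅x⁆ q)) b⊆T lt))))

  isolated : ∀ {q b} → Isolated q b → Ideal gen (var (core q) *P var (core b))
  isolated {suc (suc (suc a))} {b} (q≢b , inj₁ _) = P-product a b q≢b
  isolated {q} {suc (suc (suc a))} (q≢b , inj₂ _) = Ideal-resp gen (*P-comm (var (core q)) (var (core (suc (suc (suc a)))))) (P-product a q (q≢b ∘ sym))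
  isolated {0F} (_ , inj₁ ())
  isolated {1F} (_ , inj₁ (s≤s ()))
  isolated {2F} (_ , inj₁ (s≤s (s≤s ())))
  isolated {b = 0F} (_ , inj₂ ())
  isolated {b = 1F} (_ , inj₂ (s≤s ()))
  isolated {b = 2F} (_ , inj₂ (s≤s (s≤s ())))

  chow-notLogConcave : ChowNotLogConcave M building
  chow-notLogConcave = Gr.notLogConcave linear isolated extend extend-core annihilates

-- Building sets of Boolean matroids

∣∪∣-disjoint : ∀ (A B : Subset n) → (∀ {e} → e ∈ A → e ∉ B) → ∣ A ∪ B ∣ ≡ ∣ A ∣ + ∣ B ∣
∣∪∣-disjoint [] [] _ = refl
∣∪∣-disjoint (outside ∷ A) (outside ∷ B) d = ∣∪∣-disjoint A B (λ a b → d (V.there a) (V.there b))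
∣∪∣-disjoint (outside ∷ A) (inside ∷ B) d =
  trans (cong suc (∣∪∣-disjoint A B (λ a b → d (V.there a) (V.there b)))) (sym (ℕP.+-suc ∣ A ∣ ∣ B ∣))
∣∪∣-disjoint (inside ∷ A) (outside ∷ B) d = cong suc (∣∪∣-disjoint A B (λ a b → d (V.there a) (V.there b)))
∣∪∣-disjoint (inside ∷ A) (inside ∷ B) d = ⊥-elim (d V.here V.here)

∣⋃∣-disjoint : ∀ (l : List (Subset n)) → Unique l →
  (∀ {X Y e} → X ∈ˡ l → Y ∈ˡ l → e ∈ X → e ∈ Y → X ≡ Y) → ∣ ⋃ l ∣ ≡ sum (map ∣_∣ l)
∣⋃∣-disjoint {n} [] _ _ = SP.∣⊥∣≡0 n
∣⋃∣-disjoint (X ∷ l) (X≢ ∷ uniq) d = trans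
  (∣∪∣-disjoint X (⋃ l) λ e∈X e∈l → let Y , Y∈l , e∈Y = ∈⋃⁻ l e∈l in
    All.lookup X≢ Y∈l (d (here refl) (there Y∈l) e∈X e∈Y))
  (cong (∣ X ∣ +_) (∣⋃∣-disjoint l uniq λ X∈ Y∈ → d (there X∈) (there Y∈)))

U-flat : ∀ (F : Subset n) → IsFlat (U n) F
U-flat F e e∉F = SP.p⊂q⇒∣p∣<∣q∣ (SP.p⊆p∪q ⁅ e ⁆ , e , SP.q⊆p∪q F ⁅ e ⁆ (SP.x∈⁅x⁆ e) , e∉F)

U-cl : ∀ (A : Subset n) → cl (U n) A ≡ A
U-cl {n} A = SP.⊆-antisym back (R.⊆cl A)
  where
  module R = Rank (U n)
  back : cl (U n) A ⊆ A
  back {e} e∈cl with e SP.∈? A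
  ... | yes e∈A = e∈A
  ... | no e∉A  = ⊥-elim (ℕP.<⇒≱ (U-flat A e e∉A) (R.∈cl⁻ {A} e∈cl))

-- The classical criterion in a Boolean lattice. Intersecting members have their union in the
-- family, so the maximal members below `F` are disjoint; the singletons make them cover `F`. Since
-- joins are unions, the interval below `F` is the product over this partition, with inverse
-- `H ↦ (H ∩ Gi i)`, and cardinalities add up.
module BooleanBuilding (𝒢 : List (Subset n)) (unique : Unique 𝒢) (atoms : ∀ e → ⁅ e ⁆ ∈ˡ 𝒢)
  (nonempty : ∀ {X} → X ∈ˡ 𝒢 → X ≢ Sub.⊥)
  (unions : ∀ {X Y e} → X ∈ˡ 𝒢 → Y ∈ˡ 𝒢 → e ∈ X → e ∈ Y → X ∪ Y ∈ˡ 𝒢) where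

  module _ (F : Subset n) where
    ms : List (Subset n)
    ms = maxBelow (U n) 𝒢 F

    ms-dec : Decidable (λ G → G ⊆ F × ¬ Any.Any (λ G′ → G′ ⊆ F × (G ⊆ G′ × ¬ G′ ⊆ G)) 𝒢)
    ms-dec G = (G SP.⊆? F) ×-dec ¬? (any? (λ G′ → (G′ SP.⊆? F) ×-dec (G ⊂? G′)) 𝒢)

    ms-unique : Unique ms
    ms-unique = UP.filter⁺ ms-dec unique

    ms-maximal : ∀ {G G′} → G ∈ˡ ms → G′ ∈ˡ 𝒢 → G′ ⊆ F → G ⊆ G′ → G′ ⊆ G
    ms-maximal {G} {G′} G∈ G′∈ G′⊆F G⊆G′ with G′ SP.⊆? G
    ... | yes G′⊆G = G′⊆G
    ... | no G′⊈G  = ⊥-elim (proj₂ (proj₂ (MP.∈-filter⁻ ms-dec {xs = 𝒢} G∈))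
      (Any.map (λ { refl → (λ {_} → G′⊆F) , (λ {_} → G⊆G′) , G′⊈G }) G′∈))

    ms⊆𝒢 : ∀ {G} → G ∈ˡ ms → G ∈ˡ 𝒢
    ms⊆𝒢 = proj₁ ∘ MP.∈-filter⁻ ms-dec

    ms⊆F : ∀ {G} → G ∈ˡ ms → G ⊆ F
    ms⊆F G∈ = proj₁ (proj₂ (MP.∈-filter⁻ ms-dec {xs = 𝒢} G∈))

    ms-disjoint : ∀ {X Y e} → X ∈ˡ ms → Y ∈ˡ ms → e ∈ X → e ∈ Y → X ≡ Y
    ms-disjoint {X} {Y} X∈ Y∈ e∈X e∈Y = SP.⊆-antisym
      (λ x → ms-maximal Y∈ X∪Y∈ X∪Y⊆F (SP.q⊆p∪q X Y) (SP.p⊆p∪q Y x))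
      (λ y → ms-maximal X∈ X∪Y∈ X∪Y⊆F (SP.p⊆p∪q Y) (SP.q⊆p∪q X Y y))
      where
      X∪Y∈ : X ∪ Y ∈ˡ 𝒢
      X∪Y∈ = unions (ms⊆𝒢 X∈) (ms⊆𝒢 Y∈) e∈X e∈Y
      X∪Y⊆F : X ∪ Y ⊆ F
      X∪Y⊆F = ∪-lub (ms⊆F X∈) (ms⊆F Y∈)

    -- The maximal member containing e is the union of all members between e and F.
    ms-cover : ∀ {e} → e ∈ F → ∃ λ G → G ∈ˡ ms × e ∈ G
    ms-cover {e} e∈F = W , MP.∈-filter⁺ ms-dec (W∈ candidates all-candidates)
        (∪-lub (⁅⁆⊆ e∈F) (λ x → let X , X∈ , x∈X = ∈⋃⁻ candidates x in proj₂ (proj₂ (candidate⁻ X∈)) x∈X) , maximal)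
      , e∈W
      where
      candidate? : Decidable (λ X → e ∈ X × X ⊆ F)
      candidate? X = (e SP.∈? X) ×-dec (X SP.⊆? F)
      candidates : List (Subset n)
      candidates = filter candidate? 𝒢
      W : Subset n
      W = ⁅ e ⁆ ∪ ⋃ candidates
      candidate⁻ : ∀ {X} → X ∈ˡ candidates → X ∈ˡ 𝒢 × e ∈ X × X ⊆ F
      candidate⁻ = MP.∈-filter⁻ candidate?
      all-candidates : All (λ X → X ∈ˡ 𝒢 × e ∈ X) candidates
      all-candidates = All.tabulate (λ X∈ → let X∈𝒢 , e∈X , _ = candidate⁻ X∈ in X∈𝒢 , e∈X)
      e∈W : e ∈ W
      e∈W = SP.p⊆p∪q (⋃ candidates) (SP.x∈⁅x⁆ e)
      W∈ : ∀ l → All (λ X → X ∈ˡ 𝒢 × e ∈ X) l → ⁅ e ⁆ ∪ ⋃ l ∈ˡ 𝒢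
      W∈ [] [] = subst (_∈ˡ 𝒢) (sym (SP.∪-identityʳ ⁅ e ⁆)) (atoms e)
      W∈ (X ∷ l) ((X∈ , e∈X) ∷ h) = subst (_∈ˡ 𝒢) reorder
        (unions X∈ (W∈ l h) e∈X (SP.p⊆p∪q (⋃ l) (SP.x∈⁅x⁆ e)))
        where
        reorder : X ∪ (⁅ e ⁆ ∪ ⋃ l) ≡ ⁅ e ⁆ ∪ (X ∪ ⋃ l)
        reorder = trans (sym (SP.∪-assoc X ⁅ e ⁆ (⋃ l)))
          (trans (cong (_∪ ⋃ l) (SP.∪-comm X ⁅ e ⁆)) (SP.∪-assoc ⁅ e ⁆ X (⋃ l)))
      maximal : ¬ Any.Any (λ G′ → G′ ⊆ F × (W ⊆ G′ × ¬ G′ ⊆ W)) 𝒢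
      maximal some with find some
      ... | G′ , G′∈ , G′⊆F , W⊆G′ , G′⊈W = G′⊈W (λ x → SP.q⊆p∪q ⁅ e ⁆ (⋃ candidates)
        (∈⋃⁺ (MP.∈-filter⁺ candidate? G′∈ (W⊆G′ e∈W , λ {_} → G′⊆F)) x))

    m : ℕ
    m = length ms

    Gi : Fin m → Subset n
    Gi = L.lookup ms

    Gi-disjoint : ∀ {i j e} → e ∈ Gi i → e ∈ Gi j → i ≡ j
    Gi-disjoint {i} {j} e∈i e∈j = lookup-injective ms-unique (ms-disjoint (MP.∈-lookup i) (MP.∈-lookup j) e∈i e∈j)

    Gi-cover : ∀ {e} → e ∈ F → ∃ λ i → e ∈ Gi i
    Gi-cover e∈F with ms-cover e∈F
    ... | G , G∈ , e∈G = Any.index G∈ , subst (_ ∈_) (AnyP.lookup-index G∈) e∈G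

    Φ : (Fin m → Subset n) → Subset n
    Φ t = ⋁ (U n) (map t (allFin m))

    ∈Φ⁺ : ∀ t i {e} → e ∈ t i → e ∈ Φ t
    ∈Φ⁺ t i e∈ = subst (_ ∈_) (sym (U-cl _)) (∈⋃⁺ (MP.∈-map⁺ t (MP.∈-allFin i)) e∈)

    ∈Φ⁻ : ∀ t {e} → e ∈ Φ t → ∃ λ i → e ∈ t i
    ∈Φ⁻ t {e} e∈ with ∈⋃⁻ (map t (allFin m)) (subst (e ∈_) (U-cl _) e∈)
    ... | X , X∈ , e∈X with MP.∈-map⁻ t X∈
    ...   | i , _ , refl = i , e∈X

    InProd : (Fin m → Subset n) → Set
    InProd t = ∀ i → IsFlat (U n) (t i) × t i ⊆ Gi i

    Φ-reflects-⊆ : ∀ {t t′} → InProd t → InProd t′ → Φ t ⊆ Φ t′ → ∀ i → t i ⊆ t′ i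
    Φ-reflects-⊆ {t} {t′} p p′ Φ⊆ i e∈ with ∈Φ⁻ t′ (Φ⊆ (∈Φ⁺ t i e∈))
    ... | j , e∈′ with Gi-disjoint {i} {j} (proj₂ (p i) e∈) (proj₂ (p′ j) e∈′)
    ...   | refl = e∈′

    condition : BuildingCondition (U n) 𝒢 F
    condition =
      (λ t t′ p p′ eq i → SP.⊆-antisym
        (Φ-reflects-⊆ {t} {t′} p p′ (SP.⊆-reflexive eq) i)
        (Φ-reflects-⊆ {t′} {t} p′ p (SP.⊆-reflexive (sym eq)) i)) ,
      (λ H _ H⊆F → (λ i → H ∩ Gi i) ,
        (λ i → U-flat (H ∩ Gi i) , SP.p∩q⊆q H (Gi i)) ,
        SP.⊆-antisym
          (λ e∈ → let i , e∈i = ∈Φ⁻ (λ i → H ∩ Gi i) e∈ in SP.p∩q⊆p H (Gi i) e∈i)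
          (λ e∈ → let i , e∈i = Gi-cover (H⊆F e∈) in ∈Φ⁺ (λ i → H ∩ Gi i) i (SP.x∈p∩q⁺ (e∈ , e∈i)))) ,
      (λ t t′ p p′ → SP.⊆-antisym
        (λ e∈ → let i , e∈i = ∈Φ⁻ (λ i → cl (U n) (t i ∪ t′ i)) e∈ in subst (_ ∈_) (sym (U-cl _))
          ([ SP.p⊆p∪q (Φ t′) ∘ ∈Φ⁺ t i , SP.q⊆p∪q (Φ t) (Φ t′) ∘ ∈Φ⁺ t′ i ]′
            (SP.x∈p∪q⁻ (t i) (t′ i) (subst (_ ∈_) (U-cl _) e∈i))))
        (λ e∈ → [ (λ e∈t → let i , e∈i = ∈Φ⁻ t e∈t in
                     ∈Φ⁺ (λ i → cl (U n) (t i ∪ t′ i)) i (subst (_ ∈_) (sym (U-cl _)) (SP.p⊆p∪q (t′ i) e∈i)))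
                , (λ e∈t → let i , e∈i = ∈Φ⁻ t′ e∈t in
                     ∈Φ⁺ (λ i → cl (U n) (t i ∪ t′ i)) i (subst (_ ∈_) (sym (U-cl _)) (SP.q⊆p∪q (t i) (t′ i) e∈i))) ]′
                (SP.x∈p∪q⁻ (Φ t) (Φ t′) (subst (_ ∈_) (U-cl _) e∈)))) ,
      (λ t t′ p p′ → SP.⊆-antisym
        (λ e∈ → let i , e∈i = ∈Φ⁻ (λ i → t i ∩ t′ i) e∈ in
          SP.x∈p∩q⁺ (∈Φ⁺ t i (SP.p∩q⊆p (t i) (t′ i) e∈i) , ∈Φ⁺ t′ i (SP.p∩q⊆q (t i) (t′ i) e∈i)))
        (meet t t′ p p′)) ,
      trans (cong ∣_∣ (SP.⊆-antisym
              (λ e∈ → let G , G∈ , e∈G = ms-cover e∈ in ∈⋃⁺ G∈ e∈G)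
              (λ e∈ → let G , G∈ , e∈G = ∈⋃⁻ ms e∈ in ms⊆F G∈ e∈G)))
            (∣⋃∣-disjoint ms ms-unique ms-disjoint)
      where
      meet : ∀ t t′ → InProd t → InProd t′ → Φ t ∩ Φ t′ ⊆ Φ (λ i → t i ∩ t′ i)
      meet t t′ p p′ e∈ with ∈Φ⁻ t (SP.p∩q⊆p (Φ t) (Φ t′) e∈) | ∈Φ⁻ t′ (SP.p∩q⊆q (Φ t) (Φ t′) e∈)
      ... | i , e∈i | j , e∈j with Gi-disjoint {i} {j} (proj₂ (p i) e∈i) (proj₂ (p′ j) e∈j)
      ...   | refl = ∈Φ⁺ (λ i → t i ∩ t′ i) i (SP.x∈p∩q⁺ (e∈i , e∈j))

  isBuildingSet : IsBuildingSet (U n) 𝒢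
  isBuildingSet = unique , (λ G G∈ → U-flat G , nonempty G∈) , λ F _ → condition F

module _ (C : Configuration (U n)) where
  open Configuration C
  open Chow C using (rkG<rkH; rkH<rkT; rkP<rkT; building-unique; 4≤rk-core)

  private
    atom∈ : ∀ e → ⁅ e ⁆ ∈ˡ building
    atom∈ e = MP.∈-++⁺ʳ (map coreSet (allFin 10)) (MP.∈-map⁺ ⁅_⁆ (MP.∈-allFin e))

    core∈ : ∀ q → coreSet q ∈ˡ building
    core∈ q = MP.∈-++⁺ˡ (MP.∈-map⁺ coreSet (MP.∈-allFin q))

    building⁻ : ∀ {X} → X ∈ˡ building → (∃ λ q → X ≡ coreSet q) ⊎ (∃ λ e → X ≡ ⁅ e ⁆)
    building⁻ X∈ with MP.∈-++⁻ (map coreSet (allFin 10)) X∈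
    ... | inj₁ X∈c = let q , _ , eq = MP.∈-map⁻ coreSet {xs = allFin 10} X∈c in inj₁ (q , eq)
    ... | inj₂ X∈a = let e , _ , eq = MP.∈-map⁻ ⁅_⁆ {xs = allFin n} X∈a in inj₂ (e , eq)

    core⊆T : ∀ q → coreSet q ⊆ T
    core⊆T 0F = λ e → e
    core⊆T 1F = H⊆T
    core⊆T 2F = λ e → H⊆T (G⊆H e)
    core⊆T (suc (suc (suc a))) = P⊆T a

    -- This makes the family closed under unions: incomparable core sets have a union inside `T` of
    -- the size of `T`, so the union is `T`, again a member.
    nested-or-spanning : ∀ q b → coreSet q ⊆ coreSet b ⊎ coreSet b ⊆ coreSet q ⊎ ∣ T ∣ ≤ ∣ coreSet q ∪ coreSet b ∣
    nested-or-spanning 0F b = inj₂ (inj₁ (core⊆T b))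
    nested-or-spanning q 0F = inj₁ (core⊆T q)
    nested-or-spanning 1F 1F = inj₁ λ e → e
    nested-or-spanning 1F 2F = inj₂ (inj₁ G⊆H)
    nested-or-spanning 2F 1F = inj₁ G⊆H
    nested-or-spanning 2F 2F = inj₁ λ e → e
    nested-or-spanning 1F (suc (suc (suc b))) = inj₂ (inj₂ (ℕP.≤-trans (P∨G b)
      (SP.p⊆q⇒∣p∣≤∣q∣ (∪-lub {A = P b} (SP.q⊆p∪q H (P b)) (λ e → SP.p⊆p∪q (P b) (G⊆H e))))))
    nested-or-spanning 2F (suc (suc (suc b))) = inj₂ (inj₂ (subst (λ X → ∣ T ∣ ≤ ∣ X ∣) (SP.∪-comm (P b) G) (P∨G b)))
    nested-or-spanning (suc (suc (suc a))) 1F = inj₂ (inj₂ (ℕP.≤-trans (P∨G a)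
      (SP.p⊆q⇒∣p∣≤∣q∣ (∪-mono {A = P a} (λ e → e) G⊆H))))
    nested-or-spanning (suc (suc (suc a))) 2F = inj₂ (inj₂ (P∨G a))
    nested-or-spanning (suc (suc (suc a))) (suc (suc (suc b))) with a F.≟ b
    ... | yes refl = inj₁ λ e → e
    ... | no a≢b   = inj₂ (inj₂ (P∨P a≢b))

    ⊆-∣∣-≡ : ∀ {A B : Subset n} → A ⊆ B → ∣ B ∣ ≤ ∣ A ∣ → A ≡ B
    ⊆-∣∣-≡ {A} {B} A⊆B ∣B∣≤∣A∣ = SP.⊆-antisym A⊆B B⊆A
      where
      B⊆A : B ⊆ A
      B⊆A {e} e∈B with e SP.∈? A
      ... | yes e∈A = e∈A
      ... | no e∉A  = ⊥-elim (ℕP.<⇒≱ (SP.p⊂q⇒∣p∣<∣q∣ (A⊆B , e , e∈B , e∉A)) ∣B∣≤∣A∣)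

    ∪-absorb : ∀ {A B : Subset n} → A ⊆ B → A ∪ B ≡ B
    ∪-absorb {A} {B} A⊆B = SP.⊆-antisym (∪-lub A⊆B (λ e → e)) (SP.q⊆p∪q A B)

    unions : ∀ {X Y e} → X ∈ˡ building → Y ∈ˡ building → e ∈ X → e ∈ Y → X ∪ Y ∈ˡ building
    unions {X} {Y} {e} X∈ Y∈ e∈X e∈Y with building⁻ X∈ | building⁻ Y∈
    ... | inj₂ (x , refl) | _ = subst (_∈ˡ building)
      (sym (∪-absorb (⁅⁆⊆ (subst (_∈ Y) (SP.x∈⁅y⁆⇒x≡y x e∈X) e∈Y)))) Y∈
    ... | inj₁ _ | inj₂ (y , refl) = subst (_∈ˡ building)
      (trans (sym (∪-absorb (⁅⁆⊆ (subst (_∈ X) (SP.x∈⁅y⁆⇒x≡y y e∈Y) e∈X)))) (SP.∪-comm ⁅ y ⁆ X)) X∈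
    ... | inj₁ (q , refl) | inj₁ (b , refl) with nested-or-spanning q b
    ...   | inj₁ q⊆b         = subst (_∈ˡ building) (sym (∪-absorb q⊆b)) Y∈
    ...   | inj₂ (inj₁ b⊆q)  = subst (_∈ˡ building) (trans (sym (∪-absorb b⊆q)) (SP.∪-comm (coreSet b) (coreSet q))) X∈
    ...   | inj₂ (inj₂ span) = subst (_∈ˡ building)
      (sym (⊆-∣∣-≡ (∪-lub (core⊆T q) (core⊆T b)) span)) (core∈ 0F)

    nonempty : ∀ {X} → X ∈ˡ building → X ≢ Sub.⊥
    nonempty X∈ X≡⊥ with building⁻ X∈
    ... | inj₁ (q , refl) = ℕP.<⇒≢ (ℕP.≤-trans (s≤s z≤n) (4≤rk-core q)) (sym (trans (cong ∣_∣ X≡⊥) (SP.∣⊥∣≡0 n)))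
    ... | inj₂ (e , refl) = SP.∉⊥ (subst (e ∈_) X≡⊥ (SP.x∈⁅x⁆ e))

  boolean-isBuildingSet : IsBuildingSet (U n) building
  boolean-isBuildingSet = BooleanBuilding.isBuildingSet building building-unique atom∈ nonempty unions

-- A configuration in every Boolean matroid of rank at least 13.

module _ (m : ℕ) where

  -- The core sets stay within the first 13 points and the remaining `m` points enter the building
  -- set only as singletons, so one finite check serves all ranks.
  pad : Subset 13 → Subset (13 + m)
  pad A = A V.++ Sub.⊥

  ∣pad∣ : ∀ A → ∣ pad A ∣ ≡ ∣ A ∣
  ∣pad∣ = go
    where
    go : ∀ {k} (A : Subset k) → ∣ A V.++ Sub.⊥ {m} ∣ ≡ ∣ A ∣
    go []            = SP.∣⊥∣≡0 m
    go (inside ∷ A)  = cong suc (go A)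
    go (outside ∷ A) = go A

  pad-∪ : ∀ A B → pad A ∪ pad B ≡ pad (A ∪ B)
  pad-∪ A B = trans (VP.zipWith-++ _ A Sub.⊥ B Sub.⊥) (cong ((A ∪ B) V.++_) (SP.∪-identityˡ Sub.⊥))

  pad-⊆ : ∀ {A B} → A ∪ B ≡ B → pad A ⊆ pad B
  pad-⊆ {A} {B} eq = subst (pad A ⊆_) (trans (pad-∪ A B) (cong pad eq)) (SP.p⊆p∪q (pad B))

  private
    -- Each `P₀ a` omits one point of the ground set, and `P∨G` requires that point to lie in `G₀`.
    -- Seven hyperplanes thus force size 7 for `G₀`, and the two gaps of 3 give 10 and 13.
    G₀ H₀ : Subset 13
    G₀ = Sub.⊤ {7} V.++ Sub.⊥ {6}
    H₀ = Sub.⊤ {10} V.++ Sub.⊥ {3}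

    P₀ : Fin 7 → Subset 13
    P₀ a = Sub.⊤ Sub.- (a F.↑ˡ 6)

    spans : ∀ A B → 13 ≤ ∣ A ∪ B ∣ → ∣ pad Sub.⊤ ∣ ≤ ∣ pad A ∪ pad B ∣
    spans A B h = subst₂ _≤_ (sym (∣pad∣ Sub.⊤)) (sym (trans (cong ∣_∣ (pad-∪ A B)) (∣pad∣ (A ∪ B)))) h

  booleanConfiguration : Configuration (U (13 + m))
  booleanConfiguration = record
    { T = pad Sub.⊤ ; H = pad H₀ ; G = pad G₀ ; P = pad ∘ P₀
    ; G⊆H = pad-⊆ refl ; H⊆T = pad-⊆ refl
    ; P⊆T = λ a → pad-⊆ (from-yes (FP.all? λ a → VP.≡-dec BoolP._≟_ (P₀ a ∪ Sub.⊤) Sub.⊤) a)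
    ; rk-⁅⁆ = SP.∣⁅x⁆∣≡1
    ; 4≤rkG = subst (4 ≤_) (sym (∣pad∣ G₀)) (from-yes (4 ℕP.≤? 7))
    ; rkG≪rkH = subst₂ (λ g h → 3 + g ≤ h) (sym (∣pad∣ G₀)) (sym (∣pad∣ H₀)) ℕP.≤-refl
    ; rkH≪rkT = subst₂ (λ h t → 3 + h ≤ t) (sym (∣pad∣ H₀)) (sym (∣pad∣ Sub.⊤)) ℕP.≤-refl
    ; rkT = λ a → trans (∣pad∣ Sub.⊤) (trans (from-yes (FP.all? λ a → 13 ℕP.≟ suc ∣ P₀ a ∣) a)
                                           (cong suc (sym (∣pad∣ (P₀ a)))))
    ; P∨G = λ a → spans (P₀ a) G₀ (from-yes (FP.all? λ a → 13 ℕP.≤? ∣ P₀ a ∪ G₀ ∣) a)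
    ; P∨P = λ {a} {b} a≢b → spans (P₀ a) (P₀ b) ([ ⊥-elim ∘ a≢b , (λ h → h) ]′ (pairs a b))
    }
    where
    pairs : ∀ a b → a ≡ b ⊎ 13 ≤ ∣ P₀ a ∪ P₀ b ∣
    pairs = from-yes (FP.all? λ a → FP.all? λ b → (a F.≟ b) ⊎-dec (13 ℕP.≤? ∣ P₀ a ∪ P₀ b ∣))

boolean-part : Σ ℕ λ N → ∀ (n : ℕ) → N ≤ n →
  Σ (List (Subset n)) λ 𝒢 → IsBuildingSet (U n) 𝒢 × ChowNotLogConcave (U n) 𝒢
boolean-part = 13 , λ n 13≤n → subst (λ n → Σ (List (Subset n)) λ 𝒢 → IsBuildingSet (U n) 𝒢 × ChowNotLogConcave (U n) 𝒢)
  (ℕP.m+[n∸m]≡n 13≤n) (example (n ∸ 13))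
  where
  example : ∀ m → Σ (List (Subset (13 + m))) λ 𝒢 → IsBuildingSet (U (13 + m)) 𝒢 × ChowNotLogConcave (U (13 + m)) 𝒢
  example m = Configuration.building C , boolean-isBuildingSet C , Chow.chow-notLogConcave C
    where C = booleanConfiguration m

-- Direct sums and connected flats

∈─⁻ : ∀ {e} (A B : Subset n) → e ∈ A ─ B → e ∉ B
∈─⁻ (_ ∷ A) (outside ∷ B) (V.there e∈) (V.there e∈B) = ∈─⁻ A B e∈ e∈B
∈─⁻ (_ ∷ A) (inside ∷ B)  (V.there e∈) (V.there e∈B) = ∈─⁻ A B e∈ e∈B
∈─⁻ (inside ∷ A) (outside ∷ B) V.here ()

∈-⁻ : ∀ {e c} (A : Subset n) → e ∈ A Sub.- c → e ∈ A × e ≢ c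
∈-⁻ {c = c} A e∈ = SP.p─q⊆p A ⁅ c ⁆ e∈ , λ { refl → ∈─⁻ A ⁅ c ⁆ e∈ (SP.x∈⁅x⁆ c) }

⊈⇒∃ : ∀ {A B : Subset n} → ¬ A ⊆ B → ∃ λ e → e ∈ A × e ∉ B
⊈⇒∃ {A = A} {B} A⊈B with FP.any? (λ e → (e SP.∈? A) ×-dec ¬? (e SP.∈? B))
... | yes found = found
... | no none   = ⊥-elim (A⊈B λ {e} e∈A → go e e∈A)
  where
  go : ∀ e → e ∈ A → e ∈ B
  go e e∈A with e SP.∈? B
  ... | yes e∈B = e∈B
  ... | no e∉B  = ⊥-elim (none (e , e∈A , e∉B))

module Closure (M : Matroid n) where
  open Rank M public

  cl-mono : ∀ {A B} → A ⊆ B → cl M A ⊆ cl M B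
  cl-mono {A} {B} A⊆B {e} e∈ = ∈cl⁺ {B} {e} (ℕP.+-cancelʳ-≤ (rk A) _ _ (begin
    rk (B ∪ ⁅ e ⁆) + rk A
      ≤⟨ ℕP.+-mono-≤
           (rk-mono (∪-lub (SP.q⊆p∪q (A ∪ ⁅ e ⁆) B) (λ x → SP.p⊆p∪q B (SP.q⊆p∪q A ⁅ e ⁆ x))))
           (rk-mono (λ x → SP.x∈p∩q⁺ (SP.p⊆p∪q ⁅ e ⁆ x , A⊆B x))) ⟩
    rk ((A ∪ ⁅ e ⁆) ∪ B) + rk ((A ∪ ⁅ e ⁆) ∩ B)  ≤⟨ rk-submod (A ∪ ⁅ e ⁆) B ⟩
    rk (A ∪ ⁅ e ⁆) + rk B                        ≤⟨ ℕP.+-monoˡ-≤ (rk B) (∈cl⁻ {A} {e} e∈) ⟩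
    rk A + rk B                                  ≡⟨ ℕP.+-comm (rk A) (rk B) ⟩
    rk B + rk A                                  ∎))
    where open ℕP.≤-Reasoning

  flat⇒cl⊆ : ∀ {F A} → IsFlat M F → A ⊆ F → cl M A ⊆ F
  flat⇒cl⊆ {F} {A} flat A⊆F {e} e∈ with e SP.∈? F
  ... | yes e∈F = e∈F
  ... | no e∉F  = ⊥-elim (ℕP.<⇒≱ (flat e e∉F) (∈cl⁻ {F} {e} (cl-mono {A} {F} A⊆F e∈)))

  cl⊆⇒flat : ∀ {F} → cl M F ⊆ F → IsFlat M F
  cl⊆⇒flat {F} cl⊆ e e∉F = ℕP.≰⇒> λ le → e∉F (cl⊆ (∈cl⁺ {F} {e} le))

  cl-flat : ∀ A → IsFlat M (cl M A)
  cl-flat A = cl⊆⇒flat λ {e} e∈ → ∈cl⁺ {A} {e} (begin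
    rk (A ∪ ⁅ e ⁆)         ≤⟨ rk-mono (∪-mono {A = A} (⊆cl A) (λ x → x)) ⟩
    rk (cl M A ∪ ⁅ e ⁆)    ≤⟨ ∈cl⁻ {cl M A} {e} e∈ ⟩
    rk (cl M A)            ≤⟨ rk-cl A ⟩
    rk A                   ∎)
    where open ℕP.≤-Reasoning

  flat⇒cl≡ : ∀ {F} → IsFlat M F → cl M F ≡ F
  flat⇒cl≡ {F} flat = SP.⊆-antisym (flat⇒cl⊆ {F} {F} flat (λ e → e)) (⊆cl F)

  ∩-flat : ∀ {A B} → IsFlat M A → IsFlat M B → IsFlat M (A ∩ B)
  ∩-flat {A} {B} flatA flatB = cl⊆⇒flat λ e∈ → SP.x∈p∩q⁺
    (flat⇒cl⊆ {A} flatA (SP.p∩q⊆p A B) e∈ , flat⇒cl⊆ {B} flatB (SP.p∩q⊆q A B) e∈)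

  spanning⇒⊆cl : ∀ {X F} → X ⊆ F → rk F ≤ rk X → F ⊆ cl M X
  spanning⇒⊆cl {X} {F} X⊆F le {e} e∈F = ∈cl⁺ {X} {e} (ℕP.≤-trans (rk-mono (∪-lub X⊆F (⁅⁆⊆ e∈F))) le)

  flatsBelow : ∀ {A} → IsFlat M A → Lattice 0ℓ 0ℓ 0ℓ
  flatsBelow {A} flatA = record
    { Carrier = Σ (Subset n) λ X → IsFlat M X × X ⊆ A
    ; _≈_ = λ X Y → proj₁ X ≡ proj₁ Y
    ; _≤_ = λ X Y → proj₁ X ⊆ proj₁ Y
    ; _∨_ = λ { (X , _ , X⊆) (Y , _ , Y⊆) → cl M (X ∪ Y) , cl-flat (X ∪ Y) , flat⇒cl⊆ {A} {X ∪ Y} flatA (∪-lub X⊆ Y⊆) }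
    ; _∧_ = λ { (X , fX , X⊆) (Y , fY , _) → X ∩ Y , ∩-flat fX fY , λ e → X⊆ (SP.p∩q⊆p X Y e) }
    ; isLattice = record
      { isPartialOrder = record
        { isPreorder = record
          { isEquivalence = record { refl = refl ; sym = sym ; trans = trans }
          ; reflexive = λ eq → SP.⊆-reflexive eq
          ; trans = λ p q e → q (p e)
          }
        ; antisym = SP.⊆-antisym
        }
      ; supremum = λ { (X , _) (Y , _) →
          (λ e → ⊆cl (X ∪ Y) (SP.p⊆p∪q Y e)) , (λ e → ⊆cl (X ∪ Y) (SP.q⊆p∪q X Y e)) ,
          λ { (Z , fZ , _) X⊆Z Y⊆Z → flat⇒cl⊆ {Z} {X ∪ Y} fZ (∪-lub X⊆Z Y⊆Z) } }
      ; infimum = λ { (X , _) (Y , _) →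
          SP.p∩q⊆p X Y , SP.p∩q⊆q X Y , λ { _ Z⊆X Z⊆Y e → SP.x∈p∩q⁺ (Z⊆X e , Z⊆Y e) } }
      }
    }

  module DirectSum {F A B} (flatF : IsFlat M F) (flatA : IsFlat M A) (flatB : IsFlat M B)
    (A⊆F : A ⊆ F) (B⊆F : B ⊆ F) (F⊆A∪B : F ⊆ A ∪ B) (disjoint : ∀ {e} → e ∈ A → e ∉ B)
    (rk-sum : rk A + rk B ≤ rk F) where

    -- Additivity passes from `A`, `B` to subsets in two submodular steps: first `A` is shrunk to
    -- `X` with `B` kept, then `B` is shrunk to `Y`.
    rk-direct : ∀ {X Y} → X ⊆ A → Y ⊆ B → rk X + rk Y ≤ rk (X ∪ Y)
    rk-direct {X} {Y} X⊆A Y⊆B = ℕP.+-cancelʳ-≤ (rk B) _ _ (begin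
      rk X + rk Y + rk B         ≡⟨ trans (ℕP.+-assoc (rk X) (rk Y) (rk B)) (trans (cong (rk X +_) (ℕP.+-comm (rk Y) (rk B)))
                                      (sym (ℕP.+-assoc (rk X) (rk B) (rk Y)))) ⟩
      rk X + rk B + rk Y         ≤⟨ ℕP.+-monoˡ-≤ (rk Y) step ⟩
      rk (X ∪ B) + rk Y
        ≤⟨ ℕP.+-mono-≤
             (rk-mono (∪-mono {A = X} (SP.p⊆p∪q Y) (λ e → e)))
             (rk-mono (λ e → SP.x∈p∩q⁺ (SP.q⊆p∪q X Y e , Y⊆B e))) ⟩
      rk ((X ∪ Y) ∪ B) + rk ((X ∪ Y) ∩ B)   ≤⟨ rk-submod (X ∪ Y) B ⟩
      rk (X ∪ Y) + rk B          ∎)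
      where
      open ℕP.≤-Reasoning
      step : rk X + rk B ≤ rk (X ∪ B)
      step = ℕP.+-cancelʳ-≤ (rk A) _ _ (begin
        rk X + rk B + rk A       ≡⟨ trans (ℕP.+-assoc (rk X) (rk B) (rk A)) (ℕP.+-comm (rk X) _) ⟩
        rk B + rk A + rk X       ≤⟨ ℕP.+-monoˡ-≤ (rk X) (ℕP.≤-trans (ℕP.≤-reflexive (ℕP.+-comm (rk B) (rk A))) rk-sum) ⟩
        rk F + rk X
          ≤⟨ ℕP.+-mono-≤
               (rk-mono (λ e → [ SP.q⊆p∪q (X ∪ B) A , (λ b → SP.p⊆p∪q A (SP.q⊆p∪q X B b)) ]′ (SP.x∈p∪q⁻ A B (F⊆A∪B e))))
               (rk-mono (λ e → SP.x∈p∩q⁺ (SP.p⊆p∪q B e , X⊆A e))) ⟩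
        rk ((X ∪ B) ∪ A) + rk ((X ∪ B) ∩ A)   ≤⟨ rk-submod (X ∪ B) A ⟩
        rk (X ∪ B) + rk A        ∎)

    ∪-flat : ∀ {X Y} → IsFlat M X → X ⊆ A → IsFlat M Y → Y ⊆ B → IsFlat M (X ∪ Y)
    ∪-flat {X} {Y} fX X⊆A fY Y⊆B e e∉ with e SP.∈? F
    ... | no e∉F = ℕP.≰⇒> λ le → e∉F (flat⇒cl⊆ {F} {X ∪ Y} flatF (∪-lub (λ x → A⊆F (X⊆A x)) (λ y → B⊆F (Y⊆B y))) (∈cl⁺ {X ∪ Y} {e} le))
    ... | yes e∈F with SP.x∈p∪q⁻ A B (F⊆A∪B e∈F)
    ...   | inj₁ e∈A = begin-strict
      rk (X ∪ Y)                ≤⟨ rk-∪ X Y ⟩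
      rk X + rk Y               <⟨ ℕP.+-monoˡ-< (rk Y) (fX e (λ e∈X → e∉ (SP.p⊆p∪q Y e∈X))) ⟩
      rk (X ∪ ⁅ e ⁆) + rk Y     ≤⟨ rk-direct (∪-lub X⊆A (⁅⁆⊆ e∈A)) Y⊆B ⟩
      rk ((X ∪ ⁅ e ⁆) ∪ Y)      ≤⟨ rk-mono (∪-lub (∪-mono {A = X} (SP.p⊆p∪q Y) (λ x → x)) (λ y → SP.p⊆p∪q ⁅ e ⁆ (SP.q⊆p∪q X Y y))) ⟩
      rk ((X ∪ Y) ∪ ⁅ e ⁆)      ∎
      where open ℕP.≤-Reasoning
    ...   | inj₂ e∈B = begin-strict
      rk (X ∪ Y)                ≤⟨ rk-∪ X Y ⟩
      rk X + rk Y               <⟨ ℕP.+-monoʳ-< (rk X) (fY e (λ e∈Y → e∉ (SP.q⊆p∪q X Y e∈Y))) ⟩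
      rk X + rk (Y ∪ ⁅ e ⁆)     ≤⟨ rk-direct X⊆A (∪-lub Y⊆B (⁅⁆⊆ e∈B)) ⟩
      rk (X ∪ (Y ∪ ⁅ e ⁆))      ≤⟨ rk-mono (∪-lub (λ x → SP.p⊆p∪q ⁅ e ⁆ (SP.p⊆p∪q Y x)) (∪-mono {A = Y} (SP.q⊆p∪q X Y) (λ x → x))) ⟩
      rk ((X ∪ Y) ∪ ⁅ e ⁆)      ∎
      where open ℕP.≤-Reasoning

    ∪-∩A : ∀ {X Y} → X ⊆ A → Y ⊆ B → (X ∪ Y) ∩ A ≡ X
    ∪-∩A {X} {Y} X⊆A Y⊆B = SP.⊆-antisym
      (λ e∈ → let e∈∪ , e∈A = SP.x∈p∩q⁻ (X ∪ Y) A e∈ in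
        [ (λ x → x) , (λ y → ⊥-elim (disjoint e∈A (Y⊆B y))) ]′ (SP.x∈p∪q⁻ X Y e∈∪))
      (λ x → SP.x∈p∩q⁺ (SP.p⊆p∪q Y x , X⊆A x))

    ∪-∩B : ∀ {X Y} → X ⊆ A → Y ⊆ B → (X ∪ Y) ∩ B ≡ Y
    ∪-∩B {X} {Y} X⊆A Y⊆B = SP.⊆-antisym
      (λ e∈ → let e∈∪ , e∈B = SP.x∈p∩q⁻ (X ∪ Y) B e∈ in
        [ (λ x → ⊥-elim (disjoint (X⊆A x) e∈B)) , (λ y → y) ]′ (SP.x∈p∪q⁻ X Y e∈∪))
      (λ y → SP.x∈p∩q⁺ (SP.q⊆p∪q X Y y , Y⊆B y))

    split : ∀ {G} → G ⊆ F → (G ∩ A) ∪ (G ∩ B) ≡ G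
    split {G} G⊆F = SP.⊆-antisym (∪-lub (SP.p∩q⊆p G A) (SP.p∩q⊆p G B))
      (λ e → [ (λ a → SP.p⊆p∪q (G ∩ B) (SP.x∈p∩q⁺ (e , a))) , (λ b → SP.q⊆p∪q (G ∩ A) (G ∩ B) (SP.x∈p∩q⁺ (e , b))) ]′
        (SP.x∈p∪q⁻ A B (F⊆A∪B (G⊆F e))))

    cl-direct : ∀ {X Y} → X ⊆ A → Y ⊆ B → cl M (X ∪ Y) ≡ cl M X ∪ cl M Y
    cl-direct {X} {Y} X⊆A Y⊆B = SP.⊆-antisym
      (flat⇒cl⊆ {cl M X ∪ cl M Y} {X ∪ Y}
        (∪-flat (cl-flat X) (flat⇒cl⊆ {A} {X} flatA X⊆A) (cl-flat Y) (flat⇒cl⊆ {B} {Y} flatB Y⊆B))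
        (∪-mono (⊆cl X) (⊆cl Y)))
      (∪-lub (cl-mono {X} {X ∪ Y} (SP.p⊆p∪q Y)) (cl-mono {Y} {X ∪ Y} (SP.q⊆p∪q X Y)))

    join-∩ : ∀ {G H} → G ⊆ F → H ⊆ F → cl M (G ∪ H) ≡ cl M ((G ∩ A) ∪ (H ∩ A)) ∪ cl M ((G ∩ B) ∪ (H ∩ B))
    join-∩ {G} {H} G⊆F H⊆F = trans (cong (cl M) (SP.⊆-antisym
        (∪-lub (λ g → ∪-mono (SP.p⊆p∪q (H ∩ A)) (SP.p⊆p∪q (H ∩ B)) (SP.⊆-reflexive (sym (split G⊆F)) g))
               (λ h → ∪-mono (SP.q⊆p∪q (G ∩ A) (H ∩ A)) (SP.q⊆p∪q (G ∩ B) (H ∩ B)) (SP.⊆-reflexive (sym (split H⊆F)) h)))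
        (∪-lub (∪-mono (SP.p∩q⊆p G A) (SP.p∩q⊆p H A)) (∪-mono (SP.p∩q⊆p G B) (SP.p∩q⊆p H B)))))
      (cl-direct (∪-lub (SP.p∩q⊆q G A) (SP.p∩q⊆q H A)) (∪-lub (SP.p∩q⊆q G B) (SP.p∩q⊆q H B)))

    ∩-∩ : ∀ (G H C : Subset n) → (G ∩ H) ∩ C ≡ (G ∩ C) ∩ (H ∩ C)
    ∩-∩ G H C = SP.⊆-antisym
      (λ e → let gh , c = SP.x∈p∩q⁻ (G ∩ H) C e in let g , h = SP.x∈p∩q⁻ G H gh in
        SP.x∈p∩q⁺ (SP.x∈p∩q⁺ (g , c) , SP.x∈p∩q⁺ (h , c)))
      (λ e → let gc , hc = SP.x∈p∩q⁻ (G ∩ C) (H ∩ C) e in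
        SP.x∈p∩q⁺ (SP.x∈p∩q⁺ (SP.p∩q⊆p G C gc , SP.p∩q⊆p H C hc) , SP.p∩q⊆q G C gc))

    interval-iso : IntervalIso M F (flatsBelow flatA) (flatsBelow flatB)
    interval-iso = record
      -- `to` takes arbitrary subsets, so the closure is inserted to land in flats; on flats it is
      -- the identity.
      { to        = λ X → (cl M X ∩ A , ∩-flat (cl-flat X) flatA , SP.p∩q⊆q (cl M X) A)
                        , (cl M X ∩ B , ∩-flat (cl-flat X) flatB , SP.p∩q⊆q (cl M X) B)
      ; from      = λ { ((X , _) , (Y , _)) → X ∪ Y }
      ; from-flat = λ { ((X , fX , X⊆A) , (Y , fY , Y⊆B)) →
                      ∪-flat fX X⊆A fY Y⊆B , ∪-lub (λ x → A⊆F (X⊆A x)) (λ y → B⊆F (Y⊆B y)) }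
      ; from-cong = λ { _ _ (eqX , eqY) → cong₂ _∪_ eqX eqY }
      ; from-to   = λ G fG G⊆F → trans (cong (λ G′ → (G′ ∩ A) ∪ (G′ ∩ B)) (flat⇒cl≡ fG)) (split G⊆F)
      ; to-from   = λ { ((X , fX , X⊆A) , (Y , fY , Y⊆B)) →
                      let eq = flat⇒cl≡ (∪-flat fX X⊆A fY Y⊆B) in
                      trans (cong (_∩ A) eq) (∪-∩A X⊆A Y⊆B) , trans (cong (_∩ B) eq) (∪-∩B X⊆A Y⊆B) }
      ; to-∨      = λ G H fG G⊆F fH H⊆F →
          trans (cong (_∩ A) (join≡ G H fG G⊆F fH H⊆F)) (∪-∩A (below G H A flatA) (below G H B flatB)) ,
          trans (cong (_∩ B) (join≡ G H fG G⊆F fH H⊆F)) (∪-∩B (below G H A flatA) (below G H B flatB))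
      ; to-∧      = λ G H fG G⊆F fH H⊆F → meet≡ G H A fG fH , meet≡ G H B fG fH
      }
      where
      below : ∀ G H C → IsFlat M C → cl M ((cl M G ∩ C) ∪ (cl M H ∩ C)) ⊆ C
      below G H C fC = flat⇒cl⊆ {C} {(cl M G ∩ C) ∪ (cl M H ∩ C)} fC (∪-lub (SP.p∩q⊆q (cl M G) C) (SP.p∩q⊆q (cl M H) C))
      join≡ : ∀ G H → IsFlat M G → G ⊆ F → IsFlat M H → H ⊆ F →
        cl M (cl M (G ∪ H)) ≡ cl M ((cl M G ∩ A) ∪ (cl M H ∩ A)) ∪ cl M ((cl M G ∩ B) ∪ (cl M H ∩ B))
      join≡ G H fG G⊆F fH H⊆F = trans (flat⇒cl≡ (cl-flat (G ∪ H))) (trans (join-∩ G⊆F H⊆F)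
        (cong₂ (λ G′ H′ → cl M ((G′ ∩ A) ∪ (H′ ∩ A)) ∪ cl M ((G′ ∩ B) ∪ (H′ ∩ B))) (sym (flat⇒cl≡ fG)) (sym (flat⇒cl≡ fH))))
      meet≡ : ∀ G H C → IsFlat M G → IsFlat M H → cl M (G ∩ H) ∩ C ≡ (cl M G ∩ C) ∩ (cl M H ∩ C)
      meet≡ G H C fG fH = trans (cong (_∩ C) (flat⇒cl≡ (∩-flat fG fH))) (trans (∩-∩ G H C)
        (cong₂ (λ G′ H′ → (G′ ∩ C) ∩ (H′ ∩ C)) (sym (flat⇒cl≡ fG)) (sym (flat⇒cl≡ fH))))

    decomposable : Loopless M → A ≢ Sub.⊥ → B ≢ Sub.⊥ → Decomposable M F
    decomposable loopless A≢⊥ B≢⊥ = flatsBelow flatA , flatsBelow flatB ,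
      ((A , flatA , λ e → e) , (Sub.⊥ , loopless , SP.⊥⊆) , A≢⊥) ,
      ((B , flatB , λ e → e) , (Sub.⊥ , loopless , SP.⊥⊆) , B≢⊥) ,
      interval-iso

  -- A point whose removal lowers the rank splits off as a direct summand: `F - e` is again a flat,
  -- and the drop pays for the rank of the point.
  coloop-decomposable : Loopless M → ∀ {F e} → IsFlat M F → IsFlat M ⁅ e ⁆ → e ∈ F →
    rk (F Sub.- e) < rk F → F Sub.- e ≢ Sub.⊥ → Decomposable M F
  coloop-decomposable loopless {F} {e} flatF flat-e e∈F lt F-e≢⊥ =
    DirectSum.decomposable {F} {F Sub.- e} {⁅ e ⁆} flatF flat-A flat-e A⊆F (⁅⁆⊆ e∈F) F⊆
      (λ e∈A e∈e → ∈─⁻ F ⁅ e ⁆ e∈A e∈e)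
      (ℕP.≤-trans (ℕP.+-monoʳ-≤ (rk (F Sub.- e)) (ℕP.≤-trans (rk-≤card ⁅ e ⁆) (ℕP.≤-reflexive (SP.∣⁅x⁆∣≡1 e))))
        (ℕP.≤-trans (ℕP.≤-reflexive (ℕP.+-comm (rk (F Sub.- e)) 1)) lt))
      loopless F-e≢⊥ (λ eq → SP.∉⊥ (subst (e ∈_) eq (SP.x∈⁅x⁆ e)))
    where
    A⊆F : F Sub.- e ⊆ F
    A⊆F = SP.p─q⊆p F ⁅ e ⁆
    F⊆ : F ⊆ (F Sub.- e) ∪ ⁅ e ⁆
    F⊆ {x} x∈F with x F.≟ e
    ... | yes refl = SP.q⊆p∪q (F Sub.- e) ⁅ e ⁆ (SP.x∈⁅x⁆ e)
    ... | no x≢e   = SP.p⊆p∪q ⁅ e ⁆ (SP.x∈p∧x≢y⇒x∈p-y x∈F x≢e)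
    flat-A : IsFlat M (F Sub.- e)
    flat-A x x∉ with x F.≟ e
    ... | yes refl = ℕP.<-≤-trans lt (rk-mono F⊆)
    ... | no x≢e   = ℕP.≰⇒> λ le → x∉ (SP.x∈p∧x≢y⇒x∈p-y
      (flat⇒cl⊆ {F} {F Sub.- e} flatF A⊆F (∈cl⁺ {F Sub.- e} {x} le)) x≢e)

  -- Product decompositions of an interval of flats.

  module Product (loopless : Loopless M) {F} (flatF : IsFlat M F)
    (L₁ L₂ : Lattice 0ℓ 0ℓ 0ℓ) (I : IntervalIso M F L₁ L₂) where
    private
      module I = IntervalIso I
      module A = Lattice L₁
      module B = Lattice L₂

    -- Exchanging the factors lets every statement about `left` be reused for the flat of (bottom,
    -- top).
    swapped : IntervalIso M F L₂ L₁
    swapped = record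
      { to = λ X → proj₂ (I.to X) , proj₁ (I.to X)
      ; from = λ { (b , a) → I.from (a , b) }
      ; from-flat = λ { (b , a) → I.from-flat (a , b) }
      ; from-cong = λ { (b , a) (b′ , a′) (e , e′) → I.from-cong (a , b) (a′ , b′) (e′ , e) }
      ; from-to = I.from-to
      ; to-from = λ { (b , a) → proj₂ (I.to-from (a , b)) , proj₁ (I.to-from (a , b)) }
      ; to-∨ = λ G H fG G⊆ fH H⊆ → proj₂ (I.to-∨ G H fG G⊆ fH H⊆) , proj₁ (I.to-∨ G H fG G⊆ fH H⊆)
      ; to-∧ = λ G H fG G⊆ fH H⊆ → proj₂ (I.to-∧ G H fG G⊆ fH H⊆) , proj₁ (I.to-∧ G H fG G⊆ fH H⊆)
      }

    Below : Subset n → Set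
    Below X = IsFlat M X × X ⊆ F

    to₁ : Subset n → A.Carrier
    to₁ X = proj₁ (I.to X)

    to₂ : Subset n → B.Carrier
    to₂ X = proj₂ (I.to X)

    join≡ : ∀ {X Y} → Below Y → X ⊆ Y → cl M (X ∪ Y) ≡ Y
    join≡ {X} {Y} (fY , _) X⊆Y = trans
      (cong (cl M) (SP.⊆-antisym (∪-lub X⊆Y (λ e → e)) (SP.q⊆p∪q X Y))) (flat⇒cl≡ fY)

    to₁-mono : ∀ {X Y} → Below X → Below Y → X ⊆ Y → to₁ X A.≤ to₁ Y
    to₁-mono {X} {Y} bX@(fX , X⊆F) bY@(fY , Y⊆F) X⊆Y = A.trans (A.x≤x∨y (to₁ X) (to₁ Y))
      (A.trans (A.reflexive (A.Eq.sym (proj₁ (I.to-∨ X Y fX X⊆F fY Y⊆F)))) (A.reflexive (A.Eq.reflexive (cong to₁ (join≡ bY X⊆Y)))))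

    to₂-mono : ∀ {X Y} → Below X → Below Y → X ⊆ Y → to₂ X B.≤ to₂ Y
    to₂-mono {X} {Y} bX@(fX , X⊆F) bY@(fY , Y⊆F) X⊆Y = B.trans (B.x≤x∨y (to₂ X) (to₂ Y))
      (B.trans (B.reflexive (B.Eq.sym (proj₂ (I.to-∨ X Y fX X⊆F fY Y⊆F)))) (B.reflexive (B.Eq.reflexive (cong to₂ (join≡ bY X⊆Y)))))

    -- Order is recovered from joins: under the two inequalities `cl M (X ∪ Y)` and `Y` have the
    -- same image, and `from` identifies them.
    to-reflects : ∀ {X Y} → Below X → Below Y → to₁ X A.≤ to₁ Y → to₂ X B.≤ to₂ Y → X ⊆ Y
    to-reflects {X} {Y} (fX , X⊆F) (fY , Y⊆F) le₁ le₂ e∈X = subst (_ ∈_) eq (⊆cl (X ∪ Y) (SP.p⊆p∪q Y e∈X))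
      where
      J⊆F : cl M (X ∪ Y) ⊆ F
      J⊆F = flat⇒cl⊆ {F} {X ∪ Y} flatF (∪-lub X⊆F Y⊆F)
      joins = I.to-∨ X Y fX X⊆F fY Y⊆F
      eq : cl M (X ∪ Y) ≡ Y
      eq = trans (sym (I.from-to _ (cl-flat (X ∪ Y)) J⊆F)) (trans (I.from-cong _ _
        ( A.Eq.trans (proj₁ joins) (A.antisym (A.∨-least le₁ A.refl) (A.y≤x∨y (to₁ X) (to₁ Y)))
        , B.Eq.trans (proj₂ joins) (B.antisym (B.∨-least le₂ B.refl) (B.y≤x∨y (to₂ X) (to₂ Y)))))
        (I.from-to Y fY Y⊆F))

    ⊥-below : Below Sub.⊥
    ⊥-below = loopless , SP.⊥⊆

    F-below : Below F
    F-below = flatF , λ e → e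

    -- The flat corresponding to (⊤ , ⊥).
    left : Subset n
    left = I.from (to₁ F , to₂ Sub.⊥)

    left-below : Below left
    left-below = I.from-flat (to₁ F , to₂ Sub.⊥)

    left₁ : to₁ F A.≤ to₁ left
    left₁ = A.reflexive (A.Eq.sym (proj₁ (I.to-from (to₁ F , to₂ Sub.⊥))))

    left₂ : to₂ left B.≤ to₂ Sub.⊥
    left₂ = B.reflexive (proj₂ (I.to-from (to₁ F , to₂ Sub.⊥)))

    -- If `left` were all of `F`, top and bottom of the second factor would coincide and that factor
    -- would collapse to one element.
    left-proper : Nontrivial M L₂ → ¬ F ⊆ left
    left-proper (x , y , x≉y) F⊆left = x≉y (B.Eq.trans (collapse x) (B.Eq.sym (collapse y)))
      where
      F≤⊥ : to₂ F B.≤ to₂ Sub.⊥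
      F≤⊥ = B.trans (to₂-mono F-below left-below F⊆left) left₂
      collapse : ∀ x → x B.≈ to₂ Sub.⊥
      collapse x = B.antisym
        (B.trans (B.reflexive (B.Eq.sym x≈)) (B.trans (to₂-mono below F-below (proj₂ below)) F≤⊥))
        (B.trans (to₂-mono ⊥-below below SP.⊥⊆) (B.reflexive x≈))
        where
        X = I.from (to₁ F , x)
        below : Below X
        below = I.from-flat (to₁ F , x)
        x≈ : to₂ X B.≈ x
        x≈ = proj₂ (I.to-from (to₁ F , x))

  module Indecomposable (loopless : Loopless M) (simple : ∀ e → IsFlat M ⁅ e ⁆) {F} (flatF : IsFlat M F) where

    module _ (L₁ L₂ : Lattice 0ℓ 0ℓ 0ℓ) (I : IntervalIso M F L₁ L₂) where
      private
        module I  = IntervalIso I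
        module Lf = Product loopless flatF L₁ L₂ I
        module Rt = Product loopless flatF L₂ L₁ Lf.swapped
        module A = Lattice L₁
        module B = Lattice L₂
      open Lf using (to₁; to₂; Below; left)

      right : Subset n
      right = Rt.left

      left∩right : ∀ {e} → e ∈ left → e ∉ right
      left∩right e∈l e∈r = SP.∉⊥ (Lf.to-reflects D-below Lf.⊥-below
        (A.trans (Lf.to₁-mono D-below Rt.left-below (SP.p∩q⊆q left right)) Rt.left₂)
        (B.trans (Lf.to₂-mono D-below Lf.left-below (SP.p∩q⊆p left right)) Lf.left₂)
        (SP.x∈p∩q⁺ (e∈l , e∈r)))
        where
        D-below : Below (left ∩ right)
        D-below = ∩-flat (proj₁ Lf.left-below) (proj₁ Rt.left-below)
          , λ e → proj₂ Lf.left-below (SP.p∩q⊆p left right e)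

      -- The flats with coordinates of `e` in one factor and of the empty set in the other both lie
      -- below the atom, so each is empty or contains `e`. They cannot both be empty, since then
      -- both coordinates of `e` would be bottom.
      left∪right : ∀ {e} → e ∈ F → e ∈ left ⊎ e ∈ right
      left∪right {e} e∈F with e SP.∈? I.from (to₁ ⁅ e ⁆ , to₂ Sub.⊥) | e SP.∈? I.from (to₁ Sub.⊥ , to₂ ⁅ e ⁆)
      ... | yes e∈ | _ = inj₁ (Lf.to-reflects (I.from-flat _) Lf.left-below
              (A.trans (A.reflexive (proj₁ (I.to-from _))) (A.trans (Lf.to₁-mono E-below Lf.F-below (proj₂ E-below)) Lf.left₁))
              (B.trans (B.reflexive (proj₂ (I.to-from _))) (Lf.to₂-mono Lf.⊥-below Lf.left-below SP.⊥⊆)) e∈)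
        where
        E-below : Below ⁅ e ⁆
        E-below = simple e , ⁅⁆⊆ e∈F
      ... | no _ | yes e∈ = inj₂ (Lf.to-reflects (I.from-flat _) Rt.left-below
              (A.trans (A.reflexive (proj₁ (I.to-from _))) (Lf.to₁-mono Lf.⊥-below Rt.left-below SP.⊥⊆))
              (B.trans (B.reflexive (proj₂ (I.to-from _))) (B.trans (Lf.to₂-mono E-below Lf.F-below (proj₂ E-below)) Rt.left₁)) e∈)
        where
        E-below : Below ⁅ e ⁆
        E-below = simple e , ⁅⁆⊆ e∈F
      ... | no e∉₁ | no e∉₂ = ⊥-elim (SP.∉⊥ (Lf.to-reflects E-below Lf.⊥-below
              (A.trans (A.reflexive (A.Eq.sym (proj₁ (I.to-from _)))) (Lf.to₁-mono (I.from-flat _) Lf.⊥-below E₁⊆⊥))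
              (B.trans (B.reflexive (B.Eq.sym (proj₂ (I.to-from _)))) (Lf.to₂-mono (I.from-flat _) Lf.⊥-below E₂⊆⊥))
              (SP.x∈⁅x⁆ e)))
        where
        E-below : Below ⁅ e ⁆
        E-below = simple e , ⁅⁆⊆ e∈F
        E₁ = I.from (to₁ ⁅ e ⁆ , to₂ Sub.⊥)
        E₂ = I.from (to₁ Sub.⊥ , to₂ ⁅ e ⁆)
        E₁⊆E : E₁ ⊆ ⁅ e ⁆
        E₁⊆E = Lf.to-reflects (I.from-flat _) E-below (A.reflexive (proj₁ (I.to-from _)))
          (B.trans (B.reflexive (proj₂ (I.to-from _))) (Lf.to₂-mono Lf.⊥-below E-below SP.⊥⊆))
        E₂⊆E : E₂ ⊆ ⁅ e ⁆
        E₂⊆E = Lf.to-reflects (I.from-flat _) E-below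
          (A.trans (A.reflexive (proj₁ (I.to-from _))) (Lf.to₁-mono Lf.⊥-below E-below SP.⊥⊆))
          (B.reflexive (proj₂ (I.to-from _)))
        E₁⊆⊥ : E₁ ⊆ Sub.⊥
        E₁⊆⊥ x∈ = ⊥-elim (e∉₁ (subst (_∈ E₁) (SP.x∈⁅y⁆⇒x≡y e (E₁⊆E x∈)) x∈))
        E₂⊆⊥ : E₂ ⊆ Sub.⊥
        E₂⊆⊥ x∈ = ⊥-elim (e∉₂ (subst (_∈ E₂) (SP.x∈⁅y⁆⇒x≡y e (E₂⊆E x∈)) x∈))

      -- Spanning is decided factor by factor. The closure of `Y` lies in `right` and has bottom as
      -- first coordinate, so `cl M X` alone must supply the first coordinate of `F`, which bounds
      -- that of `left`.
      left-spanned : ∀ {X Y} → X ⊆ left → Y ⊆ right → F ⊆ cl M (X ∪ Y) → left ⊆ cl M X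
      left-spanned {X} {Y} X⊆ Y⊆ spans = Lf.to-reflects Lf.left-below bX
        (A.trans (Lf.to₁-mono Lf.left-below Lf.F-below (proj₂ Lf.left-below))
          (A.trans (A.reflexive (A.Eq.reflexive (cong to₁ F≡)))
          (A.trans (A.reflexive (proj₁ (I.to-∨ (cl M X) (cl M Y) (proj₁ bX) (proj₂ bX) (proj₁ bY) (proj₂ bY))))
            (A.∨-least A.refl (A.trans (Lf.to₁-mono bY Rt.left-below Y′⊆) (A.trans Rt.left₂ (Lf.to₁-mono Lf.⊥-below bX SP.⊥⊆)))))))
        (B.trans Lf.left₂ (Lf.to₂-mono Lf.⊥-below bX SP.⊥⊆))
        where
        X′⊆ : cl M X ⊆ left
        X′⊆ = flat⇒cl⊆ {left} {X} (proj₁ Lf.left-below) X⊆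
        Y′⊆ : cl M Y ⊆ right
        Y′⊆ = flat⇒cl⊆ {right} {Y} (proj₁ Rt.left-below) Y⊆
        bX : Below (cl M X)
        bX = cl-flat X , λ e → proj₂ Lf.left-below (X′⊆ e)
        bY : Below (cl M Y)
        bY = cl-flat Y , λ e → proj₂ Rt.left-below (Y′⊆ e)
        F≡ : F ≡ cl M (cl M X ∪ cl M Y)
        F≡ = SP.⊆-antisym
          (λ e → cl-mono {X ∪ Y} {cl M X ∪ cl M Y} (∪-mono (⊆cl X) (⊆cl Y)) (spans e))
          (flat⇒cl⊆ {F} {cl M X ∪ cl M Y} flatF (∪-lub (proj₂ bX) (proj₂ bY)))

    atom-indecomposable : ∀ {e} → F ≡ ⁅ e ⁆ → ¬ Decomposable M F
    atom-indecomposable {e} refl (L₁ , L₂ , nt₁ , nt₂ , I)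
      with left∪right L₁ L₂ I (SP.x∈⁅x⁆ e)
    ... | inj₁ e∈ = Product.left-proper loopless flatF L₁ L₂ I nt₂ (⁅⁆⊆ e∈)
    ... | inj₂ e∈ = Product.left-proper loopless flatF L₂ L₁ (Product.swapped loopless flatF L₁ L₂ I) nt₁ (⁅⁆⊆ e∈)

    -- C is a circuit spanning F: its two parts in the factors would each be independent, and
    -- removing a point of one part would still leave that factor spanned.
    circuit-indecomposable : ∀ (C : Subset n) c₀ → c₀ ∈ C → C ⊆ F →
      (∀ c → c ∈ C → ∣ C ∣ ≤ suc (rk (C Sub.- c))) → rk F < ∣ C ∣ → ¬ Decomposable M F
    circuit-indecomposable C c₀ c₀∈C C⊆F circuit rkF< (L₁ , L₂ , nt₁ , nt₂ , I)
      with SP.nonempty? (C ∩ Product.left loopless flatF L₁ L₂ I) | SP.nonempty? (C ∩ right L₁ L₂ I)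
    -- A circuit that misses one part lies in the other, and so does what it spans, namely all of
    -- `F`; but the parts are proper.
    ... | no none | _ = Product.left-proper loopless flatF L₂ L₁ (Product.swapped loopless flatF L₁ L₂ I) nt₁
        (λ e∈F → flat⇒cl⊆ {right L₁ L₂ I} {C Sub.- c₀} (proj₁ (Product.left-below loopless flatF L₂ L₁ (Product.swapped loopless flatF L₁ L₂ I)))
          (λ {x} x∈ → let x∈C = proj₁ (∈-⁻ C x∈) in
            [ (λ l → ⊥-elim (none (x , SP.x∈p∩q⁺ (x∈C , l)))) , (λ r → r) ]′ (left∪right L₁ L₂ I (C⊆F x∈C)))
          (spanning⇒⊆cl {C Sub.- c₀} {F} (λ x∈ → C⊆F (proj₁ (∈-⁻ C x∈))) (ℕP.≤-pred (ℕP.≤-trans rkF< (circuit c₀ c₀∈C))) e∈F))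
    ... | yes _ | no none = Product.left-proper loopless flatF L₁ L₂ I nt₂
        (λ e∈F → flat⇒cl⊆ {Product.left loopless flatF L₁ L₂ I} {C Sub.- c₀} (proj₁ (Product.left-below loopless flatF L₁ L₂ I))
          (λ {x} x∈ → let x∈C = proj₁ (∈-⁻ C x∈) in
            [ (λ l → l) , (λ r → ⊥-elim (none (x , SP.x∈p∩q⁺ (x∈C , r)))) ]′ (left∪right L₁ L₂ I (C⊆F x∈C)))
          (spanning⇒⊆cl {C Sub.- c₀} {F} (λ x∈ → C⊆F (proj₁ (∈-⁻ C x∈))) (ℕP.≤-pred (ℕP.≤-trans rkF< (circuit c₀ c₀∈C))) e∈F))
    ... | yes (c , c∈) | yes (d , d∈) = ℕP.<⇒≱ independent (begin
        rk (C Sub.- d)                        ≤⟨ rk-mono C-d⊆ ⟩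
        rk (((C Sub.- d) Sub.- c) ∪ ⁅ c ⁆)    ≤⟨ ∈cl⁻ {(C Sub.- d) Sub.- c} {c} c∈cl ⟩
        rk ((C Sub.- d) Sub.- c)              ∎)
      where
      open ℕP.≤-Reasoning
      lf = Product.left loopless flatF L₁ L₂ I
      rt = right L₁ L₂ I
      c∈C = proj₁ (SP.x∈p∩q⁻ C lf c∈)
      c∈l = proj₂ (SP.x∈p∩q⁻ C lf c∈)
      d∈C = proj₁ (SP.x∈p∩q⁻ C rt d∈)
      d∈r = proj₂ (SP.x∈p∩q⁻ C rt d∈)
      c≢d : c ≢ d
      c≢d refl = left∩right L₁ L₂ I c∈l d∈r
      independent : rk ((C Sub.- d) Sub.- c) < rk (C Sub.- d)
      independent = begin-strict
        rk ((C Sub.- d) Sub.- c)   ≤⟨ rk-≤card _ ⟩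
        ∣ (C Sub.- d) Sub.- c ∣    <⟨ SP.x∈p⇒∣p-x∣<∣p∣ (SP.x∈p∧x≢y⇒x∈p-y c∈C c≢d) ⟩
        ∣ C Sub.- d ∣              ≤⟨ ℕP.≤-pred (ℕP.≤-trans (SP.x∈p⇒∣p-x∣<∣p∣ d∈C) (circuit d d∈C)) ⟩
        rk (C Sub.- d)             ∎
      X = (C Sub.- c) ∩ lf
      Y = C ∩ rt
      X∪Y : C Sub.- c ⊆ X ∪ Y
      X∪Y x∈ = [ (λ l → SP.p⊆p∪q Y (SP.x∈p∩q⁺ (x∈ , l)))
               , (λ r → SP.q⊆p∪q X Y (SP.x∈p∩q⁺ (proj₁ (∈-⁻ C x∈) , r))) ]′ (left∪right L₁ L₂ I (C⊆F (proj₁ (∈-⁻ C x∈))))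
      c∈clX : c ∈ cl M X
      c∈clX = left-spanned L₁ L₂ I {X} {Y} (SP.p∩q⊆q (C Sub.- c) lf) (SP.p∩q⊆q C rt)
        (λ e∈F → cl-mono {C Sub.- c} {X ∪ Y} X∪Y
          (spanning⇒⊆cl {C Sub.- c} {F} (λ x∈ → C⊆F (proj₁ (∈-⁻ C x∈))) (ℕP.≤-pred (ℕP.≤-trans rkF< (circuit c c∈C))) e∈F)) c∈l
      c∈cl : c ∈ cl M ((C Sub.- d) Sub.- c)
      c∈cl = cl-mono {X} {(C Sub.- d) Sub.- c} (λ {x} x∈ →
        let x∈C-c , x∈l = SP.x∈p∩q⁻ (C Sub.- c) lf x∈
            x∈C , x≢c = ∈-⁻ C x∈C-c in
        SP.x∈p∧x≢y⇒x∈p-y (SP.x∈p∧x≢y⇒x∈p-y x∈C (λ { refl → left∩right L₁ L₂ I x∈l d∈r })) x≢c) c∈clX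
      C-d⊆ : C Sub.- d ⊆ ((C Sub.- d) Sub.- c) ∪ ⁅ c ⁆
      C-d⊆ {x} x∈ with x F.≟ c
      ... | yes refl = SP.q⊆p∪q ((C Sub.- d) Sub.- c) ⁅ c ⁆ (SP.x∈⁅x⁆ c)
      ... | no x≢c   = SP.p⊆p∪q ⁅ c ⁆ (SP.x∈p∧x≢y⇒x∈p-y x∈ x≢c)

-- Matroids from cyclic flats.

bit : Bool → ℕ
bit true  = 1
bit false = 0

∣∷∣ : ∀ b (A : Subset n) → ∣ b ∷ A ∣ ≡ bit b + ∣ A ∣
∣∷∣ true  A = refl
∣∷∣ false A = refl

-- Both sides are sums over points, and the inequality already holds at each point: a table of
-- Boolean cases, in which a point of `X` outside `Y` is excluded.
∣─∣-nested : ∀ (A B X Y : Subset n) → X ⊆ Y → ∣ (A ∪ B) ─ Y ∣ + ∣ (A ∩ B) ─ X ∣ ≤ ∣ A ─ X ∣ + ∣ B ─ Y ∣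
∣─∣-nested [] [] [] [] _ = z≤n
∣─∣-nested (a ∷ A) (b ∷ B) (x ∷ X) (y ∷ Y) X⊆Y = begin
  ∣ ((a ∷ A) ∪ (b ∷ B)) ─ (y ∷ Y) ∣ + ∣ ((a ∷ A) ∩ (b ∷ B)) ─ (x ∷ X) ∣
    ≡⟨ cong₂ _+_ (∣∷∣ (head (((a ∷ []) ∪ (b ∷ [])) ─ (y ∷ []))) ((A ∪ B) ─ Y)) (∣∷∣ (head (((a ∷ []) ∩ (b ∷ [])) ─ (x ∷ []))) ((A ∩ B) ─ X)) ⟩
  (p + ∣ (A ∪ B) ─ Y ∣) + (q + ∣ (A ∩ B) ─ X ∣)
    ≡⟨ interchange p (∣ (A ∪ B) ─ Y ∣) q (∣ (A ∩ B) ─ X ∣) ⟩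
  (p + q) + (∣ (A ∪ B) ─ Y ∣ + ∣ (A ∩ B) ─ X ∣)
    ≤⟨ ℕP.+-mono-≤ (local a b x y X⊆Y) (∣─∣-nested A B X Y (SP.drop-∷-⊆ X⊆Y)) ⟩
  (r + s) + (∣ A ─ X ∣ + ∣ B ─ Y ∣)
    ≡⟨ sym (interchange r (∣ A ─ X ∣) s (∣ B ─ Y ∣)) ⟩
  (r + ∣ A ─ X ∣) + (s + ∣ B ─ Y ∣)
    ≡⟨ sym (cong₂ _+_ (∣∷∣ (head ((a ∷ []) ─ (x ∷ []))) (A ─ X)) (∣∷∣ (head ((b ∷ []) ─ (y ∷ []))) (B ─ Y))) ⟩
  ∣ (a ∷ A) ─ (x ∷ X) ∣ + ∣ (b ∷ B) ─ (y ∷ Y) ∣ ∎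
  where
  open ℕP.≤-Reasoning
  head : Subset 1 → Bool
  head (b ∷ []) = b
  p = bit (head (((a ∷ []) ∪ (b ∷ [])) ─ (y ∷ [])))
  q = bit (head (((a ∷ []) ∩ (b ∷ [])) ─ (x ∷ [])))
  r = bit (head ((a ∷ []) ─ (x ∷ [])))
  s = bit (head ((b ∷ []) ─ (y ∷ [])))
  local : ∀ a b x y → x ∷ X ⊆ y ∷ Y →
    bit (head (((a ∷ []) ∪ (b ∷ [])) ─ (y ∷ []))) + bit (head (((a ∷ []) ∩ (b ∷ [])) ─ (x ∷ [])))
    ≤ bit (head ((a ∷ []) ─ (x ∷ []))) + bit (head ((b ∷ []) ─ (y ∷ [])))
  local a     b     true  false sub with sub V.here
  ... | ()
  local false false false false _ = z≤n
  local false false false true  _ = z≤n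
  local false false true  true  _ = z≤n
  local false true  false false _ = ℕP.≤-refl
  local false true  false true  _ = z≤n
  local false true  true  true  _ = z≤n
  local true  false false false _ = ℕP.≤-refl
  local true  false false true  _ = z≤n
  local true  false true  true  _ = z≤n
  local true  true  false false _ = ℕP.≤-refl
  local true  true  false true  _ = ℕP.≤-refl
  local true  true  true  true  _ = z≤n

∣∩∣-incomparable : ∀ (A B X Y : Subset n) → ∣ A ∩ B ∣ ≤ ∣ X ∩ Y ∣ + (∣ A ─ X ∣ + ∣ B ─ Y ∣)
∣∩∣-incomparable {n} A B X Y = begin
  ∣ A ∩ B ∣                                   ≤⟨ SP.p⊆q⇒∣p∣≤∣q∣ covered ⟩
  ∣ (X ∩ Y) ∪ ((A ─ X) ∪ (B ─ Y)) ∣           ≤⟨ rk-∪ (X ∩ Y) _ ⟩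
  ∣ X ∩ Y ∣ + ∣ (A ─ X) ∪ (B ─ Y) ∣           ≤⟨ ℕP.+-monoʳ-≤ ∣ X ∩ Y ∣ (rk-∪ (A ─ X) (B ─ Y)) ⟩
  ∣ X ∩ Y ∣ + (∣ A ─ X ∣ + ∣ B ─ Y ∣)         ∎
  where
  open ℕP.≤-Reasoning
  open Rank (U n) using (rk-∪)
  covered : A ∩ B ⊆ (X ∩ Y) ∪ ((A ─ X) ∪ (B ─ Y))
  covered {e} e∈ with SP.x∈p∩q⁻ A B e∈ | e SP.∈? X | e SP.∈? Y
  ... | e∈A , e∈B | yes e∈X | yes e∈Y = SP.p⊆p∪q _ (SP.x∈p∩q⁺ (e∈X , e∈Y))
  ... | e∈A , e∈B | no e∉X  | _       = SP.q⊆p∪q (X ∩ Y) _ (SP.p⊆p∪q (B ─ Y) (SP.x∈p∧x∉q⇒x∈p─q e∈A e∉X))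
  ... | e∈A , e∈B | yes _   | no e∉Y  = SP.q⊆p∪q (X ∩ Y) _ (SP.q⊆p∪q (A ─ X) (B ─ Y) (SP.x∈p∧x∉q⇒x∈p─q e∈B e∉Y))

─-monoˡ : ∀ {A B : Subset n} C → A ⊆ B → A ─ C ⊆ B ─ C
─-monoˡ {A = A} C A⊆B e∈ = SP.x∈p∧x∉q⇒x∈p─q (A⊆B (SP.p─q⊆p A C e∈)) (∈─⁻ A C e∈)

-- The matroid with cyclic flats ⊥ = Z 0, ⊤ = Z 1 and Z i of rank ρ i, any two of which
-- are nested or have join ⊤ and meet ⊥.
module CyclicFlats {l} (Z : Fin (2 + l) → Subset n) (ρ : Fin (2 + l) → ℕ)
  (Z₀ : Z 0F ≡ Sub.⊥) (ρ₀ : ρ 0F ≡ 0) (Z₁ : Z 1F ≡ Sub.⊤)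
  (nested : ∀ i j → Z i ⊆ Z j ⊎ Z j ⊆ Z i ⊎ ρ 1F + ∣ Z i ∩ Z j ∣ ≤ ρ i + ρ j) where

  bound : Fin (2 + l) → Subset n → ℕ
  bound i A = ρ i + ∣ A ─ Z i ∣

  minimum : ∀ {k} → (Fin (suc k) → ℕ) → ℕ
  minimum {zero}  f = f zero
  minimum {suc k} f = f zero ⊓ minimum (f ∘ suc)

  minimum-≤ : ∀ {k} (f : Fin (suc k) → ℕ) i → minimum f ≤ f i
  minimum-≤ {zero}  f zero    = ℕP.≤-refl
  minimum-≤ {suc k} f zero    = ℕP.m⊓n≤m _ _
  minimum-≤ {suc k} f (suc i) = ℕP.≤-trans (ℕP.m⊓n≤n (f zero) _) (minimum-≤ (f ∘ suc) i)

  minimum-attained : ∀ {k} (f : Fin (suc k) → ℕ) → ∃ λ i → minimum f ≡ f i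
  minimum-attained {zero}  f = zero , refl
  minimum-attained {suc k} f with ℕP.⊓-sel (f zero) (minimum (f ∘ suc)) | minimum-attained (f ∘ suc)
  ... | inj₁ eq | _       = zero , eq
  ... | inj₂ eq | i , eq′ = suc i , trans eq eq′

  -- The standard formula for the rank function of a matroid in terms of its cyclic flats `Z i` and
  -- their ranks `ρ i`.
  rank : Subset n → ℕ
  rank A = minimum (λ i → bound i A)

  rank-attained : ∀ A → ∃ λ i → rank A ≡ bound i A
  rank-attained A = minimum-attained (λ i → bound i A)

  rank-≤ : ∀ i A → rank A ≤ bound i A
  rank-≤ i A = minimum-≤ (λ i → bound i A) i

  rank-≤card : ∀ A → rank A ≤ ∣ A ∣
  rank-≤card A = ℕP.≤-trans (rank-≤ 0F A) (ℕP.≤-reflexive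
    (cong₂ _+_ ρ₀ (trans (cong (λ X → ∣ A ─ X ∣) Z₀) (cong ∣_∣ (SP.p─⊥≡p A)))))

  rank-≤ρ₁ : ∀ A → rank A ≤ ρ 1F
  rank-≤ρ₁ A = ℕP.≤-trans (rank-≤ 1F A) (ℕP.≤-reflexive (trans
    (cong (ρ 1F +_) (trans (cong (λ X → ∣ A ─ X ∣) Z₁) (trans (cong ∣_∣ (SP.p─⊤≡⊥ A)) (SP.∣⊥∣≡0 n))))
    (ℕP.+-identityʳ (ρ 1F))))

  -- Take indices attaining the ranks of `A` and `B`. If their sets are nested, the larger one
  -- bounds the rank of the union and the smaller one that of the intersection. Otherwise the
  -- trivial bounds `ρ 1F` for the union and cardinality for the intersection suffice, by the third
  -- alternative of `nested`.
  rank-submod : ∀ A B → rank (A ∪ B) + rank (A ∩ B) ≤ rank A + rank B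
  rank-submod A B with rank-attained A | rank-attained B
  ... | i , eqA | j , eqB = subst₂ (λ x y → rank (A ∪ B) + rank (A ∩ B) ≤ x + y) (sym eqA) (sym eqB) (go (nested i j))
    where
    open ℕP.≤-Reasoning
    go : Z i ⊆ Z j ⊎ Z j ⊆ Z i ⊎ ρ 1F + ∣ Z i ∩ Z j ∣ ≤ ρ i + ρ j →
         rank (A ∪ B) + rank (A ∩ B) ≤ bound i A + bound j B
    go (inj₁ Zi⊆Zj) = begin
      rank (A ∪ B) + rank (A ∩ B)         ≤⟨ ℕP.+-mono-≤ (rank-≤ j (A ∪ B)) (rank-≤ i (A ∩ B)) ⟩
      bound j (A ∪ B) + bound i (A ∩ B)   ≡⟨ trans (interchange (ρ j) (∣ (A ∪ B) ─ Z j ∣) (ρ i) (∣ (A ∩ B) ─ Z i ∣)) (cong (_+ (∣ (A ∪ B) ─ Z j ∣ + ∣ (A ∩ B) ─ Z i ∣)) (ℕP.+-comm (ρ j) (ρ i))) ⟩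
      (ρ i + ρ j) + (∣ (A ∪ B) ─ Z j ∣ + ∣ (A ∩ B) ─ Z i ∣)
        ≤⟨ ℕP.+-monoʳ-≤ (ρ i + ρ j) (∣─∣-nested A B (Z i) (Z j) Zi⊆Zj) ⟩
      (ρ i + ρ j) + (∣ A ─ Z i ∣ + ∣ B ─ Z j ∣)   ≡⟨ interchange (ρ i) (ρ j) (∣ A ─ Z i ∣) (∣ B ─ Z j ∣) ⟩
      bound i A + bound j B               ∎
    go (inj₂ (inj₁ Zj⊆Zi)) = begin
      rank (A ∪ B) + rank (A ∩ B)         ≡⟨ cong₂ (λ X Y → rank X + rank Y) (SP.∪-comm A B) (SP.∩-comm A B) ⟩
      rank (B ∪ A) + rank (B ∩ A)         ≤⟨ ℕP.+-mono-≤ (rank-≤ i (B ∪ A)) (rank-≤ j (B ∩ A)) ⟩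
      bound i (B ∪ A) + bound j (B ∩ A)   ≡⟨ interchange (ρ i) (∣ (B ∪ A) ─ Z i ∣) (ρ j) (∣ (B ∩ A) ─ Z j ∣) ⟩
      (ρ i + ρ j) + (∣ (B ∪ A) ─ Z i ∣ + ∣ (B ∩ A) ─ Z j ∣)
        ≤⟨ ℕP.+-monoʳ-≤ (ρ i + ρ j) (∣─∣-nested B A (Z j) (Z i) Zj⊆Zi) ⟩
      (ρ i + ρ j) + (∣ B ─ Z j ∣ + ∣ A ─ Z i ∣)   ≡⟨ trans (cong (ρ i + ρ j +_) (ℕP.+-comm (∣ B ─ Z j ∣) (∣ A ─ Z i ∣))) (interchange (ρ i) (ρ j) (∣ A ─ Z i ∣) (∣ B ─ Z j ∣)) ⟩
      bound i A + bound j B               ∎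
    go (inj₂ (inj₂ le)) = begin
      rank (A ∪ B) + rank (A ∩ B)         ≤⟨ ℕP.+-mono-≤ (rank-≤ρ₁ (A ∪ B)) (rank-≤card (A ∩ B)) ⟩
      ρ 1F + ∣ A ∩ B ∣                    ≤⟨ ℕP.+-monoʳ-≤ (ρ 1F) (∣∩∣-incomparable A B (Z i) (Z j)) ⟩
      ρ 1F + (∣ Z i ∩ Z j ∣ + (∣ A ─ Z i ∣ + ∣ B ─ Z j ∣))   ≡⟨ sym (ℕP.+-assoc (ρ 1F) ∣ Z i ∩ Z j ∣ _) ⟩
      (ρ 1F + ∣ Z i ∩ Z j ∣) + (∣ A ─ Z i ∣ + ∣ B ─ Z j ∣)   ≤⟨ ℕP.+-monoˡ-≤ _ le ⟩
      (ρ i + ρ j) + (∣ A ─ Z i ∣ + ∣ B ─ Z j ∣)   ≡⟨ interchange (ρ i) (ρ j) (∣ A ─ Z i ∣) (∣ B ─ Z j ∣) ⟩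
      bound i A + bound j B               ∎

  matroid : Matroid n
  matroid = record
    { rk        = rank
    ; rk-⊥      = ℕP.n≤0⇒n≡0 (ℕP.≤-trans (rank-≤card Sub.⊥) (ℕP.≤-reflexive (SP.∣⊥∣≡0 n)))
    ; rk-mono   = λ {A} {B} A⊆B → let i , eq = rank-attained B in ℕP.≤-trans (rank-≤ i A)
        (ℕP.≤-trans (ℕP.+-monoʳ-≤ (ρ i) (SP.p⊆q⇒∣p∣≤∣q∣ (─-monoˡ (Z i) A⊆B))) (ℕP.≤-reflexive (sym eq)))
    ; rk-submod = rank-submod
    ; rk-≤card  = rank-≤card
    }

  rank-Z : ∀ i → rank (Z i) ≤ ρ i
  rank-Z i = ℕP.≤-trans (rank-≤ i (Z i)) (ℕP.≤-reflexive (trans (cong (ρ i +_) ∣Z─Z∣) (ℕP.+-identityʳ (ρ i))))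
    where
    ∣Z─Z∣ : ∣ Z i ─ Z i ∣ ≡ 0
    ∣Z─Z∣ = ℕP.n≤0⇒n≡0 (ℕP.≤-trans
      (SP.p⊆q⇒∣p∣≤∣q∣ {p = Z i ─ Z i} {Sub.⊥} (λ e∈ → ⊥-elim (∈─⁻ (Z i) (Z i) e∈ (SP.p─q⊆p (Z i) (Z i) e∈))))
      (ℕP.≤-reflexive (SP.∣⊥∣≡0 n)))

  -- Let `Z i` attain the rank of `F`. Removing a point of `F` outside `Z i` lowers the attained
  -- bound, so that point is a coloop. If there is none, `F` lies in `Z i`, and a further point of
  -- `Z i` would not raise the rank, contradicting flatness.
  flat-cyclic-or-coloop : ∀ F → IsFlat matroid F → (∃ λ i → F ≡ Z i) ⊎ (∃ λ e → e ∈ F × rank (F Sub.- e) < rank F)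
  flat-cyclic-or-coloop F flatF with rank-attained F
  ... | i , eq with F SP.⊆? Z i
  ...   | no F⊈Z = let e , e∈F , e∉Z = ⊈⇒∃ F⊈Z in inj₂ (e , e∈F , subst (rank (F Sub.- e) <_) (sym eq)
          (ℕP.≤-<-trans (rank-≤ i (F Sub.- e)) (ℕP.+-monoʳ-< (ρ i) (SP.p⊂q⇒∣p∣<∣q∣
            (─-monoˡ (Z i) (SP.p─q⊆p F ⁅ e ⁆) , e , SP.x∈p∧x∉q⇒x∈p─q e∈F e∉Z ,
             λ e∈ → ∈─⁻ F ⁅ e ⁆ (SP.p─q⊆p (F Sub.- e) (Z i) e∈) (SP.x∈⁅x⁆ e))))))
  ...   | yes F⊆Z with Z i SP.⊆? F
  ...     | yes Z⊆F = inj₁ (i , SP.⊆-antisym F⊆Z Z⊆F)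
  ...     | no Z⊈F  = let e , e∈Z , e∉F = ⊈⇒∃ Z⊈F in ⊥-elim (ℕP.<⇒≱ (flatF e e∉F) (begin
            rank (F ∪ ⁅ e ⁆)   ≤⟨ Matroid.rk-mono matroid (∪-lub F⊆Z (⁅⁆⊆ e∈Z)) ⟩
            rank (Z i)         ≤⟨ rank-Z i ⟩
            ρ i                ≤⟨ ℕP.m≤m+n (ρ i) _ ⟩
            bound i F          ≡⟨ sym eq ⟩
            rank F             ∎))
    where open ℕP.≤-Reasoning

-- The minimal building set of a configuration.

module GminList (M : Matroid n) (C : Configuration M) (loopless : Loopless M) (simple : ∀ e → IsFlat M ⁅ e ⁆)
  (core-flat : ∀ q → IsFlat M (Configuration.coreSet C q))
  (circuit : Fin 10 → Subset n) (basePoint : Fin 10 → Fin n) (basePoint∈ : ∀ q → basePoint q ∈ circuit q)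
  (circuit⊆ : ∀ q → circuit q ⊆ Configuration.coreSet C q)
  (circuit-rank : ∀ q c → c ∈ circuit q → ∣ circuit q ∣ ≤ suc (Matroid.rk M (circuit q Sub.- c)))
  (circuit-size : ∀ q → Matroid.rk M (Configuration.coreSet C q) < ∣ circuit q ∣)
  (core-or-coloop : ∀ F → IsFlat M F → F ≢ Sub.⊥ → (∃ λ q → F ≡ Configuration.coreSet C q) ⊎ (∃ λ e → e ∈ F × Matroid.rk M (F Sub.- e) < Matroid.rk M F)) where

  open Configuration C using (coreSet; building)

  open Closure M using (coloop-decomposable; module Indecomposable)

  building-connected : ∀ F → F ∈ˡ building → IsConnectedFlat M F
  building-connected F F∈ with MP.∈-++⁻ (map coreSet (allFin 10)) F∈
  ... | inj₁ F∈c with MP.∈-map⁻ coreSet {xs = allFin 10} F∈c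
  ...   | q , _ , refl = core-flat q ,
          (λ eq → SP.∉⊥ (subst (basePoint q ∈_) eq (circuit⊆ q (basePoint∈ q)))) ,
          Indecomposable.circuit-indecomposable loopless simple (core-flat q) (circuit q) (basePoint q) (basePoint∈ q)
            (circuit⊆ q) (circuit-rank q) (circuit-size q)
  building-connected F F∈ | inj₂ F∈a with MP.∈-map⁻ ⁅_⁆ {xs = allFin n} F∈a
  ...   | e , _ , refl = simple e , (λ eq → SP.∉⊥ (subst (e ∈_) eq (SP.x∈⁅x⁆ e))) ,
          Indecomposable.atom-indecomposable loopless simple (simple e) refl

  -- A nonempty flat outside the core has a coloop, and unless the flat is that single point, the
  -- coloop splits off.
  connected-building : ∀ F → IsConnectedFlat M F → F ∈ˡ building
  connected-building F (flatF , F≢⊥ , indecomposable) with core-or-coloop F flatF F≢⊥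
  ... | inj₁ (q , refl) = MP.∈-++⁺ˡ (MP.∈-map⁺ coreSet (MP.∈-allFin q))
  ... | inj₂ (e , e∈F , lt) with F SP.⊆? ⁅ e ⁆
  ...   | yes F⊆e = subst (_∈ˡ building) (SP.⊆-antisym (⁅⁆⊆ e∈F) F⊆e)
            (MP.∈-++⁺ʳ (map coreSet (allFin 10)) (MP.∈-map⁺ ⁅_⁆ (MP.∈-allFin e)))
  ...   | no F⊈e = ⊥-elim (indecomposable (coloop-decomposable loopless flatF (simple e) e∈F lt nonempty))
    where
    nonempty : F Sub.- e ≢ Sub.⊥
    nonempty eq = let x , x∈F , x∉e = ⊈⇒∃ F⊈e in
      SP.∉⊥ (subst (x ∈_) eq (SP.x∈p∧x∉q⇒x∈p─q x∈F x∉e))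

  building-isGminList : IsGminList M building
  building-isGminList = Chow.building-unique C , λ F → building-connected F , connected-building F

conclusion : (M : Matroid n) (C : Configuration M) → Loopless M → IsGminList M (Configuration.building C) →
  Σ ℕ λ n → Σ (Matroid n) λ M → Loopless M ×
  Σ (List (Subset n)) λ Gmin → IsGminList M Gmin × ChowNotLogConcave M Gmin
conclusion {n} M C loopless gmin = n , M , loopless , Configuration.building C , gmin , Chow.chow-notLogConcave C

flat? : (M : Matroid n) → ∀ F → Dec (IsFlat M F)
flat? M F = FP.all? λ e → ¬? (e SP.∈? F) →-dec (Matroid.rk M F ℕP.<? Matroid.rk M (F ∪ ⁅ e ⁆))

-- A matroid of rank 10 on 13 points

-- With ranks 4, 7, 10 on 5, 9, 13 points the nullities along the chain are 1, 2, 3. In particular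
-- `G₀` is a circuit.
G₀ H₀ : Subset 13
G₀ = Sub.⊤ {5} V.++ Sub.⊥ {8}
H₀ = Sub.⊤ {9} V.++ Sub.⊥ {4}

-- The complements are {a, b, w} with {a, b} an edge of the complete graph on G₀ and w in H₀ ∖ G₀
-- its colour in a proper edge colouring, so two of them share at most one point.
P₀ : Fin 7 → Subset 13
P₀ 0F = Sub.⊤ Sub.- 0F Sub.- 1F Sub.- 5F
P₀ 1F = Sub.⊤ Sub.- 2F Sub.- 3F Sub.- 5F
P₀ 2F = Sub.⊤ Sub.- 0F Sub.- 2F Sub.- 6F
P₀ 3F = Sub.⊤ Sub.- 1F Sub.- 3F Sub.- 6F
P₀ 4F = Sub.⊤ Sub.- 0F Sub.- 3F Sub.- 7F
P₀ 5F = Sub.⊤ Sub.- 1F Sub.- 2F Sub.- 7F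
P₀ 6F = Sub.⊤ Sub.- 0F Sub.- 4F Sub.- 8F

Z₀ : Fin 11 → Subset 13
Z₀ 0F = Sub.⊥
Z₀ 1F = Sub.⊤
Z₀ 2F = H₀
Z₀ 3F = G₀
Z₀ (suc (suc (suc (suc a)))) = P₀ a

ρ₀ : Fin 11 → ℕ
ρ₀ 0F = 0
ρ₀ 1F = 10
ρ₀ 2F = 7
ρ₀ 3F = 4
ρ₀ (suc (suc (suc (suc a)))) = 9

-- For incomparable pairs the inequality asks that a hyperplane meet `G₀` in at most 3 points, `H₀`
-- in at most 6 and another hyperplane in at most 8. In terms of the three-point complements: at
-- least two points in `G₀`, all three in `H₀`, and at most one point shared by any two. This
-- dictates the shape of `P₀`.
nested₀ : ∀ i j → Z₀ i ⊆ Z₀ j ⊎ Z₀ j ⊆ Z₀ i ⊎ 10 + ∣ Z₀ i ∩ Z₀ j ∣ ≤ ρ₀ i + ρ₀ j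
nested₀ = from-yes (FP.all? λ i → FP.all? λ j →
  (Z₀ i SP.⊆? Z₀ j) ⊎-dec ((Z₀ j SP.⊆? Z₀ i) ⊎-dec (10 + ∣ Z₀ i ∩ Z₀ j ∣ ℕP.≤? ρ₀ i + ρ₀ j)))

open CyclicFlats Z₀ ρ₀ refl refl refl nested₀ using (rank; matroid; flat-cyclic-or-coloop)

configuration : Configuration matroid
configuration = record
  { T = Sub.⊤ ; H = H₀ ; G = G₀ ; P = P₀
  ; G⊆H = from-yes (G₀ SP.⊆? H₀)
  ; H⊆T = SP.⊆⊤
  ; P⊆T = λ _ → SP.⊆⊤
  ; rk-⁅⁆ = from-yes (FP.all? λ e → rank ⁅ e ⁆ ℕP.≟ 1)
  ; 4≤rkG = ℕP.≤-refl
  ; rkG≪rkH = ℕP.≤-refl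
  ; rkH≪rkT = ℕP.≤-refl
  ; rkT = from-yes (FP.all? λ a → 10 ℕP.≟ suc (rank (P₀ a)))
  ; P∨G = from-yes (FP.all? λ a → 10 ℕP.≤? rank (P₀ a ∪ G₀))
  ; P∨P = λ {a} {b} a≢b → [ ⊥-elim ∘ a≢b , (λ h → h) ]′ (pairs a b)
  }
  where
  pairs : ∀ a b → a ≡ b ⊎ 10 ≤ rank (P₀ a ∪ P₀ b)
  pairs = from-yes (FP.all? λ a → FP.all? λ b → (a F.≟ b) ⊎-dec (10 ℕP.≤? rank (P₀ a ∪ P₀ b)))

open Configuration configuration using (coreSet; building)

loopless : Loopless matroid
loopless = from-yes (flat? matroid Sub.⊥)

simple : ∀ e → IsFlat matroid ⁅ e ⁆
simple = from-yes (FP.all? λ e → flat? matroid ⁅ e ⁆)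

core-flat : ∀ q → IsFlat matroid (coreSet q)
core-flat = from-yes (FP.all? λ q → flat? matroid (coreSet q))

-- No P₀ a is contained in circuit 0F, because none of their complements contains {4, 5}.
circuit : Fin 10 → Subset 13
circuit 0F = Sub.⊤ Sub.- 4F Sub.- 5F
circuit 1F = H₀ Sub.- 0F
circuit 2F = G₀
circuit (suc (suc (suc a))) = P₀ a

12F : Fin 13
12F = F.fromℕ 12

basePoint : Fin 10 → Fin 13
basePoint 1F = 1F
basePoint 2F = 1F
basePoint _  = 12F

basePoint∈ : ∀ q → basePoint q ∈ circuit q
basePoint∈ = from-yes (FP.all? λ q → basePoint q SP.∈? circuit q)

circuit⊆ : ∀ q → circuit q ⊆ coreSet q
circuit⊆ = from-yes (FP.all? λ q → circuit q SP.⊆? coreSet q)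

circuit-rank : ∀ q c → c ∈ circuit q → ∣ circuit q ∣ ≤ suc (rank (circuit q Sub.- c))
circuit-rank = from-yes (FP.all? λ q → FP.all? λ c →
  (c SP.∈? circuit q) →-dec (∣ circuit q ∣ ℕP.≤? suc (rank (circuit q Sub.- c))))

circuit-size : ∀ q → rank (coreSet q) < ∣ circuit q ∣
circuit-size = from-yes (FP.all? λ q → rank (coreSet q) ℕP.<? ∣ circuit q ∣)

core-or-coloop : ∀ F → IsFlat matroid F → F ≢ Sub.⊥ →
  (∃ λ q → F ≡ coreSet q) ⊎ (∃ λ e → e ∈ F × rank (F Sub.- e) < rank F)
core-or-coloop F flatF F≢⊥ = Sum.map₁ (λ (i , eq) → core i eq) (flat-cyclic-or-coloop F flatF)
  where
  core : ∀ i → F ≡ Z₀ i → ∃ λ q → F ≡ coreSet q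
  core 0F eq = ⊥-elim (F≢⊥ eq)
  core 1F eq = 0F , eq
  core 2F eq = 1F , eq
  core 3F eq = 2F , eq
  core (suc (suc (suc (suc a)))) eq = suc (suc (suc a)) , eq

matroid-part : Σ ℕ λ n → Σ (Matroid n) λ M → Loopless M ×
  Σ (List (Subset n)) λ Gmin → IsGminList M Gmin × ChowNotLogConcave M Gmin
matroid-part = conclusion matroid configuration loopless
  (GminList.building-isGminList matroid configuration loopless simple core-flat circuit basePoint basePoint∈
    circuit⊆ circuit-rank circuit-size core-or-coloop)

theorem1p6 : (Σ ℕ λ n → Σ (Matroid n) λ M → Loopless M ×
    Σ (List (Subset n)) λ Gmin → IsGminList M Gmin × ChowNotLogConcave M Gmin)
    × (Σ ℕ λ N → ∀ (n : ℕ) → N ≤ n →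
    Σ (List (Subset n)) λ 𝒢 → IsBuildingSet (U n) 𝒢 × ChowNotLogConcave (U n) 𝒢)
theorem1p6 = matroid-part , boolean-part
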